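{- The identity problem and the group problem are undecidable for braids in $B_5$. That is: (i) there is no algorithm which, given a finite set $B \subseteq B_5$ of braids, decides whether the trivial braid belongs to $\langle B \rangle$; and (ii) there is no algorithm which, given a finite set $B \subseteq B_5$, decides whether the semigroup $\langle B \rangle$ is a group.
   Context: $B_5$ is the braid group on five strands, with generators $\sigma_1,\dots,\sigma_4$ and relations $\sigma_i\sigma_j = \sigma_j\sigma_i$ for $|i-j|\ge 2$ and $\sigma_i\sigma_{i+1}\sigma_i = \sigma_{i+1}\sigma_i\sigma_{i+1}$ for $1 \le i \le 3$; braids are given as words over the generators and their inverses. For a finite set $B$ of braids, $\langle B \rangle$ is the semigroup of all nonempty finite products of elements of $B$. The trivial braid is the identity element of $B_5$. -}

module Defs where

open import Data.Nat using (ℕ; zero; suc; _+_; _*_; _≤_)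
open import Data.Nat using (_/_)
open import Data.Fin using (Fin; toℕ)
open import Data.Bool using (Bool; true; false; not)
open import Data.List using (List; []; _∷_; _++_; concat; map)
open import Data.List.Membership.Propositional using (_∈_)
open import Data.List.Relation.Unary.All using (All)
open import Data.Vec using (Vec; []; _∷_)
open import Data.Maybe using (Maybe; just; nothing; _>>=_)
open import Data.Product using (Σ; _×_; _,_; ∃; ∃-syntax)
open import Data.Sum using (_⊎_)
open import Relation.Nullary using (¬_)
open import Relation.Binary.PropositionalEquality using (_≡_)
open import Relation.Binary.Construct.Closure.Equivalence using (EqClosure)

-- A letter: generator index (Fin 4: 0 ↦ σ₁, …, 3 ↦ σ₄) and sign
-- (true = σᵢ, false = σᵢ⁻¹).
record Letter : Set where
  constructor gen
  field
    index : Fin 4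
    pos   : Bool

Word : Set
Word = List Letter

σ : Fin 4 → Letter
σ i = gen i true

-- Elementary relations of the presentation of B₅ (as a monoid
-- presentation on σᵢ, σᵢ⁻¹): free cancellation, far commutativity,
-- braid relation.
data Rel : Word → Word → Set where
  cancel  : ∀ i b → Rel (gen i b ∷ gen i (not b) ∷ []) []
  farComm : ∀ i j → toℕ i + 2 ≤ toℕ j →
            Rel (σ i ∷ σ j ∷ []) (σ j ∷ σ i ∷ [])
  braid   : ∀ i j → toℕ j ≡ suc (toℕ i) →
            Rel (σ i ∷ σ j ∷ σ i ∷ []) (σ j ∷ σ i ∷ σ j ∷ [])

data Step : Word → Word → Set where
  step : ∀ u v l r → Rel l r → Step (u ++ l ++ v) (u ++ r ++ v)

_≈B_ : Word → Word → Set
_≈B_ = EqClosure Step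

ε : Word
ε = []

_∈⟨_⟩ : Word → List Word → Set
x ∈⟨ B ⟩ = Σ Word λ w → Σ (List Word) λ ws →
           w ∈ B × All (_∈ B) ws × (concat (w ∷ ws) ≈B x)

IdentityIn : List Word → Set
IdentityIn B = ε ∈⟨ B ⟩

-- Group problem instance: the semigroup ⟨B⟩ (with the multiplication
-- of B₅, hence associative) is a group: it has an identity element and
-- every element has an inverse in ⟨B⟩.
IsGroupGen : List Word → Set
IsGroupGen B =
  Σ Word λ e → e ∈⟨ B ⟩ ×
    (∀ x → x ∈⟨ B ⟩ →
       ((e ++ x) ≈B x) × ((x ++ e) ≈B x) ×
       (Σ Word λ y → y ∈⟨ B ⟩ × ((x ++ y) ≈B e) × ((y ++ x) ≈B e)))

-- Model of computation: μ-recursive functions with a fuel-indexed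
-- evaluator (an algorithm halts on input xs with output y iff
-- eval n c xs ≡ just y for some fuel n).

data Code : ℕ → Set where
  Z    : ∀ {n} → Code n
  S    : Code 1
  proj : ∀ {n} → Fin n → Code n
  comp : ∀ {m n} → Code m → Vec (Code n) m → Code n
  prec : ∀ {n} → Code n → Code (suc (suc n)) → Code (suc n)
  mu   : ∀ {n} → Code (suc n) → Code n

lookupV : ∀ {A : Set} {n} → Vec A n → Fin n → A
lookupV (x ∷ xs) Fin.zero    = x
lookupV (x ∷ xs) (Fin.suc i) = lookupV xs i

mutual
  eval : ℕ → ∀ {n} → Code n → Vec ℕ n → Maybe ℕ
  eval zero    c          xs           = nothing
  eval (suc f) Z          xs           = just 0
  eval (suc f) S          (x ∷ [])     = just (suc x)
  eval (suc f) (proj i)   xs           = just (lookupV xs i)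
  eval (suc f) (comp g hs) xs          = evalVec f hs xs >>= eval f g
  eval (suc f) (prec g h) (zero ∷ xs)  = eval f g xs
  eval (suc f) (prec g h) (suc k ∷ xs) =
    eval f (prec g h) (k ∷ xs) >>= λ r → eval f h (k ∷ r ∷ xs)
  eval (suc f) (mu g)     xs           = search f g xs 0

  evalVec : ℕ → ∀ {m n} → Vec (Code n) m → Vec ℕ n → Maybe (Vec ℕ m)
  evalVec f []       xs = just []
  evalVec f (h ∷ hs) xs =
    eval f h xs >>= λ y → evalVec f hs xs >>= λ ys → just (y ∷ ys)

  search : ℕ → ∀ {n} → Code (suc n) → Vec ℕ n → ℕ → Maybe ℕ
  search zero    g xs i = nothing
  search (suc f) g xs i with eval f g (i ∷ xs)
  ... | nothing      = nothing
  ... | just zero    = just i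
  ... | just (suc _) = search f g xs (suc i)

-- Cantor pairing
pair : ℕ → ℕ → ℕ
pair x y = ((x + y) * suc (x + y)) / 2 + y

encLetter : Letter → ℕ
encLetter (gen i true)  = 2 * toℕ i
encLetter (gen i false) = suc (2 * toℕ i)

encList : ∀ {A : Set} → (A → ℕ) → List A → ℕ
encList e []       = 0
encList e (x ∷ xs) = suc (pair (e x) (encList e xs))

encWord : Word → ℕ
encWord = encList encLetter

encSet : List Word → ℕ
encSet = encList encWord

Decides : Code 1 → (List Word → Set) → Set
Decides c P = ∀ B → ∃[ n ]
  ((eval n c (encSet B ∷ []) ≡ just 1 × P B) ⊎
   (eval n c (encSet B ∷ []) ≡ just 0 × ¬ P B))

{-# OPTIONS --safe #-}

-- B₅ contains F × F for F free of infinite rank: the first factor lives in ⟨ σ₁ , σ₂ ⟩, the second in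
-- ⟨ σ₄ , δ ⟩, where strand 5 of the pure braid δ encircles all others.  Forgetting all strands but
-- 1, 2, 3 or 1, 4, 5 recovers the two components, and PSL(2,ℤ) = Z/2 * Z/3 acts on its normal forms
-- by ping-pong, so that only trivial pairs are mapped to the trivial braid.
--
-- A computation is encoded as a Post correspondence w # v(α) = u(α) H #.  The generators of F × F
-- are edges a → b of a graph, with components a⁻¹ x b.  A tour of its cycle writes (e , v(e)) for the
-- letters e of a word α, then erases (e⁻¹ , u(e)⁻¹) for those of a word β; a trivial block, with both
-- contributions equal to 1, is a solution of the correspondence.  An identity need not be a tour:
-- cancellations can be nested differently in the two components.  Therefore the cycle consists of six
-- copies of the tour, whose contributions are separated by brackets.  Planarity of the cancellation
-- in one component implies that of all blocks started in an identity, fewer than half are interrupted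
-- or non-trivial in that component.  Hence some block is trivial in both components.
--
-- The correspondence simulates string rewriting, which simulates counter machines, into which
-- μ-recursive functions are compiled.  Once the halting symbol H is reached it may create any word,
-- so that every generator occurs in some identity and the semigroup is a group.  As only six
-- generators depend on the input, an instance is easily computed from the code of the remaining
-- ones, and a decider can be run on the instance describing that very run.
module Submission where

open import Defs
open import Data.Product using (_×_; ∃-syntax)
open import Relation.Nullary using (¬_)
open import Data.Bool using (Bool; true; false; not)
open import Data.Bool.Properties using (not-involutive)
open import Data.Empty using (⊥-elim; ⊥)
open import Data.Nat using (ℕ; zero; suc; _+_; _*_; _≤_; z≤n; s≤s; _∸_; _<_)
open import Data.Fin using (Fin; zero; suc; toℕ; #_)
open import Data.Maybe using (Maybe; just; nothing)
open import Data.List using (List; []; _∷_; _++_; map; concatMap; replicate; reverse; length; concat; allFin)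
open import Data.List.Properties using (++-assoc; ++-identityʳ; ∷-injectiveˡ; ∷-injectiveʳ; concatMap-++; length-++; length-map; reverse-involutive; map-++; reverse-++; unfold-reverse; concat-++; map-∘; map-cong)
open import Data.List.Relation.Unary.All using (All; []; _∷_)
open import Data.List.Relation.Unary.Any using (index; here; there)
open import Data.List.Membership.Propositional using (_∈_; _∉_)
open import Data.List.Membership.Propositional.Properties using (∈-++⁺ʳ; ∈-++⁺ˡ; ∈-++⁻; ∈-map⁺; ∈-map⁻; ∈-concatMap⁺; ∈-concatMap⁻; ∈-∃++; ∈-allFin)
open import Data.Vec using (Vec; []; _∷_)
open import Data.Product using (_,_; proj₂; proj₁; Σ)
open import Data.Sum using (_⊎_; inj₁; inj₂)
open import Relation.Nullary using (Dec; yes; no)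
open import Relation.Binary.PropositionalEquality using (_≡_; refl; sym; trans; cong; cong₂; subst; _≢_; subst₂; module ≡-Reasoning)
open import Function using (_∘_; id)
import Data.List.Relation.Unary.All.Properties as Allₚ
import Data.List.Properties as Listₚ
import Data.List.Relation.Unary.All as All
import Data.List.Relation.Unary.Any as Any

-- The obstacle is that a product trivial in both factors carries two unrelated planar matchings.
-- Counting overcomes it: if each matching spoils fewer than half of the blocks, some block survives
-- both. Six is the price of this count. A circuit of `6 (w + 1)` blocks has at most `2 w`
-- non-trivial ones, one more may stay unclosed at its end, one may be cut when the circuit is
-- rotated, and `Bound` keeps one unit in reserve for later insertions. The total `2 w + 3` is at
-- most half of `6 (w + 1)`, with equality for `w = 0`, so fewer kinds would not do for this count.
-- The component that records the letters themselves is what forces `β` to be `α` reversed; the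
-- other one alone would only compare `v(α)` with the contributions of an unrelated `β`. The
-- self-reference at the end is not circular because the six input-dependent generators mention no
-- rule of the rewriting system. One code thus assembles instances for all programs and can itself
-- be part of the program that defines the remaining generators.

++-split : ∀ {A : Set} (u : List A) {v x y : List A} {a : A} → u ++ v ≡ x ++ a ∷ y →
  (∃[ y′ ] u ≡ x ++ a ∷ y′ × y ≡ y′ ++ v) ⊎ (∃[ x′ ] x ≡ u ++ x′ × v ≡ x′ ++ a ∷ y)
++-split [] {x = x} eq = inj₂ (x , refl , eq)
++-split (b ∷ u) {x = []} refl = inj₁ (u , refl , refl)
++-split (b ∷ u) {x = c ∷ x} eq with ∷-injectiveˡ eq | ++-split u (∷-injectiveʳ eq)
... | refl | inj₁ (y′ , p , q) = inj₁ (y′ , cong (b ∷_) p , q)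
... | refl | inj₂ (x′ , p , q) = inj₂ (x′ , cong (b ∷_) p , q)

-- Signed words and triviality in a free group

data Signed (X : Set) : Set where
  pos neg : X → Signed X

inv : ∀ {X} → Signed X → Signed X
inv (pos x) = neg x
inv (neg x) = pos x

inv-involutive : ∀ {X} (a : Signed X) → inv (inv a) ≡ a
inv-involutive (pos x) = refl
inv-involutive (neg x) = refl

SWord : Set → Set
SWord X = List (Signed X)

-- Triviality in the free group, witnessed by a non-crossing matching of the letters.
data Triv {X : Set} : SWord X → Set where
  nil  : Triv []
  node : ∀ a {u v} → Triv u → Triv v → Triv (a ∷ u ++ inv a ∷ v)

module _ {X : Set} where

  triv-++ : {u v : SWord X} → Triv u → Triv v → Triv (u ++ v)
  triv-++ nil t = t
  triv-++ {v = w} (node a {u} {v} p q) t =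
    subst Triv (cong (a ∷_) (sym (++-assoc u (inv a ∷ v) w))) (node a p (triv-++ q t))

  triv-insert : ∀ (u : SWord X) {v I} → Triv (u ++ v) → Triv I → Triv (u ++ I ++ v)
  triv-insert u t i = go t u refl i
    where
    go : ∀ {w} → Triv w → ∀ (u : SWord X) {v I} → w ≡ u ++ v → Triv I → Triv (u ++ I ++ v)
    go t [] refl i = triv-++ i t
    go (node a {u} {v} p q) (b ∷ x) {y} {I} eq i with ∷-injectiveˡ eq | ++-split x (sym (∷-injectiveʳ eq))
    ... | refl | inj₁ (y′ , refl , refl) =
      subst Triv (cong (a ∷_) (sym (++-assoc u (inv a ∷ y′) (I ++ y)))) (node a p (go q y′ refl i))
    ... | refl | inj₂ (x′ , refl , refl) =
      subst Triv (cong (a ∷_) eq′) (node a (go p x refl i) q)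
      where
      eq′ : (x ++ I ++ x′) ++ inv a ∷ v ≡ x ++ I ++ x′ ++ inv a ∷ v
      eq′ = trans (++-assoc x (I ++ x′) _) (cong (x ++_) (++-assoc I x′ _))

  Match : (M : SWord X) (a : Signed X) (W : SWord X) → Set
  Match M a W =
    (∃[ I ] ∃[ V ] W ≡ I ++ inv a ∷ V × Triv I × Triv (M ++ V)) ⊎
    (∃[ M′ ] ∃[ I ] M ≡ M′ ++ inv a ∷ I × Triv I × Triv (M′ ++ W))

  -- Planarity in usable form: deleting the arch from `a` to its partner, contents included, leaves
  -- a trivial word. In the recursion `a` is the first letter, its partner, or lies inside or after
  -- the outer arch.
  triv-match : ∀ (M : SWord X) {a W} → Triv (M ++ a ∷ W) → Match M a W
  triv-match M t = go t M refl
    where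
    go : ∀ {w} → Triv w → ∀ (M : SWord X) {a W} → w ≡ M ++ a ∷ W → Match M a W
    go nil [] ()
    go nil (x ∷ M) ()
    go (node a p q) [] refl = inj₁ (_ , _ , refl , p , q)
    go (node a {u} {v} p q) (b ∷ x) {c} {y} eq with ∷-injectiveˡ eq | ++-split u (∷-injectiveʳ eq)
    ... | refl | inj₁ (y′ , refl , refl) with go p x refl
    ...   | inj₁ (I , V , refl , i , m) = inj₁ (I , V ++ inv a ∷ v , ++-assoc I _ _ , i ,
              subst Triv (cong (a ∷_) (++-assoc x V _)) (node a m q))
    ...   | inj₂ (M′ , I , refl , i , m) = inj₂ (a ∷ M′ , I , refl , i ,
              subst Triv (cong (a ∷_) (++-assoc M′ y′ _)) (node a m q))
    go (node a {u} {v} p q) (b ∷ x) {c} {y} eq | refl | inj₂ ([] , refl , refl) =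
      inj₂ ([] , u , cong₂ _∷_ (sym (inv-involutive a)) (++-identityʳ u) , p , q)
    go (node a {u} {v} p q) (b ∷ x) {c} {y} eq | refl | inj₂ (d ∷ x′ , refl , e)
      with ∷-injectiveˡ e | ∷-injectiveʳ e
    ... | refl | refl with go q x′ refl
    ...   | inj₁ (I , V , refl , i , m) = inj₁ (I , V , refl , i ,
              subst Triv (cong (a ∷_) (sym (++-assoc u (inv a ∷ x′) V))) (node a p m))
    ...   | inj₂ (M′ , I , refl , i , m) = inj₂ (a ∷ u ++ inv a ∷ M′ , I ,
              cong (a ∷_) (sym (++-assoc u (inv a ∷ M′) _)) , i ,
              subst Triv (cong (a ∷_) (sym (++-assoc u (inv a ∷ M′) y))) (node a p m))

  -- Once the arch `a I a⁻¹` is removed, `V` remains trivial, and so is its conjugate `a⁻¹ V a`,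
  -- which follows `I` in the rotated word.
  triv-rotate₁ : ∀ a {w : SWord X} → Triv (a ∷ w) → Triv (w ++ a ∷ [])
  triv-rotate₁ a {w} t with triv-match [] t
  ... | inj₂ ([] , _ , () , _)
  ... | inj₂ (_ ∷ _ , _ , () , _)
  ... | inj₁ (I , V , refl , i , m) = subst Triv (sym (++-assoc I (inv a ∷ V) _))
        (triv-++ i (subst (λ z → Triv (inv a ∷ V ++ z ∷ [])) (inv-involutive a) (node (inv a) m nil)))

  triv-rotate : ∀ (u : SWord X) {v} → Triv (u ++ v) → Triv (v ++ u)
  triv-rotate [] {v} t = subst Triv (sym (++-identityʳ v)) t
  triv-rotate (a ∷ u) {v} t = subst Triv (++-assoc v (a ∷ []) u)
    (triv-rotate u (subst Triv (++-assoc u v (a ∷ [])) (triv-rotate₁ a t)))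

  data IsPos : Signed X → Set where
    pos : ∀ x → IsPos (pos x)

  data IsNeg : Signed X → Set where
    neg : ∀ x → IsNeg (neg x)

  triv-positive : {w : SWord X} → All IsPos w → Triv w → w ≡ []
  triv-positive p nil = refl
  triv-positive p (node a {u} t s) with p
  ... | pos x ∷ p′ with Allₚ.++⁻ʳ u p′
  ...   | () ∷ _

  triv-negative : {w : SWord X} → All IsNeg w → Triv w → w ≡ []
  triv-negative p nil = refl
  triv-negative p (node a {u} t s) with p
  ... | neg x ∷ p′ with Allₚ.++⁻ʳ u p′
  ...   | () ∷ _

  -- A factorisation t₀ a₁ t₁ … aₙ tₙ of w with trivial tᵢ and reduced form a₁ … aₙ.
  data Reduction : SWord X → SWord X → Set where
    done : ∀ {w} → Triv w → Reduction w []
    next : ∀ {u a v r} → Triv u → Reduction v r → Reduction (u ++ a ∷ v) (a ∷ r)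

  reduction-prepend : ∀ {u v r} → Triv u → Reduction v r → Reduction (u ++ v) r
  reduction-prepend t (done s) = done (triv-++ t s)
  reduction-prepend {u} t (next {u′} {a} {v} s d) =
    subst (λ z → Reduction z _) (++-assoc u u′ (a ∷ v)) (next (triv-++ t s) d)

-- Ping-pong for a free group of infinite rank in PSL(2,ℤ)

module PingPong where

  open import Data.Nat.Properties
  open import Relation.Binary.Definitions using (tri<; tri≈; tri>)

  iter : ∀ {A : Set} → ℕ → (A → A) → A → A
  iter zero f x = x
  iter (suc n) f x = f (iter n f x)

  iter-comm : ∀ {A : Set} n (f : A → A) x → iter n f (f x) ≡ f (iter n f x)
  iter-comm zero f x = refl
  iter-comm (suc n) f x = cong f (iter-comm n f x)

  iter-+ : ∀ {A : Set} m n (f : A → A) x → iter (m + n) f x ≡ iter m f (iter n f x)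
  iter-+ zero n f x = refl
  iter-+ (suc m) n f x = cong f (iter-+ m n f x)

  iter-inverse : ∀ {A : Set} {f g : A → A} → (∀ x → f (g x) ≡ x) → ∀ n x → iter n f (iter n g x) ≡ x
  iter-inverse e zero x = refl
  iter-inverse {f = f} {g} e (suc n) x =
    trans (sym (iter-comm n f _)) (trans (cong (iter n f) (e _)) (iter-inverse e n x))

  -- Normal forms of Z/2 * Z/3 = ⟨ s ⟩ * ⟨ t ⟩ not starting with s; true stands for t, false for t⁻¹.
  data Tail : Set where
    ∅    : Tail
    end  : Bool → Tail
    _·s_ : Bool → Tail → Tail

  infixr 5 _·s_

  -- (true , w) is the normal form s w.
  Ω : Set
  Ω = Bool × Tail

  -- Left multiplications on normal forms. When `t` cancels a leading `t⁻¹`, the letter `s` behind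
  -- it comes to the front and is recorded by the flag.
  s t t⁻ : Ω → Ω
  s (b , w) = not b , w

  t (true , w)             = false , true ·s w
  t (false , ∅)            = false , end true
  t (false , end true)     = false , end false
  t (false , end false)    = false , ∅
  t (false , true ·s w)    = false , false ·s w
  t (false , false ·s w)   = true , w

  t⁻ (true , w)            = false , false ·s w
  t⁻ (false , ∅)           = false , end false
  t⁻ (false , end false)   = false , end true
  t⁻ (false , end true)    = false , ∅
  t⁻ (false , false ·s w)  = false , true ·s w
  t⁻ (false , true ·s w)   = true , w

  s-s : ∀ ω → s (s ω) ≡ ω
  s-s (b , w) = cong (_, w) (not-involutive b)

  t-t⁻ : ∀ ω → t (t⁻ ω) ≡ ω
  t-t⁻ (true , w)            = refl
  t-t⁻ (false , ∅)           = refl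
  t-t⁻ (false , end false)   = refl
  t-t⁻ (false , end true)    = refl
  t-t⁻ (false , false ·s w)  = refl
  t-t⁻ (false , true ·s w)   = refl

  t⁻-t⁻ : ∀ ω → t⁻ (t⁻ ω) ≡ t ω
  t⁻-t⁻ (true , w)            = refl
  t⁻-t⁻ (false , ∅)           = refl
  t⁻-t⁻ (false , end false)   = refl
  t⁻-t⁻ (false , end true)    = refl
  t⁻-t⁻ (false , false ·s w)  = refl
  t⁻-t⁻ (false , true ·s w)   = refl

  t⁻-t : ∀ ω → t⁻ (t ω) ≡ ω
  t⁻-t (true , w)            = refl
  t⁻-t (false , ∅)           = refl
  t⁻-t (false , end false)   = refl
  t⁻-t (false , end true)    = refl
  t⁻-t (false , false ·s w)  = refl
  t⁻-t (false , true ·s w)   = refl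

  -- The quotient B₃ → PSL(2,ℤ) = Z/2 * Z/3.
  s₁ s₁⁻ s₂ s₂⁻ : Ω → Ω
  s₁  = t⁻ ∘ s
  s₁⁻ = s ∘ t
  s₂  = s ∘ t⁻
  s₂⁻ = t ∘ s

  s₁-s₁⁻ : ∀ ω → s₁ (s₁⁻ ω) ≡ ω
  s₁-s₁⁻ ω = trans (cong t⁻ (s-s (t ω))) (t⁻-t ω)

  s₁⁻-s₁ : ∀ ω → s₁⁻ (s₁ ω) ≡ ω
  s₁⁻-s₁ ω = trans (cong s (t-t⁻ (s ω))) (s-s ω)

  s₂-s₂⁻ : ∀ ω → s₂ (s₂⁻ ω) ≡ ω
  s₂-s₂⁻ ω = trans (cong s (t⁻-t (s ω))) (s-s ω)

  s₂⁻-s₂ : ∀ ω → s₂⁻ (s₂ ω) ≡ ω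
  s₂⁻-s₂ ω = trans (cong t (s-s (t⁻ ω))) (t-t⁻ ω)

  s₁s₂s₁ : ∀ ω → s₁ (s₂ (s₁ ω)) ≡ s ω
  s₁s₂s₁ ω = begin
    t⁻ (s (s (t⁻ (t⁻ (s ω)))))  ≡⟨ cong t⁻ (s-s (t⁻ (t⁻ (s ω)))) ⟩
    t⁻ (t⁻ (t⁻ (s ω)))          ≡⟨ cong t⁻ (t⁻-t⁻ (s ω)) ⟩
    t⁻ (t (s ω))                ≡⟨ t⁻-t (s ω) ⟩
    s ω                         ∎
    where open ≡-Reasoning

  s₂s₁s₂ : ∀ ω → s₂ (s₁ (s₂ ω)) ≡ s ω
  s₂s₁s₂ ω = cong s (begin
    t⁻ (t⁻ (s (s (t⁻ ω))))  ≡⟨ cong (t⁻ ∘ t⁻) (s-s (t⁻ ω)) ⟩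
    t⁻ (t⁻ (t⁻ ω))          ≡⟨ cong t⁻ (t⁻-t⁻ ω) ⟩
    t⁻ (t ω)                ≡⟨ t⁻-t ω ⟩
    ω                       ∎)
    where open ≡-Reasoning

  -- The full twist `σ₂ σ₁² σ₂ σ₁²` is central in B₃ and so vanishes in PSL(2,ℤ). The left side is
  -- what remains of `δ` when strands 2 and 3 are forgotten; this is why `left` uses `σ₁⁻²`, so that
  -- both factors act by the same `gen-act`.
  s₂s₁s₁s₂ : ∀ ω → s₂ (s₁ (s₁ (s₂ ω))) ≡ s₁⁻ (s₁⁻ ω)
  s₂s₁s₁s₂ ω = cong s (begin
    t⁻ (t⁻ (s (t⁻ (s (s (t⁻ ω))))))  ≡⟨ t⁻-t⁻ (s (t⁻ (s (s (t⁻ ω))))) ⟩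
    t (s (t⁻ (s (s (t⁻ ω)))))        ≡⟨ cong (t ∘ s ∘ t⁻) (s-s (t⁻ ω)) ⟩
    t (s (t⁻ (t⁻ ω)))                ≡⟨ cong (t ∘ s) (t⁻-t⁻ ω) ⟩
    t (s (t ω))                      ∎)
    where open ≡-Reasoning

  t-t : ∀ ω → t (t ω) ≡ t⁻ ω
  t-t (true , w)            = refl
  t-t (false , ∅)           = refl
  t-t (false , end true)    = refl
  t-t (false , end false)   = refl
  t-t (false , true ·s w)   = refl
  t-t (false , false ·s w)  = refl

  s₂⁻s₁⁻s₁⁻s₂⁻ : ∀ ω → s₂⁻ (s₁⁻ (s₁⁻ (s₂⁻ ω))) ≡ s₁ (s₁ ω)
  s₂⁻s₁⁻s₁⁻s₂⁻ ω = begin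
    t (s (s (t (s (t (t (s ω)))))))  ≡⟨ cong t (s-s (t (s (t (t (s ω)))))) ⟩
    t (t (s (t (t (s ω)))))          ≡⟨ t-t (s (t (t (s ω)))) ⟩
    t⁻ (s (t (t (s ω))))             ≡⟨ cong (t⁻ ∘ s) (t-t (s ω)) ⟩
    t⁻ (s (t⁻ (s ω)))                ∎
    where open ≡-Reasoning

  -- Number of factors s t⁻¹ in front of s t.
  data Lead : ℕ → Tail → Set where
    stop-s   : ∀ {w} → Lead 0 (true ·s w)
    stop-end : Lead 0 (end true)
    more     : ∀ {n w} → Lead n w → Lead (suc n) (false ·s w)

  -- Equivalently, `ω` is `s₂ⁿ` applied to a normal form starting with `s t`, since `s₂` multiplies
  -- by `s t⁻¹`.
  Region : ℕ → Ω → Set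
  Region n ω = ∃[ w ] ω ≡ (true , w) × Lead n w

  climb : ∀ n {j ω} → Region j ω → Region (n + j) (iter n s₂ ω)
  climb zero r = r
  climb (suc n) r with climb n r
  ... | w , e , l = false ·s w , cong s₂ e , more l

  descend : ∀ n {j ω} → Region (n + j) ω → Region j (iter n s₂⁻ ω)
  descend zero r = r
  descend (suc n) (_ , refl , more {w = w} l) =
    subst (Region _) (iter-comm n s₂⁻ _) (descend n (w , refl , l))

  Edge Far : Ω → Set
  Edge ω = ∃[ w ] ω ≡ (false , w)
  Far ω = ∃[ w ] ω ≡ (false , true ·s w)

  fall : ∀ {ω} → Region 0 ω → Edge (s₂⁻ ω)
  fall (_ , refl , stop-s) = _ , refl
  fall (_ , refl , stop-end) = _ , refl

  fall-further : ∀ {ω} → Edge ω → Far (s₂⁻ ω)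
  fall-further (_ , refl) = _ , refl

  far-iter : ∀ n {ω} → Far ω → Far (iter n s₂⁻ ω)
  far-iter zero f = f
  far-iter (suc n) f with far-iter n f
  ... | _ , e = fall-further (_ , e)

  gen-act : Signed ℕ → Ω → Ω
  gen-act (pos k) = iter (2 + k * 2) s₂ ∘ s₁⁻ ∘ s₁⁻ ∘ iter (2 + k * 2) s₂⁻
  gen-act (neg k) = iter (2 + k * 2) s₂ ∘ s₁ ∘ s₁ ∘ iter (2 + k * 2) s₂⁻

  -- Index of the ping-pong set of a letter. Even indices belong to positive letters and odd ones to
  -- negative letters, which makes the sets disjoint; hence the exponents in `gen-act` grow in steps
  -- of two. The square of `s₁` absorbs one factor, so `neg k` comes out one lower than `pos k`.
  lead : Signed ℕ → ℕ
  lead (pos k) = 2 + k * 2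
  lead (neg k) = 1 + k * 2

  ω₀ : Ω
  ω₀ = false , ∅

  r-near : ∀ {j ω} → Region j ω → Region 0 (s₁⁻ (s₁⁻ ω))
  r-near (_ , refl , _) = _ , refl , stop-s

  r-far : ∀ {ω} → Far ω → Region 0 (s₁⁻ (s₁⁻ ω))
  r-far (_ , refl) = _ , refl , stop-s

  r⁻-near : ∀ {j ω} → Region (suc j) ω → Region 0 (s₂ (s₁ (s₁ ω)))
  r⁻-near (_ , refl , more _) = _ , refl , stop-s

  r⁻-edge : ∀ {ω} → Edge ω → Region 0 (s₂ (s₁ (s₁ ω)))
  r⁻-edge (_ , refl) = _ , refl , stop-s

  finish-pos : ∀ k {ω} → Region 0 (s₁⁻ (s₁⁻ (iter (2 + k * 2) s₂⁻ ω))) → Region (lead (pos k)) (gen-act (pos k) ω)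
  finish-pos k {ω} r = subst (λ n → Region n (gen-act (pos k) ω)) (+-identityʳ _) (climb (2 + k * 2) r)

  finish-neg : ∀ k {ω} → Region 0 (s₂ (s₁ (s₁ (iter (2 + k * 2) s₂⁻ ω)))) → Region (lead (neg k)) (gen-act (neg k) ω)
  -- The innermost `s₂` already belongs to the hypothesis, so only `1 + k * 2` climbs are left.
  finish-neg k r = subst₂ Region (+-identityʳ _) (iter-comm (1 + k * 2) s₂ _) (climb (1 + k * 2) r)

  -- The first `n` applications of `s₂⁻` strip leading factors. One more falls off the regions, to
  -- some normal form not starting with `s`; from the next one on the result starts with `t s`.
  data Position (N : ℕ) (ω : Ω) (n : ℕ) : Set where
    near : ∀ j → n ≡ N + j → Region j (iter N s₂⁻ ω) → Position N ω n
    edge : N ≡ suc n → Edge (iter N s₂⁻ ω) → Position N ω n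
    far  : Far (iter N s₂⁻ ω) → Position N ω n

  position : ∀ N {n ω} → Region n ω → Position N ω n
  position N {n} {ω} r with <-cmp N n
  ... | tri≈ _ refl _ = near 0 (sym (+-identityʳ N)) (descend N (subst (λ n → Region n ω) (sym (+-identityʳ N)) r))
  ... | tri< N<n _ _ with m≤n⇒∃[o]m+o≡n (<⇒≤ N<n)
  ...   | j , refl = near j refl (descend N r)
  position N {n} {ω} r | tri> _ _ n<N with m≤n⇒∃[o]m+o≡n n<N
  ... | j , refl = go j
    where
    e : Edge (iter (suc n) s₂⁻ ω)
    e = fall (descend n (subst (λ n → Region n ω) (sym (+-identityʳ n)) r))
    go : ∀ j → Position (suc n + j) ω n
    go zero = edge (cong suc (+-identityʳ n)) (subst (λ m → Edge (iter m s₂⁻ ω)) (sym (+-identityʳ (suc n))) e)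
    go (suc j) = far (subst (λ m → Far (iter m s₂⁻ ω)) (trans (cong suc (+-comm j (suc n))) (sym (+-suc (suc n) j)))
      (subst Far (sym (iter-+ (suc j) (suc n) s₂⁻ ω)) (far′ j)))
      where
      far′ : ∀ j → Far (iter (suc j) s₂⁻ (iter (suc n) s₂⁻ ω))
      far′ j = subst Far (iter-comm j s₂⁻ _) (far-iter j (fall-further e))

  -- The squares in the middle of `gen-act` can miss their target at a single depth: one step past
  -- the lead of `b` for `pos k`, exactly at the lead for `neg k`. Parity and size of the exponent
  -- show that `b` is then the inverse letter.
  ping-pong : ∀ a {b ω} → b ≢ inv a → Region (lead b) ω → Region (lead a) (gen-act a ω)
  ping-pong (pos k) {b} b≢ r with position (2 + k * 2) r
  ... | near j _ r′ = finish-pos k (r-near r′)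
  ... | far f       = finish-pos k (r-far f)
  ... | edge e _    = ⊥-elim (b≢ (go b e))
    where
    go : ∀ b → 2 + k * 2 ≡ suc (lead b) → b ≡ neg k
    go (neg l) e = cong neg (sym (*-cancelʳ-≡ k l 2 (suc-injective (suc-injective e))))
    go (pos l) e = ⊥-elim (even≢odd k l (trans (*-comm 2 k) (trans (suc-injective (suc-injective e)) (cong suc (*-comm l 2)))))
  ping-pong (neg k) {b} b≢ r with position (2 + k * 2) r
  ... | near (suc j) _ r′ = finish-neg k (r⁻-near r′)
  ... | near zero e _     = ⊥-elim (b≢ (go b (trans e (+-identityʳ _))))
    where
    go : ∀ b → lead b ≡ 2 + k * 2 → b ≡ pos k
    go (pos l) e = cong pos (*-cancelʳ-≡ l k 2 (suc-injective (suc-injective e)))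
    go (neg l) e = ⊥-elim (even≢odd l k (trans (*-comm 2 l) (trans (suc-injective e) (cong suc (*-comm k 2)))))
  ... | far (_ , f)       = finish-neg k (r⁻-edge (_ , f))
  ... | edge _ f          = finish-neg k (r⁻-edge f)

  far-ω₀ : ∀ n → Far (iter (2 + n) s₂⁻ ω₀)
  far-ω₀ zero = _ , refl
  far-ω₀ (suc n) with far-ω₀ n
  ... | _ , e = fall-further (_ , e)

  ping : ∀ a → Region (lead a) (gen-act a ω₀)
  ping (pos k) = finish-pos k (r-far (far-ω₀ (k * 2)))
  ping (neg k) = finish-neg k (r⁻-edge (_ , proj₂ (far-ω₀ (k * 2))))

  conjugate-cancel : ∀ {A : Set} (P P⁻ f g : A → A) → (∀ x → P⁻ (P x) ≡ x) → (∀ x → P (P⁻ x) ≡ x) →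
    (∀ x → f (g x) ≡ x) → ∀ x → P (f (f (P⁻ (P (g (g (P⁻ x))))))) ≡ x
  conjugate-cancel P P⁻ f g P⁻P PP⁻ fg x =
    trans (cong (P ∘ f ∘ f) (P⁻P _)) (trans (cong (P ∘ f) (fg _)) (trans (cong P (fg _)) (PP⁻ x)))

  gen-act-inv : ∀ a ω → gen-act a (gen-act (inv a) ω) ≡ ω
  gen-act-inv (pos k) = conjugate-cancel (iter (2 + k * 2) s₂) (iter (2 + k * 2) s₂⁻) s₁⁻ s₁
    (iter-inverse {f = s₂⁻} {s₂} s₂⁻-s₂ (2 + k * 2)) (iter-inverse {f = s₂} {s₂⁻} s₂-s₂⁻ (2 + k * 2)) s₁⁻-s₁
  gen-act-inv (neg k) = conjugate-cancel (iter (2 + k * 2) s₂) (iter (2 + k * 2) s₂⁻) s₁ s₁⁻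
    (iter-inverse {f = s₂⁻} {s₂} s₂⁻-s₂ (2 + k * 2)) (iter-inverse {f = s₂} {s₂⁻} s₂-s₂⁻ (2 + k * 2)) s₁-s₁⁻

  word-act : SWord ℕ → Ω → Ω
  word-act [] ω = ω
  word-act (a ∷ w) ω = gen-act a (word-act w ω)

  word-act-++ : ∀ u v ω → word-act (u ++ v) ω ≡ word-act u (word-act v ω)
  word-act-++ [] v ω = refl
  word-act-++ (a ∷ u) v ω = cong (gen-act a) (word-act-++ u v ω)

  triv-act : ∀ {w} → Triv w → ∀ ω → word-act w ω ≡ ω
  triv-act nil ω = refl
  triv-act (node a {u} {v} p q) ω = begin
    gen-act a (word-act (u ++ inv a ∷ v) ω)                    ≡⟨ cong (gen-act a) (word-act-++ u (inv a ∷ v) ω) ⟩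
    gen-act a (word-act u (gen-act (inv a) (word-act v ω)))    ≡⟨ cong (gen-act a) (triv-act p (gen-act (inv a) (word-act v ω))) ⟩
    gen-act a (gen-act (inv a) (word-act v ω))                 ≡⟨ gen-act-inv a (word-act v ω) ⟩
    word-act v ω                                               ≡⟨ triv-act q ω ⟩
    ω                                                          ∎
    where open ≡-Reasoning

  signed-≟ : ∀ (a b : Signed ℕ) → Dec (a ≡ b)
  signed-≟ (pos x) (pos y) with x ≟ y
  ... | yes refl = yes refl
  ... | no n = no λ { refl → n refl }
  signed-≟ (neg x) (neg y) with x ≟ y
  ... | yes refl = yes refl
  ... | no n = no λ { refl → n refl }
  signed-≟ (pos x) (neg y) = no λ ()
  signed-≟ (neg x) (pos y) = no λ ()

  data Reduced : SWord ℕ → Set where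
    []   : Reduced []
    one  : ∀ a → Reduced (a ∷ [])
    cons : ∀ a {b r} → b ≢ inv a → Reduced (b ∷ r) → Reduced (a ∷ b ∷ r)

  reduced-tail : ∀ {a r} → Reduced (a ∷ r) → Reduced r
  reduced-tail (one a) = []
  reduced-tail (cons a n r) = r

  reduce : ∀ w → ∃[ r ] Reduction w r × Reduced r
  reduce [] = [] , done nil , []
  reduce (a ∷ w) with reduce w
  ... | [] , d , r = a ∷ [] , next nil d , one a
  ... | b ∷ x , d , r with signed-≟ b (inv a)
  ...   | no n = a ∷ b ∷ x , next nil d , cons a n r
  reduce (a ∷ w) | b ∷ x , next {u} {v = v} p d , r | yes refl =
    x , subst (λ z → Reduction (a ∷ z) x) (++-assoc u (inv a ∷ []) v)
          (reduction-prepend (node a p nil) d) , reduced-tail r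

  reduction-act : ∀ {w r} → Reduction w r → ∀ ω → word-act w ω ≡ word-act r ω
  reduction-act (done t) ω = triv-act t ω
  reduction-act (next {u} {a} {v} {r} p d) ω = begin
    word-act (u ++ a ∷ v) ω           ≡⟨ word-act-++ u (a ∷ v) ω ⟩
    word-act u (word-act (a ∷ v) ω)   ≡⟨ triv-act p (word-act (a ∷ v) ω) ⟩
    gen-act a (word-act v ω)          ≡⟨ cong (gen-act a) (reduction-act d ω) ⟩
    gen-act a (word-act r ω)          ∎
    where open ≡-Reasoning

  reduced-region : ∀ {a r} → Reduced (a ∷ r) → Region (lead a) (word-act (a ∷ r) ω₀)
  reduced-region (one a) = ping a
  reduced-region (cons a n r) = ping-pong a n (reduced-region r)

  -- A non-empty reduced form sends `ω₀` to a normal form starting with `s`, whereas `ω₀` is the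
  -- empty one.
  word-act-faithful : ∀ w → word-act w ω₀ ≡ ω₀ → Triv w
  word-act-faithful w e with reduce w
  ... | [] , done p , r = p
  ... | a ∷ x , d , r with subst (Region (lead a)) (trans (sym (reduction-act d ω₀)) e) (reduced-region r)
  ...   | _ , () , _

-- Action of braids on three of the five strands

module StrandForgetting where

  import Data.Nat as ℕ
  open import Data.Nat.Properties hiding (_≟_)
  import Data.Nat.Properties as ℕ
  open import Data.Fin.Properties using (_≟_; all?)
  open import Data.List.Properties using (≡-dec)
  open import Data.Vec using (lookup)
  import Data.Maybe.Properties as Maybe
  import Data.Product.Properties as ×
  open import Relation.Nullary.Decidable using (from-yes; _→-dec_; _×-dec_; _⊎-dec_)
  import Relation.Binary.Construct.Closure.Equivalence as Eq
  open import Relation.Binary.Construct.Closure.ReflexiveTransitive using (_◅_) renaming (ε to ε*)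
  open import Relation.Binary.Construct.Closure.Symmetric using (fwd; bwd)
  open PingPong

  ≈-refl : ∀ {u} → u ≈B u
  ≈-refl = Eq.reflexive Step

  ≈-sym : ∀ {u v} → u ≈B v → v ≈B u
  ≈-sym = Eq.symmetric Step

  ≈-trans : ∀ {u v w} → u ≈B v → v ≈B w → u ≈B w
  ≈-trans = Eq.transitive Step

  ≈-reflexive : ∀ {u v} → u ≡ v → u ≈B v
  ≈-reflexive refl = ≈-refl

  step-context : ∀ x y {u v} → Step u v → Step (x ++ u ++ y) (x ++ v ++ y)
  step-context x y (step u v l r ρ) = subst₂ Step (assoc l) (assoc r) (step (x ++ u) (v ++ y) l r ρ)
    where
    assoc : ∀ l → (x ++ u) ++ l ++ v ++ y ≡ x ++ (u ++ l ++ v) ++ y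
    assoc l = trans (++-assoc x u _) (cong (x ++_) (sym (trans (++-assoc u (l ++ v) y) (cong (u ++_) (++-assoc l v y)))))

  ≈-context : ∀ x y {u v} → u ≈B v → (x ++ u ++ y) ≈B (x ++ v ++ y)
  ≈-context x y = Eq.gmap (λ u → x ++ u ++ y) (step-context x y)

  ≈-++ : ∀ {u u′ v v′} → u ≈B u′ → v ≈B v′ → (u ++ v) ≈B (u′ ++ v′)
  ≈-++ {u} {u′} {v} {v′} p q = ≈-trans (≈-context [] v p)
    (subst₂ _≈B_ (cong (u′ ++_) (++-identityʳ v)) (cong (u′ ++_) (++-identityʳ v′)) (≈-context u′ [] q))

  ≈-++ˡ : ∀ x {u v} → u ≈B v → (x ++ u) ≈B (x ++ v)
  ≈-++ˡ x = ≈-++ (≈-refl {x})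

  ≈-rel : ∀ {l r} → Rel l r → l ≈B r
  ≈-rel {l} {r} ρ = subst₂ _≈B_ (++-identityʳ l) (++-identityʳ r) (fwd (step [] [] l r ρ) ◅ ε*)

  -- A state is the set of positions of three marked strands, in the order
  -- 123, 124, 125, 134, 135, 145, 234, 235, 245, 345.
  State : Set
  State = Fin 10

  swaps : Vec (Vec State 10) 4
  swaps =
    (# 0 ∷ # 1 ∷ # 2 ∷ # 6 ∷ # 7 ∷ # 8 ∷ # 3 ∷ # 4 ∷ # 5 ∷ # 9 ∷ []) ∷
    (# 0 ∷ # 3 ∷ # 4 ∷ # 1 ∷ # 2 ∷ # 5 ∷ # 6 ∷ # 7 ∷ # 9 ∷ # 8 ∷ []) ∷
    (# 1 ∷ # 0 ∷ # 2 ∷ # 3 ∷ # 5 ∷ # 4 ∷ # 6 ∷ # 8 ∷ # 7 ∷ # 9 ∷ []) ∷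
    (# 0 ∷ # 2 ∷ # 1 ∷ # 4 ∷ # 3 ∷ # 5 ∷ # 7 ∷ # 6 ∷ # 8 ∷ # 9 ∷ []) ∷ []

  -- In the row of `σᵢ` a crossing is present exactly when positions `i` and `i + 1` are both
  -- marked. It is `c₁` if these are the first two marked positions and `c₂` if they are the last
  -- two: the generator of B₃ that survives.
  crossings : Vec (Vec (Maybe (Fin 2)) 10) 4
  crossings =
    (c₁ ∷ c₁ ∷ c₁ ∷ ∙ ∷ ∙ ∷ ∙ ∷ ∙ ∷ ∙ ∷ ∙ ∷ ∙ ∷ []) ∷
    (c₂ ∷ ∙ ∷ ∙ ∷ ∙ ∷ ∙ ∷ ∙ ∷ c₁ ∷ c₁ ∷ ∙ ∷ ∙ ∷ []) ∷
    (∙ ∷ ∙ ∷ ∙ ∷ c₂ ∷ ∙ ∷ ∙ ∷ c₂ ∷ ∙ ∷ ∙ ∷ c₁ ∷ []) ∷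
    (∙ ∷ ∙ ∷ ∙ ∷ ∙ ∷ ∙ ∷ c₂ ∷ ∙ ∷ ∙ ∷ c₂ ∷ c₂ ∷ []) ∷ []
    where
    ∙ c₁ c₂ : Maybe (Fin 2)
    ∙  = nothing
    c₁ = just (# 0)
    c₂ = just (# 1)

  swap : Fin 4 → State → State
  swap i P = lookup (lookup swaps i) P

  crossing : Fin 4 → State → Maybe (Fin 2)
  crossing i P = lookup (lookup crossings i) P

  cross : Maybe (Fin 2) → Bool → Ω → Ω
  cross nothing _ = λ ω → ω
  cross (just zero) true = s₁
  cross (just zero) false = s₁⁻
  cross (just (suc zero)) true = s₂
  cross (just (suc zero)) false = s₂⁻

  letter-act : Letter → State × Ω → State × Ω
  letter-act (gen i b) (P , ω) = swap i P , cross (crossing i P) b ω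

  braid-act : Word → State × Ω → State × Ω
  braid-act [] x = x
  braid-act (l ∷ w) x = letter-act l (braid-act w x)

  braid-act-++ : ∀ u v x → braid-act (u ++ v) x ≡ braid-act u (braid-act v x)
  braid-act-++ [] v x = refl
  braid-act-++ (l ∷ u) v x = cong (letter-act l) (braid-act-++ u v x)

  cross-cancel : ∀ c b ω → cross c b (cross c (not b) ω) ≡ ω
  cross-cancel nothing b ω = refl
  cross-cancel (just zero) true ω = s₁-s₁⁻ ω
  cross-cancel (just zero) false ω = s₁⁻-s₁ ω
  cross-cancel (just (suc zero)) true ω = s₂-s₂⁻ ω
  cross-cancel (just (suc zero)) false ω = s₂⁻-s₂ ω

  swap-swap : ∀ i P → swap i (swap i P) ≡ P
  swap-swap = from-yes (all? λ i → all? λ P → swap i (swap i P) ≟ P)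

  crossing-swap : ∀ i P → crossing i (swap i P) ≡ crossing i P
  crossing-swap = from-yes (all? λ i → all? λ P → Maybe.≡-dec _≟_ (crossing i (swap i P)) (crossing i P))

  -- `Ω` is infinite, so the relations cannot be tested on it by enumeration. The word of surviving
  -- crossings depends on one of ten states only, which turns the relations between positive letters
  -- into a finite check.
  track : List (Fin 4) → State → State × List (Fin 2)
  track [] P = P , []
  track (i ∷ w) P = swap i (proj₁ (track w P)) , collect (crossing i (proj₁ (track w P))) (proj₂ (track w P))
    where
    collect : Maybe (Fin 2) → List (Fin 2) → List (Fin 2)
    collect nothing cs = cs
    collect (just c) cs = c ∷ cs

  crosses : List (Fin 2) → Ω → Ω
  crosses [] ω = ω
  crosses (c ∷ cs) ω = cross (just c) true (crosses cs ω)

  track-act : ∀ w P ω → braid-act (map σ w) (P , ω) ≡ (proj₁ (track w P) , crosses (proj₂ (track w P)) ω)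
  track-act [] P ω = refl
  track-act (i ∷ w) P ω rewrite track-act w P ω with crossing i (proj₁ (track w P))
  ... | nothing = refl
  ... | just c = refl

  far-track : ∀ i j → toℕ i + 2 ≤ toℕ j → ∀ P → track (i ∷ j ∷ []) P ≡ track (j ∷ i ∷ []) P
  far-track = from-yes (all? λ i → all? λ j → (toℕ i + 2 ℕ.≤? toℕ j) →-dec
    all? λ P → ×.≡-dec _≟_ (≡-dec _≟_) (track (i ∷ j ∷ []) P) (track (j ∷ i ∷ []) P))

  -- If all three strands involved are marked, the braid relation of B₃ appears; if one is
  -- forgotten, both sides leave the same crossings.
  braid-track : ∀ i j → toℕ j ≡ suc (toℕ i) → ∀ P →
    let l = track (i ∷ j ∷ i ∷ []) P ; r = track (j ∷ i ∷ j ∷ []) P in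
    proj₁ l ≡ proj₁ r × (proj₂ l ≡ proj₂ r ⊎
      proj₂ l ≡ # 0 ∷ # 1 ∷ # 0 ∷ [] × proj₂ r ≡ # 1 ∷ # 0 ∷ # 1 ∷ [])
  braid-track = from-yes (all? λ i → all? λ j → (toℕ j ℕ.≟ suc (toℕ i)) →-dec all? λ P →
    let l = track (i ∷ j ∷ i ∷ []) P ; r = track (j ∷ i ∷ j ∷ []) P in
    (proj₁ l ≟ proj₁ r) ×-dec (≡-dec _≟_ (proj₂ l) (proj₂ r) ⊎-dec
      (≡-dec _≟_ (proj₂ l) (# 0 ∷ # 1 ∷ # 0 ∷ []) ×-dec ≡-dec _≟_ (proj₂ r) (# 1 ∷ # 0 ∷ # 1 ∷ []))))

  rel-act : ∀ {l r} → Rel l r → ∀ x → braid-act l x ≡ braid-act r x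
  rel-act (cancel i b) (P , ω) rewrite swap-swap i P | crossing-swap i P = cong (P ,_) (cross-cancel (crossing i P) b ω)
  rel-act (farComm i j d) (P , ω) = begin
    braid-act (σ i ∷ σ j ∷ []) (P , ω)   ≡⟨ track-act (i ∷ j ∷ []) P ω ⟩
    _                                    ≡⟨ cong (λ (Q , cs) → Q , crosses cs ω) (far-track i j d P) ⟩
    _                                    ≡⟨ track-act (j ∷ i ∷ []) P ω ⟨
    braid-act (σ j ∷ σ i ∷ []) (P , ω)   ∎
    where open ≡-Reasoning
  rel-act (braid i j a) (P , ω) = begin
    braid-act (map σ u) (P , ω)                            ≡⟨ track-act u P ω ⟩
    proj₁ (track u P) , crosses (proj₂ (track u P)) ω      ≡⟨ cong₂ _,_ (proj₁ agree) (same (proj₂ agree)) ⟩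
    proj₁ (track v P) , crosses (proj₂ (track v P)) ω      ≡⟨ track-act v P ω ⟨
    braid-act (map σ v) (P , ω)                            ∎
    where
    open ≡-Reasoning
    u = i ∷ j ∷ i ∷ []
    v = j ∷ i ∷ j ∷ []
    agree = braid-track i j a P
    same : ∀ {cs ds} → cs ≡ ds ⊎ (cs ≡ # 0 ∷ # 1 ∷ # 0 ∷ [] × ds ≡ # 1 ∷ # 0 ∷ # 1 ∷ []) → crosses cs ω ≡ crosses ds ω
    same (inj₁ refl) = refl
    same (inj₂ (refl , refl)) = trans (s₁s₂s₁ ω) (sym (s₂s₁s₂ ω))

  step-act : ∀ {u v} → Step u v → ∀ x → braid-act u x ≡ braid-act v x
  step-act (step u v l r ρ) x = begin
    braid-act (u ++ l ++ v) x                       ≡⟨ braid-act-++ u (l ++ v) x ⟩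
    braid-act u (braid-act (l ++ v) x)              ≡⟨ cong (braid-act u) (braid-act-++ l v x) ⟩
    braid-act u (braid-act l (braid-act v x))       ≡⟨ cong (braid-act u) (rel-act ρ (braid-act v x)) ⟩
    braid-act u (braid-act r (braid-act v x))       ≡⟨ cong (braid-act u) (braid-act-++ r v x) ⟨
    braid-act u (braid-act (r ++ v) x)              ≡⟨ braid-act-++ u (r ++ v) x ⟨
    braid-act (u ++ r ++ v) x                       ∎
    where open ≡-Reasoning

  ≈-act : ∀ {u v} → u ≈B v → ∀ x → braid-act u x ≡ braid-act v x
  ≈-act ε* x = refl
  ≈-act (fwd p ◅ q) x = trans (step-act p x) (≈-act q x)
  ≈-act (bwd p ◅ q) x = trans (sym (step-act p x)) (≈-act q x)

-- A product of two free groups inside B₅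

module FreeSquare where

  import Relation.Binary.Reasoning.Setoid as SetoidReasoning
  import Relation.Binary.Construct.Closure.Equivalence as Eq
  open PingPong
  open StrandForgetting

  module ≈-Reasoning = SetoidReasoning (Eq.setoid Step)

  Commute : Word → Word → Set
  Commute u v = (u ++ v) ≈B (v ++ u)

  commute-sym : ∀ {u v} → Commute u v → Commute v u
  commute-sym = ≈-sym

  commute-[] : ∀ u → Commute u []
  commute-[] u = ≈-reflexive (++-identityʳ u)

  commute-++ : ∀ {u} v w → Commute u v → Commute u w → Commute u (v ++ w)
  commute-++ {u} v w p q = begin
    u ++ v ++ w      ≡⟨ ++-assoc u v w ⟨
    (u ++ v) ++ w    ≈⟨ ≈-++ p ≈-refl ⟩
    (v ++ u) ++ w    ≡⟨ ++-assoc v u w ⟩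
    v ++ u ++ w      ≈⟨ ≈-++ˡ v q ⟩
    v ++ w ++ u      ≡⟨ ++-assoc v w u ⟨
    (v ++ w) ++ u    ∎
    where open ≈-Reasoning

  -- v⁻¹ u = v⁻¹ u v v⁻¹ = u v⁻¹
  commute-inverse : ∀ {u v v⁻} → (v⁻ ++ v) ≈B [] → (v ++ v⁻) ≈B [] → Commute u v → Commute u v⁻
  commute-inverse {u} {v} {v⁻} p q c = begin
    u ++ v⁻                      ≈⟨ ≈-++ p (≈-refl {u ++ v⁻}) ⟨
    (v⁻ ++ v) ++ u ++ v⁻         ≡⟨ ++-assoc v⁻ v _ ⟩
    v⁻ ++ v ++ u ++ v⁻           ≡⟨ cong (v⁻ ++_) (++-assoc v u v⁻) ⟨
    v⁻ ++ (v ++ u) ++ v⁻         ≈⟨ ≈-++ˡ v⁻ (≈-++ c (≈-refl {v⁻})) ⟨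
    v⁻ ++ (u ++ v) ++ v⁻         ≡⟨ cong (v⁻ ++_) (++-assoc u v v⁻) ⟩
    v⁻ ++ u ++ v ++ v⁻           ≈⟨ ≈-++ˡ v⁻ (≈-++ˡ u q) ⟩
    v⁻ ++ u ++ []                ≡⟨ cong (v⁻ ++_) (++-identityʳ u) ⟩
    v⁻ ++ u                      ∎
    where open ≈-Reasoning

  flip : Letter → Letter
  flip (gen i b) = gen i (not b)

  _⁻¹ : Word → Word
  [] ⁻¹ = []
  (l ∷ w) ⁻¹ = w ⁻¹ ++ flip l ∷ []

  letter-inverseʳ : ∀ l → (l ∷ flip l ∷ []) ≈B []
  letter-inverseʳ (gen i b) = ≈-rel (cancel i b)

  letter-inverseˡ : ∀ l → (flip l ∷ l ∷ []) ≈B []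
  letter-inverseˡ (gen i b) =
    subst (λ c → (gen i (not b) ∷ gen i c ∷ []) ≈B []) (not-involutive b) (≈-rel (cancel i (not b)))

  inverseʳ : ∀ w → (w ++ w ⁻¹) ≈B []
  inverseʳ [] = ≈-refl
  inverseʳ (l ∷ w) = begin
    (l ∷ []) ++ w ++ w ⁻¹ ++ flip l ∷ []    ≡⟨ cong (l ∷_) (++-assoc w (w ⁻¹) _) ⟨
    (l ∷ []) ++ (w ++ w ⁻¹) ++ flip l ∷ []  ≈⟨ ≈-context (l ∷ []) (flip l ∷ []) (inverseʳ w) ⟩
    l ∷ flip l ∷ []                         ≈⟨ letter-inverseʳ l ⟩
    []                                      ∎
    where open ≈-Reasoning

  inverseˡ : ∀ w → (w ⁻¹ ++ w) ≈B []
  inverseˡ [] = ≈-refl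
  inverseˡ (l ∷ w) = begin
    (w ⁻¹ ++ flip l ∷ []) ++ l ∷ w          ≡⟨ ++-assoc (w ⁻¹) _ _ ⟩
    w ⁻¹ ++ (flip l ∷ l ∷ []) ++ w          ≈⟨ ≈-context (w ⁻¹) w (letter-inverseˡ l) ⟩
    w ⁻¹ ++ w                               ≈⟨ inverseˡ w ⟩
    []                                      ∎
    where open ≈-Reasoning

  commute-⁻¹ : ∀ {u} v → Commute u v → Commute u (v ⁻¹)
  commute-⁻¹ {u} v = commute-inverse {u} {v} {v ⁻¹} (inverseˡ v) (inverseʳ v)

  commute-replicate : ∀ {u} n l → Commute u (l ∷ []) → Commute u (replicate n l)
  commute-replicate {u} zero l c = commute-[] u
  commute-replicate (suc n) l c = commute-++ (l ∷ []) (replicate n l) c (commute-replicate n l c)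

  σ₁ σ₂ σ₃ σ₄ : Letter
  σ₁ = σ (# 0)
  σ₂ = σ (# 1)
  σ₃ = σ (# 2)
  σ₄ = σ (# 3)

  commute-far : ∀ i j → toℕ i + 2 ≤ toℕ j → Commute (σ i ∷ []) (σ j ∷ [])
  commute-far i j d = ≈-rel (farComm i j d)

  -- Strand 5 encircles all the others, so δ commutes with σ₁, σ₂, σ₃.
  δ : Word
  δ = σ₄ ∷ σ₃ ∷ σ₂ ∷ σ₁ ∷ σ₁ ∷ σ₂ ∷ σ₃ ∷ σ₄ ∷ []

  σ₁-σ₃ : Commute (σ₁ ∷ []) (σ₃ ∷ [])
  σ₁-σ₃ = commute-far (# 0) (# 2) (s≤s (s≤s z≤n))

  σ₁-σ₄ : Commute (σ₁ ∷ []) (σ₄ ∷ [])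
  σ₁-σ₄ = commute-far (# 0) (# 3) (s≤s (s≤s z≤n))

  σ₂-σ₄ : Commute (σ₂ ∷ []) (σ₄ ∷ [])
  σ₂-σ₄ = commute-far (# 1) (# 3) (s≤s (s≤s (s≤s z≤n)))

  σ₁σ₂σ₁ : (σ₁ ∷ σ₂ ∷ σ₁ ∷ []) ≈B (σ₂ ∷ σ₁ ∷ σ₂ ∷ [])
  σ₁σ₂σ₁ = ≈-rel (braid (# 0) (# 1) refl)

  σ₂σ₃σ₂ : (σ₂ ∷ σ₃ ∷ σ₂ ∷ []) ≈B (σ₃ ∷ σ₂ ∷ σ₃ ∷ [])
  σ₂σ₃σ₂ = ≈-rel (braid (# 1) (# 2) refl)

  -- Passing `σ₄ σ₃ σ₂ σ₁` turns `σ₁` into `σ₂`, and passing the mirror half of `δ` turns it back.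
  -- Likewise `σ₂` becomes `σ₃` for a while in `σ₂-δ`.
  σ₁-δ : Commute (σ₁ ∷ []) δ
  σ₁-δ = begin
    σ₁ ∷ σ₄ ∷ σ₃ ∷ σ₂ ∷ σ₁ ∷ σ₁ ∷ σ₂ ∷ σ₃ ∷ σ₄ ∷ []  ≈⟨ ≈-context [] (σ₃ ∷ σ₂ ∷ σ₁ ∷ σ₁ ∷ σ₂ ∷ σ₃ ∷ σ₄ ∷ []) σ₁-σ₄ ⟩
    σ₄ ∷ σ₁ ∷ σ₃ ∷ σ₂ ∷ σ₁ ∷ σ₁ ∷ σ₂ ∷ σ₃ ∷ σ₄ ∷ []  ≈⟨ ≈-context (σ₄ ∷ []) (σ₂ ∷ σ₁ ∷ σ₁ ∷ σ₂ ∷ σ₃ ∷ σ₄ ∷ []) σ₁-σ₃ ⟩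
    σ₄ ∷ σ₃ ∷ σ₁ ∷ σ₂ ∷ σ₁ ∷ σ₁ ∷ σ₂ ∷ σ₃ ∷ σ₄ ∷ []  ≈⟨ ≈-context (σ₄ ∷ σ₃ ∷ []) (σ₁ ∷ σ₂ ∷ σ₃ ∷ σ₄ ∷ []) σ₁σ₂σ₁ ⟩
    σ₄ ∷ σ₃ ∷ σ₂ ∷ σ₁ ∷ σ₂ ∷ σ₁ ∷ σ₂ ∷ σ₃ ∷ σ₄ ∷ []  ≈⟨ ≈-context (σ₄ ∷ σ₃ ∷ σ₂ ∷ σ₁ ∷ []) (σ₃ ∷ σ₄ ∷ []) σ₁σ₂σ₁ ⟨
    σ₄ ∷ σ₃ ∷ σ₂ ∷ σ₁ ∷ σ₁ ∷ σ₂ ∷ σ₁ ∷ σ₃ ∷ σ₄ ∷ []  ≈⟨ ≈-context (σ₄ ∷ σ₃ ∷ σ₂ ∷ σ₁ ∷ σ₁ ∷ σ₂ ∷ []) (σ₄ ∷ []) σ₁-σ₃ ⟩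
    σ₄ ∷ σ₃ ∷ σ₂ ∷ σ₁ ∷ σ₁ ∷ σ₂ ∷ σ₃ ∷ σ₁ ∷ σ₄ ∷ []  ≈⟨ ≈-context (σ₄ ∷ σ₃ ∷ σ₂ ∷ σ₁ ∷ σ₁ ∷ σ₂ ∷ σ₃ ∷ []) [] σ₁-σ₄ ⟩
    σ₄ ∷ σ₃ ∷ σ₂ ∷ σ₁ ∷ σ₁ ∷ σ₂ ∷ σ₃ ∷ σ₄ ∷ σ₁ ∷ []  ∎
    where open ≈-Reasoning

  σ₂-δ : Commute (σ₂ ∷ []) δ
  σ₂-δ = begin
    σ₂ ∷ σ₄ ∷ σ₃ ∷ σ₂ ∷ σ₁ ∷ σ₁ ∷ σ₂ ∷ σ₃ ∷ σ₄ ∷ []  ≈⟨ ≈-context [] (σ₃ ∷ σ₂ ∷ σ₁ ∷ σ₁ ∷ σ₂ ∷ σ₃ ∷ σ₄ ∷ []) σ₂-σ₄ ⟩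
    σ₄ ∷ σ₂ ∷ σ₃ ∷ σ₂ ∷ σ₁ ∷ σ₁ ∷ σ₂ ∷ σ₃ ∷ σ₄ ∷ []  ≈⟨ ≈-context (σ₄ ∷ []) (σ₁ ∷ σ₁ ∷ σ₂ ∷ σ₃ ∷ σ₄ ∷ []) σ₂σ₃σ₂ ⟩
    σ₄ ∷ σ₃ ∷ σ₂ ∷ σ₃ ∷ σ₁ ∷ σ₁ ∷ σ₂ ∷ σ₃ ∷ σ₄ ∷ []  ≈⟨ ≈-context (σ₄ ∷ σ₃ ∷ σ₂ ∷ []) (σ₁ ∷ σ₂ ∷ σ₃ ∷ σ₄ ∷ []) σ₁-σ₃ ⟨
    σ₄ ∷ σ₃ ∷ σ₂ ∷ σ₁ ∷ σ₃ ∷ σ₁ ∷ σ₂ ∷ σ₃ ∷ σ₄ ∷ []  ≈⟨ ≈-context (σ₄ ∷ σ₃ ∷ σ₂ ∷ σ₁ ∷ []) (σ₂ ∷ σ₃ ∷ σ₄ ∷ []) σ₁-σ₃ ⟨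
    σ₄ ∷ σ₃ ∷ σ₂ ∷ σ₁ ∷ σ₁ ∷ σ₃ ∷ σ₂ ∷ σ₃ ∷ σ₄ ∷ []  ≈⟨ ≈-context (σ₄ ∷ σ₃ ∷ σ₂ ∷ σ₁ ∷ σ₁ ∷ []) (σ₄ ∷ []) σ₂σ₃σ₂ ⟨
    σ₄ ∷ σ₃ ∷ σ₂ ∷ σ₁ ∷ σ₁ ∷ σ₂ ∷ σ₃ ∷ σ₂ ∷ σ₄ ∷ []  ≈⟨ ≈-context (σ₄ ∷ σ₃ ∷ σ₂ ∷ σ₁ ∷ σ₁ ∷ σ₂ ∷ σ₃ ∷ []) [] σ₂-σ₄ ⟩
    σ₄ ∷ σ₃ ∷ σ₂ ∷ σ₁ ∷ σ₁ ∷ σ₂ ∷ σ₃ ∷ σ₄ ∷ σ₂ ∷ []  ∎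
    where open ≈-Reasoning

  -- The two factors of F₂ × F₂ are ⟨ σ₂² , σ₁⁻² ⟩ and ⟨ σ₄² , δ ⟩; letter number k of a free group of
  -- infinite rank is the conjugate of the second generator by the (k + 1)-st power of the first.
  conjugate : Fin 4 → Word → ℕ → Word
  conjugate i r k = replicate (2 + k * 2) (gen i true) ++ r ++ replicate (2 + k * 2) (gen i false)

  opaque
    left right : Signed ℕ → Word
    left (pos k) = conjugate (# 1) ((σ₁ ∷ σ₁ ∷ []) ⁻¹) k
    left (neg k) = conjugate (# 1) (σ₁ ∷ σ₁ ∷ []) k
    right (pos k) = conjugate (# 3) δ k
    right (neg k) = conjugate (# 3) (δ ⁻¹) k

  record Acts (w : Word) (P : State) (f : Ω → Ω) : Set where
    constructor acts
    field on : ∀ ω → braid-act w (P , ω) ≡ (P , f ω)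

  open Acts

  acts-++ : ∀ {u v P f g} → Acts u P f → Acts v P g → Acts (u ++ v) P (f ∘ g)
  acts-++ {u} {v} {P} {f} {g} (acts p) (acts q) = acts λ ω →
    trans (braid-act-++ u v (P , ω)) (trans (cong (braid-act u) (q ω)) (p (g ω)))

  acts-replicate : ∀ {l P f} → Acts (l ∷ []) P f → ∀ n → Acts (replicate n l) P (iter n f)
  acts-replicate p zero = acts λ ω → refl
  acts-replicate p (suc n) = acts-++ p (acts-replicate p n)

  acts-conjugate : ∀ i r {P f f⁻ g} → Acts (gen i true ∷ []) P f → Acts (gen i false ∷ []) P f⁻ → Acts r P g →
    ∀ k → Acts (conjugate i r k) P (iter (2 + k * 2) f ∘ g ∘ iter (2 + k * 2) f⁻)
  acts-conjugate i r p q s k = acts-++ (acts-replicate p n) (acts-++ s (acts-replicate q n))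
    where n = 2 + k * 2

  iter-id : ∀ {A : Set} n (x : A) → iter n (λ x → x) x ≡ x
  iter-id zero x = refl
  iter-id (suc n) x = iter-id n x

  acts-conjugate-id : ∀ i r {P} → Acts (gen i true ∷ []) P (λ ω → ω) → Acts (gen i false ∷ []) P (λ ω → ω) →
    Acts r P (λ ω → ω) → ∀ k → Acts (conjugate i r k) P (λ ω → ω)
  acts-conjugate-id i r p q s k = acts λ ω → trans (on (acts-conjugate i r p q s k) ω)
    (cong (_ ,_) (trans (iter-id (2 + k * 2) _) (iter-id (2 + k * 2) ω)))

  -- The states 123 and 145.
  S₁ S₂ : State
  S₁ = # 0
  S₂ = # 5

  opaque
    unfolding left right

    left-S₁ : ∀ a → Acts (left a) S₁ (gen-act a)
    left-S₁ (pos k) = acts-conjugate (# 1) ((σ₁ ∷ σ₁ ∷ []) ⁻¹) {f = s₂} {s₂⁻} {s₁⁻ ∘ s₁⁻} (acts λ ω → refl) (acts λ ω → refl) (acts λ ω → refl) k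
    left-S₁ (neg k) = acts-conjugate (# 1) (σ₁ ∷ σ₁ ∷ []) {f = s₂} {s₂⁻} {s₁ ∘ s₁} (acts λ ω → refl) (acts λ ω → refl) (acts λ ω → refl) k

    right-S₁ : ∀ a → Acts (right a) S₁ (λ ω → ω)
    right-S₁ (pos k) = acts-conjugate-id (# 3) δ (acts λ ω → refl) (acts λ ω → refl) (acts λ ω → refl) k
    right-S₁ (neg k) = acts-conjugate-id (# 3) (δ ⁻¹) (acts λ ω → refl) (acts λ ω → refl) (acts λ ω → refl) k

    left-S₂ : ∀ a → Acts (left a) S₂ (λ ω → ω)
    left-S₂ (pos k) = acts-conjugate-id (# 1) ((σ₁ ∷ σ₁ ∷ []) ⁻¹) (acts λ ω → refl) (acts λ ω → refl) (acts λ ω → refl) k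
    left-S₂ (neg k) = acts-conjugate-id (# 1) (σ₁ ∷ σ₁ ∷ []) (acts λ ω → refl) (acts λ ω → refl) (acts λ ω → refl) k

    right-S₂ : ∀ a → Acts (right a) S₂ (gen-act a)
    right-S₂ (pos k) = acts-conjugate (# 3) δ {f = s₂} {s₂⁻} {s₁⁻ ∘ s₁⁻}
      (acts λ ω → refl) (acts λ ω → refl) (acts λ ω → cong (S₂ ,_) (s₂s₁s₁s₂ ω)) k
    right-S₂ (neg k) = acts-conjugate (# 3) (δ ⁻¹) {f = s₂} {s₂⁻} {s₁ ∘ s₁}
      (acts λ ω → refl) (acts λ ω → refl) (acts λ ω → cong (S₂ ,_) (s₂⁻s₁⁻s₁⁻s₂⁻ ω)) k

  concatMap-acts : ∀ {f P} → (∀ a → Acts (f a) P (gen-act a)) → ∀ w → Acts (concatMap f w) P (word-act w)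
  concatMap-acts h [] = acts λ ω → refl
  concatMap-acts h (a ∷ w) = acts-++ (h a) (concatMap-acts h w)

  concatMap-acts-id : ∀ {f : Signed ℕ → Word} {P} → (∀ a → Acts (f a) P (λ ω → ω)) →
    ∀ w → Acts (concatMap f w) P (λ ω → ω)
  concatMap-acts-id h [] = acts λ ω → refl
  concatMap-acts-id h (a ∷ w) = acts-++ (h a) (concatMap-acts-id h w)

  toBraid : SWord ℕ → SWord ℕ → Word
  toBraid u v = concatMap left u ++ concatMap right v

  -- At state 123 all crossings of `right` involve a forgotten strand, and at state 145 all
  -- crossings of `left` do, so each state isolates one component.
  toBraid-faithful : ∀ u v → toBraid u v ≈B [] → Triv u × Triv v
  toBraid-faithful u v e = word-act-faithful u (trivial act₁) , word-act-faithful v (trivial act₂)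
    where
    act₁ : Acts (toBraid u v) S₁ (word-act u)
    act₁ = acts-++ (concatMap-acts left-S₁ u) (concatMap-acts-id right-S₁ v)
    act₂ : Acts (toBraid u v) S₂ (word-act v)
    act₂ = acts-++ (concatMap-acts-id left-S₂ u) (concatMap-acts right-S₂ v)
    trivial : ∀ {P f} → Acts (toBraid u v) P f → f ω₀ ≡ ω₀
    trivial a = cong proj₂ (trans (sym (on a ω₀)) (≈-act e _))

  commute-conjugate : ∀ {u} i r k → Commute u (σ i ∷ []) → Commute u r → Commute u (conjugate i r k)
  commute-conjugate i r k p q = commute-++ (replicate n (σ i)) _ (commute-replicate n (σ i) p)
    (commute-++ r _ q (commute-replicate n (gen i false) (commute-⁻¹ (σ i ∷ []) p)))
    where n = 2 + k * 2

  opaque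
    unfolding left right

    commute-right : ∀ {u} → Commute u (σ₄ ∷ []) → Commute u δ → ∀ a → Commute u (right a)
    commute-right p q (pos k) = commute-conjugate (# 3) δ k p q
    commute-right p q (neg k) = commute-conjugate (# 3) (δ ⁻¹) k p (commute-⁻¹ δ q)

    commute-left : ∀ {u} → Commute u (σ₁ ∷ []) → Commute u (σ₂ ∷ []) → ∀ a → Commute u (left a)
    commute-left p q (pos k) = commute-conjugate (# 1) _ k q (commute-⁻¹ (σ₁ ∷ σ₁ ∷ []) (commute-++ (σ₁ ∷ []) (σ₁ ∷ []) p p))
    commute-left p q (neg k) = commute-conjugate (# 1) _ k q (commute-++ (σ₁ ∷ []) (σ₁ ∷ []) p p)

  left-right : ∀ a b → Commute (left a) (right b)
  left-right a b = commute-sym {right b} (commute-left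
    (commute-sym {σ₁ ∷ []} (commute-right σ₁-σ₄ σ₁-δ b)) (commute-sym {σ₂ ∷ []} (commute-right σ₂-σ₄ σ₂-δ b)) a)

  commute-concatMap : ∀ {u} (f : Signed ℕ → Word) → (∀ a → Commute u (f a)) → ∀ w → Commute u (concatMap f w)
  commute-concatMap {u} f h [] = commute-[] u
  commute-concatMap f h (a ∷ w) = commute-++ (f a) _ (h a) (commute-concatMap f h w)

  lefts-rights : ∀ u v → Commute (concatMap left u) (concatMap right v)
  lefts-rights u v = commute-sym {concatMap right v} (commute-concatMap left
    (λ a → commute-sym {left a} (commute-concatMap right (left-right a) v)) u)

  toBraid-++ : ∀ u v u′ v′ → (toBraid u v ++ toBraid u′ v′) ≈B toBraid (u ++ u′) (v ++ v′)
  toBraid-++ u v u′ v′ = begin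
    (L u ++ R v) ++ L u′ ++ R v′    ≡⟨ ++-assoc (L u) _ _ ⟩
    L u ++ R v ++ L u′ ++ R v′      ≡⟨ cong (L u ++_) (++-assoc (R v) (L u′) (R v′)) ⟨
    L u ++ (R v ++ L u′) ++ R v′    ≈⟨ ≈-context (L u) (R v′) (commute-sym {L u′} (lefts-rights u′ v)) ⟩
    L u ++ (L u′ ++ R v) ++ R v′    ≡⟨ cong (L u ++_) (++-assoc (L u′) (R v) (R v′)) ⟩
    L u ++ L u′ ++ R v ++ R v′      ≡⟨ ++-assoc (L u) _ _ ⟨
    (L u ++ L u′) ++ R v ++ R v′    ≡⟨ cong₂ _++_ (concatMap-++ left u u′) (concatMap-++ right v v′) ⟨
    L (u ++ u′) ++ R (v ++ v′)      ∎
    where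
    open ≈-Reasoning
    L R : SWord ℕ → Word
    L = concatMap left
    R = concatMap right

  replicate-inverse : ∀ n l l′ → (l ∷ l′ ∷ []) ≈B [] → (replicate n l ++ replicate n l′) ≈B []
  replicate-inverse zero l l′ e = ≈-refl
  replicate-inverse (suc n) l l′ e = begin
    l ∷ replicate n l ++ replicate (suc n) l′             ≡⟨ cong (λ w → l ∷ replicate n l ++ w) (replicate-∷ʳ n) ⟩
    l ∷ replicate n l ++ replicate n l′ ++ l′ ∷ []        ≡⟨ cong (l ∷_) (++-assoc (replicate n l) _ _) ⟨
    l ∷ (replicate n l ++ replicate n l′) ++ l′ ∷ []      ≈⟨ ≈-context (l ∷ []) (l′ ∷ []) (replicate-inverse n l l′ e) ⟩
    l ∷ l′ ∷ []                                           ≈⟨ e ⟩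
    []                                                    ∎
    where
    open ≈-Reasoning
    replicate-∷ʳ : ∀ n → replicate (suc n) l′ ≡ replicate n l′ ++ l′ ∷ []
    replicate-∷ʳ zero = refl
    replicate-∷ʳ (suc n) = cong (l′ ∷_) (replicate-∷ʳ n)

  conjugate-inverse : ∀ i r r⁻ k → (r ++ r⁻) ≈B [] → (conjugate i r k ++ conjugate i r⁻ k) ≈B []
  conjugate-inverse i r r⁻ k e = begin
    (P ++ r ++ P⁻) ++ P ++ r⁻ ++ P⁻      ≡⟨ ++-assoc P _ _ ⟩
    P ++ (r ++ P⁻) ++ P ++ r⁻ ++ P⁻      ≡⟨ cong (P ++_) (++-assoc r _ _) ⟩
    P ++ r ++ P⁻ ++ P ++ r⁻ ++ P⁻        ≡⟨ cong (λ w → P ++ r ++ w) (++-assoc P⁻ _ _) ⟨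
    P ++ r ++ (P⁻ ++ P) ++ r⁻ ++ P⁻      ≈⟨ ≈-++ˡ P (≈-context r (r⁻ ++ P⁻) (replicate-inverse n _ _ (letter-inverseˡ (σ i)))) ⟩
    P ++ r ++ r⁻ ++ P⁻                   ≡⟨ cong (P ++_) (++-assoc r _ _) ⟨
    P ++ (r ++ r⁻) ++ P⁻                 ≈⟨ ≈-context P P⁻ e ⟩
    P ++ P⁻                              ≈⟨ replicate-inverse n _ _ (letter-inverseʳ (σ i)) ⟩
    []                                   ∎
    where
    open ≈-Reasoning
    n = 2 + k * 2
    P = replicate n (gen i true)
    P⁻ = replicate n (gen i false)

  opaque
    unfolding left right

    left-inverse : ∀ a → (left a ++ left (inv a)) ≈B []
    left-inverse (pos k) = conjugate-inverse (# 1) ((σ₁ ∷ σ₁ ∷ []) ⁻¹) (σ₁ ∷ σ₁ ∷ []) k (inverseˡ (σ₁ ∷ σ₁ ∷ []))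
    left-inverse (neg k) = conjugate-inverse (# 1) (σ₁ ∷ σ₁ ∷ []) ((σ₁ ∷ σ₁ ∷ []) ⁻¹) k (inverseʳ (σ₁ ∷ σ₁ ∷ []))

    right-inverse : ∀ a → (right a ++ right (inv a)) ≈B []
    right-inverse (pos k) = conjugate-inverse (# 3) δ (δ ⁻¹) k (inverseʳ δ)
    right-inverse (neg k) = conjugate-inverse (# 3) (δ ⁻¹) δ k (inverseˡ δ)

  triv-≈ : ∀ (f : Signed ℕ → Word) → (∀ a → (f a ++ f (inv a)) ≈B []) → ∀ {w} → Triv w → concatMap f w ≈B []
  triv-≈ f h nil = ≈-refl
  triv-≈ f h (node a {u} {v} p q) = begin
    f a ++ concatMap f (u ++ inv a ∷ v)              ≡⟨ cong (f a ++_) (concatMap-++ f u (inv a ∷ v)) ⟩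
    f a ++ concatMap f u ++ f (inv a) ++ concatMap f v  ≈⟨ ≈-context (f a) _ (triv-≈ f h p) ⟩
    f a ++ f (inv a) ++ concatMap f v                ≡⟨ ++-assoc (f a) _ _ ⟨
    (f a ++ f (inv a)) ++ concatMap f v              ≈⟨ ≈-++ (h a) (triv-≈ f h q) ⟩
    []                                               ∎
    where open ≈-Reasoning

  toBraid-triv : ∀ {u v} → Triv u → Triv v → toBraid u v ≈B []
  toBraid-triv p q = ≈-++ (triv-≈ left left-inverse p) (triv-≈ right right-inverse q)

-- Counting spoiled blocks in trivial circuits

module Circuits where

  import Data.Nat as ℕ
  open import Data.Nat.Properties hiding (_≟_)
  open import Data.Nat.Solver using (module +-*-Solver)
  open import Data.Fin.Properties using (_≟_; all?)
  open import Relation.Nullary.Decidable using (from-yes; ¬?)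

  Kind : Set
  Kind = Fin 6

  succ : Kind → Kind
  succ zero = # 1
  succ (suc zero) = # 2
  succ (suc (suc zero)) = # 3
  succ (suc (suc (suc zero))) = # 4
  succ (suc (suc (suc (suc zero)))) = # 5
  succ (suc (suc (suc (suc (suc zero))))) = # 0

  advance : ℕ → Kind → Kind
  advance zero j = j
  advance (suc n) j = advance n (succ j)

  advance-suc : ∀ n j → advance (suc n) j ≡ succ (advance n j)
  advance-suc zero j = refl
  advance-suc (suc n) j = advance-suc n (succ j)

  advance-6 : ∀ j → advance 6 j ≡ j
  advance-6 = from-yes (all? λ j → advance 6 j ≟ j)

  advance-<6 : ∀ (n : Fin 5) j → advance (suc (toℕ n)) j ≢ j
  advance-<6 = from-yes (all? {n = 5} λ n → all? λ j → ¬? (advance (suc (toℕ n)) j ≟ j))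

  advance-period : ∀ n j → advance n j ≡ j → ∃[ x ] n ≡ x * 6
  advance-period 0 j e = 0 , refl
  advance-period 1 j e = ⊥-elim (advance-<6 (# 0) j e)
  advance-period 2 j e = ⊥-elim (advance-<6 (# 1) j e)
  advance-period 3 j e = ⊥-elim (advance-<6 (# 2) j e)
  advance-period 4 j e = ⊥-elim (advance-<6 (# 3) j e)
  advance-period 5 j e = ⊥-elim (advance-<6 (# 4) j e)
  advance-period (suc (suc (suc (suc (suc (suc n)))))) j e
    with advance-period n j (trans (sym (cong (advance n) (advance-6 j))) e)
  ... | x , refl = suc x , refl

  -- The phases of the kind j: history is written in phase (true , j) and erased in phase (false , j).
  Node : Set
  Node = Bool × Kind

  data Symbol (X : Set) : Set where
    node    : Node → Symbol X
    bracket : Kind → Symbol X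
    symbol  : X → Symbol X

  posWord negWord : {X : Set} → List X → SWord (Symbol X)
  posWord = map λ x → pos (symbol x)
  negWord xs = map (λ x → neg (symbol x)) (reverse xs)

  data Gen (E : Set) : Set where
    seed turn : Kind → Gen E
    write erase : Kind → E → Gen E

  source target : ∀ {E} → Gen E → Node
  source (seed j)    = false , j
  source (write j e) = true , j
  source (turn j)    = true , j
  source (erase j e) = false , j
  target (seed j)    = true , succ j
  target (write j e) = true , j
  target (turn j)    = false , j
  target (erase j e) = false , j

  -- Non-emptiness of `push` and `pop` excludes trivial loops made of `write` or `erase` alone,
  -- which would contain no block.
  record Component (E : Set) : Set₁ where
    field
      X          : Set
      start stop : List X
      push pop   : E → List X
      push≢[]    : ∀ e → push e ≢ []
      pop≢[]     : ∀ e → pop e ≢ []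

  data NonSeed {E : Set} : Gen E → Set where
    write : ∀ j e → NonSeed (write j e)
    turn  : ∀ j → NonSeed (turn j)
    erase : ∀ j e → NonSeed (erase j e)

  seeds : ∀ {E} → List (Gen E) → ℕ
  seeds [] = 0
  seeds (seed j ∷ gs) = suc (seeds gs)
  seeds (turn _ ∷ gs) = seeds gs
  seeds (write _ _ ∷ gs) = seeds gs
  seeds (erase _ _ ∷ gs) = seeds gs

  seeds-++ : ∀ {E} (gs hs : List (Gen E)) → seeds (gs ++ hs) ≡ seeds gs + seeds hs
  seeds-++ [] hs = refl
  seeds-++ (seed j ∷ gs) hs = cong suc (seeds-++ gs hs)
  seeds-++ (turn _ ∷ gs) hs = seeds-++ gs hs
  seeds-++ (write _ _ ∷ gs) hs = seeds-++ gs hs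
  seeds-++ (erase _ _ ∷ gs) hs = seeds-++ gs hs

  module _ {E : Set} where

    data Erasing (j : Kind) : List E → List (Gen E) → Set where
      close : ∀ {k gs} → Erasing j [] (seed k ∷ gs)
      erase : ∀ {e es gs} → Erasing j es gs → Erasing j (e ∷ es) (erase j e ∷ gs)

    -- Reads one block off the front of a list, up to the next seed, and ignores what follows. Where
    -- a block ends is thus decided by the generators alone, in the same way for both components.
    data Writing (j : Kind) : List E → List E → List (Gen E) → Set where
      turn  : ∀ {βs gs} → Erasing j βs gs → Writing j [] βs (turn j ∷ gs)
      write : ∀ {e αs βs gs} → Writing j αs βs gs → Writing j (e ∷ αs) βs (write j e ∷ gs)

    erasing-++ : ∀ {j βs gs} hs → Erasing j βs gs → Erasing j βs (gs ++ hs)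
    erasing-++ hs close = close
    erasing-++ hs (erase p) = erase (erasing-++ hs p)

    writing-++ : ∀ {j αs βs gs} hs → Writing j αs βs gs → Writing j αs βs (gs ++ hs)
    writing-++ hs (turn p) = turn (erasing-++ hs p)
    writing-++ hs (write p) = write (writing-++ hs p)

    erasing-cut : ∀ {j βs} gs {hs} → Erasing j βs (gs ++ hs) → Erasing j βs gs ⊎ All NonSeed gs
    erasing-cut [] p = inj₂ []
    erasing-cut (_ ∷ gs) close = inj₁ close
    erasing-cut (_ ∷ gs) (erase p) with erasing-cut gs p
    ... | inj₁ q = inj₁ (erase q)
    ... | inj₂ q = inj₂ (erase _ _ ∷ q)

    writing-cut : ∀ {j αs βs} gs {hs} → Writing j αs βs (gs ++ hs) → Writing j αs βs gs ⊎ All NonSeed gs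
    writing-cut [] p = inj₂ []
    writing-cut (_ ∷ gs) (turn p) with erasing-cut gs p
    ... | inj₁ q = inj₁ (turn q)
    ... | inj₂ q = inj₂ (turn _ ∷ q)
    writing-cut (_ ∷ gs) (write p) with writing-cut gs p
    ... | inj₁ q = inj₁ (write q)
    ... | inj₂ q = inj₂ (write _ _ ∷ q)

    erasing-unique : ∀ {j βs βs′ gs} → Erasing j βs gs → Erasing j βs′ gs → βs ≡ βs′
    erasing-unique close close = refl
    erasing-unique (erase p) (erase q) = cong (_ ∷_) (erasing-unique p q)

    writing-unique : ∀ {j αs αs′ βs βs′ gs} → Writing j αs βs gs → Writing j αs′ βs′ gs → αs ≡ αs′ × βs ≡ βs′
    writing-unique (turn p) (turn q) = refl , erasing-unique p q
    writing-unique (write p) (write q) with writing-unique p q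
    ... | refl , refl = refl , refl

    segment : Kind → List E → List E → List (Gen E) → List (Gen E)
    segment j αs βs gs = map (write j) αs ++ turn j ∷ map (erase j) βs ++ gs

    blocks : Kind → List (List E × List E) → List (Gen E)
    blocks j [] = []
    blocks j ((αs , βs) ∷ bs) = seed j ∷ segment (succ j) αs βs (blocks (succ j) bs)

    segment-writing : ∀ j αs βs {k gs} → Writing j αs βs (segment j αs βs (seed k ∷ gs))
    segment-writing j [] βs = turn (go βs)
      where
      go : ∀ βs {k gs} → Erasing j βs (map (erase j) βs ++ seed k ∷ gs)
      go [] = close
      go (e ∷ βs) = erase (go βs)
    segment-writing j (e ∷ αs) βs = write (segment-writing j αs βs)

    seeds-segment : ∀ j αs βs gs → seeds (segment j αs βs gs) ≡ seeds gs
    seeds-segment j [] [] gs = refl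
    seeds-segment j [] (e ∷ βs) gs = seeds-segment j [] βs gs
    seeds-segment j (e ∷ αs) βs gs = seeds-segment j αs βs gs

    seeds-blocks : ∀ j bs → seeds (blocks j bs) ≡ length bs
    seeds-blocks j [] = refl
    seeds-blocks j ((αs , βs) ∷ bs) = cong suc (trans (seeds-segment (succ j) αs βs _) (seeds-blocks (succ j) bs))

    data Path : Node → List (Gen E) → Node → Set where
      []  : ∀ {a} → Path a [] a
      _∷_ : ∀ {a b g gs} → source g ≡ a → Path (target g) gs b → Path a (g ∷ gs) b

    path-++ : ∀ {a b c gs hs} → Path a gs b → Path b hs c → Path a (gs ++ hs) c
    path-++ [] q = q
    path-++ (e ∷ p) q = e ∷ path-++ p q

    path-split : ∀ {a b} gs {hs} → Path a (gs ++ hs) b → ∃[ c ] Path a gs c × Path c hs b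
    path-split [] p = _ , [] , p
    path-split (g ∷ gs) (e ∷ p) with path-split gs p
    ... | c , q , r = c , e ∷ q , r

    parse-erasing : ∀ {j k gs} → Path (false , j) gs (false , k) →
      ∃[ βs ] ∃[ bs ] gs ≡ map (erase j) βs ++ blocks j bs × k ≡ advance (length bs) j
    parse-writing : ∀ {j k gs} → Path (true , j) gs (false , k) →
      ∃[ αs ] ∃[ βs ] ∃[ bs ] gs ≡ segment j αs βs (blocks j bs) × k ≡ advance (length bs) j
    parse-erasing [] = [] , [] , refl , refl
    parse-erasing (_∷_ {g = seed j} refl p) with parse-writing p
    ... | αs , βs , bs , refl , e = [] , (αs , βs) ∷ bs , refl , e
    parse-erasing (_∷_ {g = erase j x} refl p) with parse-erasing p
    ... | βs , bs , refl , e = x ∷ βs , bs , refl , e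
    parse-writing (_∷_ {g = turn j} refl p) with parse-erasing p
    ... | βs , bs , refl , e = [] , βs , bs , refl , e
    parse-writing (_∷_ {g = write j x} refl p) with parse-writing p
    ... | αs , βs , bs , refl , e = x ∷ αs , βs , bs , refl , e

    find-seed : ∀ gs → (∃[ t ] ∃[ j ] ∃[ r ] gs ≡ t ++ seed j ∷ r × All NonSeed t) ⊎ All (NonSeed {E}) gs
    find-seed [] = inj₂ []
    find-seed (seed j ∷ gs) = inj₁ ([] , j , gs , refl , [])
    find-seed (turn j ∷ gs) with find-seed gs
    ... | inj₁ (t , k , r , refl , n) = inj₁ (_ ∷ t , k , r , refl , turn j ∷ n)
    ... | inj₂ n = inj₂ (turn j ∷ n)
    find-seed (write j e ∷ gs) with find-seed gs
    ... | inj₁ (t , k , r , refl , n) = inj₁ (_ ∷ t , k , r , refl , write j e ∷ n)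
    ... | inj₂ n = inj₂ (write j e ∷ n)
    find-seed (erase j e ∷ gs) with find-seed gs
    ... | inj₁ (t , k , r , refl , n) = inj₁ (_ ∷ t , k , r , refl , erase j e ∷ n)
    ... | inj₂ n = inj₂ (erase j e ∷ n)

    nonSeed-seeds : ∀ {gs} → All (NonSeed {E}) gs → seeds gs ≡ 0
    nonSeed-seeds [] = refl
    nonSeed-seeds (write _ _ ∷ n) = nonSeed-seeds n
    nonSeed-seeds (turn _ ∷ n) = nonSeed-seeds n
    nonSeed-seeds (erase _ _ ∷ n) = nonSeed-seeds n

  module Words {E : Set} (C : Component E) where
    open Component C

    mid : Gen E → SWord (Symbol X)
    mid (seed j)    = pos (bracket j) ∷ neg (bracket (succ j)) ∷ posWord start
    mid (write j e) = posWord (push e)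
    mid (turn j)    = negWord stop
    mid (erase j e) = negWord (pop e)

    mids : List (Gen E) → SWord (Symbol X)
    mids = concatMap mid

    word : Gen E → SWord (Symbol X)
    word g = neg (node (source g)) ∷ mid g ++ pos (node (target g)) ∷ []

    words : List (Gen E) → SWord (Symbol X)
    words [] = []
    words (g ∷ gs) = neg (node (source g)) ∷ mid g ++ pos (node (target g)) ∷ words gs

    body : List E × List E → SWord (Symbol X)
    body (αs , βs) = posWord start ++ concatMap (posWord ∘ push) αs ++ negWord stop ++ concatMap (negWord ∘ pop) βs

    Good : Kind → List (Gen E) → Set
    Good j gs = ∃[ αs ] ∃[ βs ] Writing (succ j) αs βs gs × Triv (body (αs , βs))

    -- All but at most n seeds of the list start a closed block with trivial body.
    data Bad : List (Gen E) → ℕ → Set where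
      []   : ∀ {n} → Bad [] n
      skip : ∀ {g gs n} → NonSeed g → Bad gs n → Bad (g ∷ gs) n
      good : ∀ {j gs n} → Good j gs → Bad gs n → Bad (seed j ∷ gs) n
      bad  : ∀ {j gs n} → Bad gs n → Bad (seed j ∷ gs) (suc n)

    bad-weaken : ∀ {gs m n} → m ≤ n → Bad gs m → Bad gs n
    bad-weaken p [] = []
    bad-weaken p (skip s b) = skip s (bad-weaken p b)
    bad-weaken p (good s b) = good s (bad-weaken p b)
    bad-weaken (s≤s p) (bad b) = bad (bad-weaken p b)

    bad-++ : ∀ {gs hs m n} → Bad gs m → Bad hs n → Bad (gs ++ hs) (m + n)
    bad-++ {m = m} [] c = bad-weaken (m≤n+m _ m) c
    bad-++ (skip s b) c = skip s (bad-++ b c)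
    bad-++ {hs = hs} (good (αs , βs , w , t) b) c = good (αs , βs , writing-++ hs w , t) (bad-++ b c)
    bad-++ (bad b) c = bad (bad-++ b c)

    bad-drop : ∀ gs {hs n} → Bad (gs ++ hs) n → Bad hs n
    bad-drop [] b = b
    bad-drop (_ ∷ gs) (skip _ b) = bad-drop gs b
    bad-drop (_ ∷ gs) (good _ b) = bad-drop gs b
    bad-drop (_ ∷ gs) (bad b) = bad-weaken (n≤1+n _) (bad-drop gs b)

    bad-nonSeed : ∀ {gs} → All NonSeed gs → Bad gs 0
    bad-nonSeed [] = []
    bad-nonSeed (n ∷ ns) = skip n (bad-nonSeed ns)

    -- At most one block straddles the cut.
    bad-cut : ∀ gs {hs n} → Bad (gs ++ hs) n → ∃[ k ] ∃[ l ] Bad gs k × Bad hs l × k + l ≤ suc n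
    bad-cut [] {n = n} b = 0 , n , [] , b , n≤1+n n
    bad-cut (_ ∷ gs) (skip s b) with bad-cut gs b
    ... | k , l , c , d , p = k , l , skip s c , d , p
    bad-cut (_ ∷ gs) (bad b) with bad-cut gs b
    ... | k , l , c , d , p = suc k , l , bad c , d , s≤s p
    bad-cut (_ ∷ gs) (good (αs , βs , w , t) b) with writing-cut gs w
    ... | inj₂ n = 1 , _ , bad (bad-nonSeed n) , bad-drop gs b , ≤-refl
    ... | inj₁ w′ with bad-cut gs b
    ...   | k , l , c , d , p = k , l , good (αs , βs , w′ , t) c , d , p

    data Plain : Signed (Symbol X) → Set where
      pos : ∀ x → Plain (pos (symbol x))
      neg : ∀ x → Plain (neg (symbol x))

    posWord-plain : ∀ xs → All Plain (posWord xs)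
    posWord-plain xs = Allₚ.map⁺ (go xs)
      where
      go : ∀ xs → All (λ x → Plain (pos (symbol x))) xs
      go [] = []
      go (x ∷ xs) = pos x ∷ go xs

    negWord-plain : ∀ xs → All Plain (negWord xs)
    negWord-plain xs = Allₚ.map⁺ (go (reverse xs))
      where
      go : ∀ xs → All (λ x → Plain (neg (symbol x))) xs
      go [] = []
      go (x ∷ xs) = neg x ∷ go xs

    body-plain : ∀ b → All Plain (body b)
    body-plain (αs , βs) = Allₚ.++⁺ (posWord-plain start) (Allₚ.++⁺ (go αs) (Allₚ.++⁺ (negWord-plain stop) (go′ βs)))
      where
      go : ∀ es → All Plain (concatMap (posWord ∘ push) es)
      go [] = []
      go (e ∷ es) = Allₚ.++⁺ (posWord-plain (push e)) (go es)
      go′ : ∀ es → All Plain (concatMap (negWord ∘ pop) es)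
      go′ [] = []
      go′ (e ∷ es) = Allₚ.++⁺ (negWord-plain (pop e)) (go′ es)

    bracketed : Kind → List (SWord (Symbol X)) → SWord (Symbol X)
    bracketed j [] = []
    bracketed j (h ∷ hs) = neg (bracket (succ j)) ∷ h ++ pos (bracket (succ j)) ∷ bracketed (succ j) hs

    data NonTriv : List (SWord (Symbol X)) → ℕ → Set where
      []   : ∀ {n} → NonTriv [] n
      triv : ∀ {h hs n} → Triv h → NonTriv hs n → NonTriv (h ∷ hs) n
      any  : ∀ {h hs n} → NonTriv hs n → NonTriv (h ∷ hs) (suc n)

    nonTriv-weaken : ∀ {hs m n} → m ≤ n → NonTriv hs m → NonTriv hs n
    nonTriv-weaken p [] = []
    nonTriv-weaken p (triv t b) = triv t (nonTriv-weaken p b)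
    nonTriv-weaken (s≤s p) (any b) = any (nonTriv-weaken p b)

    nonTriv-++ : ∀ {gs hs m n} → NonTriv gs m → NonTriv hs n → NonTriv (gs ++ hs) (m + n)
    nonTriv-++ {m = m} [] c = nonTriv-weaken (m≤n+m _ m) c
    nonTriv-++ (triv t b) c = triv t (nonTriv-++ b c)
    nonTriv-++ (any b) c = any (nonTriv-++ b c)

    nonTriv-tail : ∀ {h hs n} → NonTriv (h ∷ hs) n → NonTriv hs n
    nonTriv-tail (triv _ b) = b
    nonTriv-tail (any b) = nonTriv-weaken (n≤1+n _) b

    no-bracket : ∀ {c} u {v} → ¬ All Plain (u ++ neg (bracket c) ∷ v)
    no-bracket u p with Allₚ.++⁻ʳ u p
    ... | () ∷ _

    locate-bracket : ∀ j {c} hs I {V} → All (All Plain) hs → bracketed j hs ≡ I ++ neg (bracket c) ∷ V →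
      ∃[ xs ] ∃[ h ] ∃[ ys ] hs ≡ xs ++ h ∷ ys × I ≡ bracketed j xs × c ≡ advance (suc (length xs)) j ×
        V ≡ h ++ pos (bracket c) ∷ bracketed c ys
    locate-bracket j [] [] p ()
    locate-bracket j [] (_ ∷ _) p ()
    locate-bracket j (h ∷ hs) [] p refl = [] , h , hs , refl , refl , refl , refl
    locate-bracket j {c} (h ∷ hs) (a ∷ I) (p ∷ ps) e with ∷-injectiveˡ e | ++-split h {x = I} (∷-injectiveʳ e)
    ... | refl | inj₁ (y′ , refl , _) = ⊥-elim (no-bracket I p)
    ... | refl | inj₂ (b ∷ x′ , refl , e′) with ∷-injectiveˡ e′ | locate-bracket (succ j) hs x′ ps (∷-injectiveʳ e′)
    ...   | refl | xs , h′ , ys , refl , refl , ac , eV = h ∷ xs , h′ , ys , refl , refl , ac , eV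

    -- Two blocks whose brackets cancel are of the same kind, hence enclose at least five others.
    bracket-bound : ∀ fuel j hs w → length hs ≤ fuel → length hs ≤ suc w * 6 → All (All Plain) hs →
      Triv (bracketed j hs) → NonTriv hs (2 * w)
    bracket-bound fuel j [] w f l p t = []
    bracket-bound (suc fuel) j (h ∷ hs) w (s≤s f) l (p ∷ ps) t with triv-match (neg (bracket (succ j)) ∷ h) t
    -- The closing bracket of `h` cancels its own opening bracket.
    ... | inj₂ ([] , .h , refl , i , m) = triv i (bracket-bound fuel (succ j) hs w f (≤-trans (n≤1+n _) l) ps m)
    ... | inj₂ (_ ∷ M′ , I , refl , i , m) = ⊥-elim (no-bracket M′ p)
    ... | inj₁ (I , V , e , i , m) with locate-bracket (succ j) hs I ps e
    ...   | xs , h′ , ys , refl , refl , ac , refl with advance-period (suc (length xs)) (succ j) (sym ac)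
    -- It cancels the opening bracket of a later block `h′`: the list `xs` is enclosed and `h ++ h′`
    -- becomes one block. The number of blocks outside drops by `6 (x + 1)`, which allows
    -- `2 (x + 1)` non-trivial ones: `2 x` for `xs` and one each for `h` and `h′`.
    ...     | suc x , lx = nonTriv-weaken arith (any (nonTriv-++ left′ (any (nonTriv-tail right′))))
      where
      open +-*-Solver
      open ≡-Reasoning
      len : length (xs ++ h′ ∷ ys) ≡ length xs + suc (length ys)
      len = length-++ xs
      room : suc x * 6 + suc (length ys) ≤ suc w * 6
      room = subst (_≤ suc w * 6) (trans (cong suc len) (cong (_+ suc (length ys)) lx)) l
      x≤w : suc x ≤ w
      x≤w = ℕ.s≤s⁻¹ (*-cancelʳ-< 6 (suc x) (suc w) (<-≤-trans (m<m+n (suc x * 6) (s≤s z≤n)) room))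
      w′ : ℕ
      w′ = w ∸ suc x
      w≡ : w ≡ suc x + w′
      w≡ = sym (m+[n∸m]≡n x≤w)
      shorter : suc (length ys) ≤ suc w′ * 6
      shorter = +-cancelˡ-≤ (suc x * 6) _ _ (≤-trans room (≤-reflexive
        (trans (cong (λ w → suc w * 6) w≡)
          (solve 2 (λ a b → (con 1 :+ (con 1 :+ a :+ b)) :* con 6 := (con 1 :+ a) :* con 6 :+ (con 1 :+ b) :* con 6) refl x w′))))
      pxs : All (All Plain) xs
      pxs = Allₚ.++⁻ˡ xs ps
      pys : All (All Plain) (h′ ∷ ys)
      pys = Allₚ.++⁻ʳ xs ps
      f′ : length xs + suc (length ys) ≤ fuel
      f′ = subst (_≤ fuel) len f
      left′ : NonTriv xs (2 * x)
      left′ = bracket-bound fuel (succ j) xs x (≤-trans (m≤m+n _ _) f′)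
        (≤-trans (n≤1+n _) (≤-reflexive lx)) pxs i
      merged : Triv (bracketed j ((h ++ h′) ∷ ys))
      merged = subst (λ z → Triv (neg (bracket (succ j)) ∷ z)) (sym (++-assoc h h′ _)) m
      right′ : NonTriv ((h ++ h′) ∷ ys) (2 * w′)
      right′ with pys
      ... | p′ ∷ py = bracket-bound fuel j ((h ++ h′) ∷ ys) w′ (≤-trans (m≤n+m _ (length xs)) f′) shorter
                        (Allₚ.++⁺ p p′ ∷ py) merged
      arith : suc (2 * x + suc (2 * w′)) ≤ 2 * w
      arith = ≤-reflexive (trans (solve 2 (λ a b → con 1 :+ (con 2 :* a :+ (con 1 :+ con 2 :* b)) := con 2 :* (con 1 :+ a :+ b)) refl x w′)
        (cong (2 *_) (sym w≡)))

    mids-segment : ∀ j αs βs gs → mids (segment j αs βs gs) ≡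
      concatMap (posWord ∘ push) αs ++ negWord stop ++ concatMap (negWord ∘ pop) βs ++ mids gs
    mids-segment j [] βs gs = cong (negWord stop ++_) (go βs)
      where
      go : ∀ βs → mids (map (erase j) βs ++ gs) ≡ concatMap (negWord ∘ pop) βs ++ mids gs
      go [] = refl
      go (e ∷ βs) = trans (cong (negWord (pop e) ++_) (go βs)) (sym (++-assoc (negWord (pop e)) _ _))
    mids-segment j (e ∷ αs) βs gs =
      trans (cong (posWord (push e) ++_) (mids-segment j αs βs gs)) (sym (++-assoc (posWord (push e)) _ _))

    -- Conjugation moves the bracket preceding the first block behind the last one.
    mids-blocks : ∀ j bs → mids (blocks j bs) ++ pos (bracket (advance (length bs) j)) ∷ [] ≡
      pos (bracket j) ∷ bracketed j (map body bs)
    mids-blocks j [] = refl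
    mids-blocks j ((αs , βs) ∷ bs) = cong (λ z → pos (bracket j) ∷ neg (bracket (succ j)) ∷ z) (begin
      (posWord start ++ mids (segment (succ j) αs βs gs)) ++ c   ≡⟨ cong (λ z → (posWord start ++ z) ++ c) (mids-segment (succ j) αs βs gs) ⟩
      (posWord start ++ a ++ negWord stop ++ b ++ mids gs) ++ c  ≡⟨ cong (λ z → (posWord start ++ z) ++ c) (trans (cong (a ++_) (sym (++-assoc (negWord stop) b _))) (sym (++-assoc a _ _))) ⟩
      (posWord start ++ (a ++ negWord stop ++ b) ++ mids gs) ++ c  ≡⟨ cong (_++ c) (++-assoc (posWord start) _ _) ⟨
      (body (αs , βs) ++ mids gs) ++ c                       ≡⟨ ++-assoc (body (αs , βs)) _ _ ⟩
      body (αs , βs) ++ mids gs ++ c                         ≡⟨ cong (body (αs , βs) ++_) (mids-blocks (succ j) bs) ⟩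
      body (αs , βs) ++ pos (bracket (succ j)) ∷ bracketed (succ j) (map body bs)  ∎)
      where
      open ≡-Reasoning
      gs = blocks (succ j) bs
      a = concatMap (posWord ∘ push) αs
      b = concatMap (negWord ∘ pop) βs
      c = pos (bracket (advance (length bs) (succ j))) ∷ []

    skip-segment : ∀ j αs βs {gs n} → Bad gs n → Bad (segment j αs βs gs) n
    skip-segment j [] [] b = skip (turn j) b
    skip-segment j [] (e ∷ βs) b with skip-segment j [] βs b
    ... | skip s c = skip s (skip (erase j e) c)
    skip-segment j (e ∷ αs) βs b = skip (write j e) (skip-segment j αs βs b)

    -- The last block need not be closed.
    nonTriv-bad : ∀ j bs {n} → NonTriv (map body bs) n → Bad (blocks j bs) (suc n)
    nonTriv-bad j [] b = []
    nonTriv-bad j ((αs , βs) ∷ []) b = bad (skip-segment (succ j) αs βs [])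
    nonTriv-bad j ((αs , βs) ∷ b₂ ∷ bs) (triv t b) =
      good (αs , βs , segment-writing (succ j) αs βs , t) (skip-segment (succ j) αs βs (nonTriv-bad (succ j) (b₂ ∷ bs) b))
    nonTriv-bad j ((αs , βs) ∷ b₂ ∷ bs) (any b) = bad (skip-segment (succ j) αs βs (nonTriv-bad (succ j) (b₂ ∷ bs) b))

    -- The reserve in `suc n` pays for the block broken when one list is inserted into another. It
    -- also makes the bad seeds of two components together fewer than the seeds.
    Bound : List (Gen E) → Set
    Bound gs = ∃[ n ] Bad gs n × 2 * suc n ≤ seeds gs

    posWord-positive : ∀ (xs : List X) → All IsPos (posWord xs)
    posWord-positive [] = []
    posWord-positive (x ∷ xs) = pos (symbol x) ∷ posWord-positive xs

    negWord-negative : ∀ (xs : List X) → All IsNeg (negWord xs)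
    negWord-negative xs = go (reverse xs)
      where
      go : ∀ xs → All IsNeg (map (λ x → neg (symbol x)) xs)
      go [] = []
      go (x ∷ xs) = neg (symbol x) ∷ go xs

    posWord-[] : ∀ {xs : List X} → posWord xs ≡ [] → xs ≡ []
    posWord-[] {[]} e = refl

    negWord-[] : ∀ {xs : List X} → negWord xs ≡ [] → xs ≡ []
    negWord-[] {xs} e with reverse xs | reverse-involutive xs
    ... | [] | r = sym r

    erasing-path : ∀ {j b gs} → Path (false , j) gs b → All NonSeed gs → b ≡ (false , j) × All IsNeg (mids gs)
    erasing-path [] [] = refl , []
    erasing-path (_∷_ {g = erase j e} refl p) (_ ∷ n) with erasing-path p n
    ... | b , m = b , Allₚ.++⁺ (negWord-negative (pop e)) m
    erasing-path (_∷_ {g = seed j} refl p) (() ∷ n)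

    writing-path : ∀ {j k gs} → Path (true , j) gs (true , k) → All NonSeed gs → All IsPos (mids gs)
    writing-path [] [] = []
    writing-path (_∷_ {g = write j e} refl p) (_ ∷ n) = Allₚ.++⁺ (posWord-positive (push e)) (writing-path p n)
    writing-path (_∷_ {g = turn j} refl p) (_ ∷ n) with erasing-path p n
    ... | () , _

    -- A circuit cannot leave a phase and return to it without a seed, so a seedless one only writes
    -- or only erases. Its word is then positive or negative, and non-empty.
    loop-has-seed : ∀ {a gs} → gs ≢ [] → Path a gs a → All NonSeed gs → ¬ Triv (mids gs)
    loop-has-seed ne [] n t = ne refl
    loop-has-seed {true , j} ne (_∷_ {g = write j e} refl p) n t =
      push≢[] e (posWord-[] (Listₚ.++-conicalˡ (posWord (push e)) _ (triv-positive (writing-path (refl ∷ p) n) t)))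
    loop-has-seed {true , j} ne (_∷_ {g = turn j} refl p) (_ ∷ n) t with erasing-path p n
    ... | () , _
    loop-has-seed {false , j} ne (_∷_ {g = erase j e} refl p) n t =
      pop≢[] e (negWord-[] (Listₚ.++-conicalˡ (negWord (pop e)) _ (triv-negative (proj₂ (erasing-path (refl ∷ p) n)) t)))
    loop-has-seed {false , j} ne (_∷_ {g = seed j} refl p) (() ∷ n) t

    blocks-bound : ∀ j bs → bs ≢ [] → advance (length bs) j ≡ j → Triv (mids (blocks j bs)) →
      ∃[ w ] length bs ≡ suc w * 6 × Bad (blocks j bs) (suc (2 * w))
    blocks-bound j [] ne a t = ⊥-elim (ne refl)
    blocks-bound j (b ∷ bs) ne a t with advance-period (length (b ∷ bs)) j a
    ... | suc w , l = w , l , nonTriv-bad j (b ∷ bs) (bracket-bound _ j (map body (b ∷ bs)) w ≤-refl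
            (≤-reflexive (trans (length-map body (b ∷ bs)) l)) (plain (b ∷ bs)) t′)
      where
      plain : ∀ bs → All (All Plain) (map body bs)
      plain [] = []
      plain (b ∷ bs) = body-plain b ∷ plain bs
      t′ : Triv (bracketed j (map body (b ∷ bs)))
      t′ = subst Triv (∷-injectiveʳ (trans (sym (cong (λ k → mids (blocks j (b ∷ bs)) ++ pos (bracket k) ∷ []) a))
                                          (mids-blocks j (b ∷ bs))))
                      (triv-rotate₁ (pos (bracket j)) t)

    -- Rotated to start at a seed, the circuit is a sequence of whole blocks whose number is a
    -- multiple of six. Rotating back cuts the list once.
    loop-bound : ∀ {a gs} → gs ≢ [] → Path a gs a → Triv (mids gs) → Bound gs
    loop-bound {gs = gs} ne p t with find-seed gs
    ... | inj₂ n = ⊥-elim (loop-has-seed ne p n t)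
    ... | inj₁ (u , j , r , refl , n) with path-split u p
    ...   | .(false , j) , p₁ , refl ∷ p₂ with parse-writing (path-++ p₂ p₁)
    ...     | αs , βs , bs , e′ , ac = bound (blocks-bound j ((αs , βs) ∷ bs) (λ ()) (sym ac) t′)
      where
      e″ : seed j ∷ r ++ u ≡ blocks j ((αs , βs) ∷ bs)
      e″ = cong (seed j ∷_) e′
      mids-++ : ∀ gs hs → mids (gs ++ hs) ≡ mids gs ++ mids hs
      mids-++ = concatMap-++ mid
      t′ : Triv (mids (blocks j ((αs , βs) ∷ bs)))
      t′ = subst (Triv ∘ mids) e″ (subst Triv (sym (mids-++ (seed j ∷ r) u))
             (triv-rotate (mids u) (subst Triv (mids-++ u (seed j ∷ r)) t)))
      bound : ∃[ w ] suc (length bs) ≡ suc w * 6 × Bad (blocks j ((αs , βs) ∷ bs)) (suc (2 * w)) →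
              Bound (u ++ seed j ∷ r)
      bound (w , l , b) with bad-cut (seed j ∷ r) (subst (λ gs → Bad gs (suc (2 * w))) (sym e″) b)
      ... | k , m , c , d , q = m + k , bad-++ d c , (begin
        2 * suc (m + k)                   ≤⟨ *-monoʳ-≤ 2 (s≤s (≤-trans (≤-reflexive (+-comm m k)) q)) ⟩
        -- The three units are the unclosed last block, the block cut by the rotation, and the
        -- reserve in `Bound`.
        2 * suc (suc (suc (2 * w)))       ≡⟨ solve 1 (λ w → con 2 :* (con 3 :+ con 2 :* w) := con 6 :+ con 4 :* w) refl w ⟩
        6 + 4 * w                         ≤⟨ +-monoʳ-≤ 6 (*-monoˡ-≤ w {4} {6} (s≤s (s≤s (s≤s (s≤s z≤n))))) ⟩
        6 + 6 * w                         ≡⟨ cong (6 +_) (*-comm 6 w) ⟩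
        suc w * 6                         ≡⟨ l ⟨
        length ((αs , βs) ∷ bs)           ≡⟨ seeds-blocks j ((αs , βs) ∷ bs) ⟨
        seeds (blocks j ((αs , βs) ∷ bs)) ≡⟨ cong seeds e″ ⟨
        seeds ((seed j ∷ r) ++ u)         ≡⟨ seeds-++ (seed j ∷ r) u ⟩
        seeds (seed j ∷ r) + seeds u      ≡⟨ +-comm (seeds (seed j ∷ r)) (seeds u) ⟩
        seeds u + seeds (seed j ∷ r)      ≡⟨ seeds-++ u (seed j ∷ r) ⟨
        seeds (u ++ seed j ∷ r)           ∎)
        where
        open ≤-Reasoning
        open +-*-Solver

    data NonNode : Signed (Symbol X) → Set where
      plain   : ∀ {a} → Plain a → NonNode a
      bracket⁺ : ∀ k → NonNode (pos (bracket k))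
      bracket⁻ : ∀ k → NonNode (neg (bracket k))

    mid-nonNode : ∀ g → All NonNode (mid g)
    mid-nonNode (seed j) = bracket⁺ j ∷ bracket⁻ (succ j) ∷ All.map plain (posWord-plain start)
    mid-nonNode (turn j) = All.map plain (negWord-plain stop)
    mid-nonNode (write j e) = All.map plain (posWord-plain (push e))
    mid-nonNode (erase j e) = All.map plain (negWord-plain (pop e))

    mids-nonNode : ∀ gs → All NonNode (mids gs)
    mids-nonNode [] = []
    mids-nonNode (g ∷ gs) = Allₚ.++⁺ (mid-nonNode g) (mids-nonNode gs)

    no-node : ∀ {b} u {v} → ¬ All NonNode (u ++ neg (node b) ∷ v)
    no-node u p with Allₚ.++⁻ʳ u p
    ... | plain () ∷ _

    locate-node : ∀ {b} gs I {V} → words gs ≡ I ++ neg (node b) ∷ V →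
      ∃[ xs ] ∃[ g ] ∃[ ys ] gs ≡ xs ++ g ∷ ys × I ≡ words xs × source g ≡ b × V ≡ mid g ++ pos (node (target g)) ∷ words ys
    locate-node [] [] ()
    locate-node [] (_ ∷ _) ()
    locate-node (g ∷ gs) [] refl = [] , g , gs , refl , refl , refl , refl
    locate-node (g ∷ gs) (a ∷ I) e with ∷-injectiveˡ e | ++-split (mid g) {x = I} (∷-injectiveʳ e)
    ... | refl | inj₁ (y′ , q , _) = ⊥-elim (no-node I (subst (All NonNode) q (mid-nonNode g)))
    ... | refl | inj₂ (b ∷ x′ , refl , e′) with ∷-injectiveˡ e′ | locate-node gs x′ (∷-injectiveʳ e′)
    ...   | refl | xs , h , ys , refl , refl , s , eV = g ∷ xs , h , ys , refl , refl , s , eV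

    bound-++ : ∀ {gs hs} → Bound gs → Bound hs → Bound (gs ++ hs)
    bound-++ {gs} {hs} (m , b , p) (n , c , q) = m + n , bad-++ b c , (begin
      2 * suc (m + n)          ≤⟨ *-monoʳ-≤ 2 (≤-trans (n≤1+n _) (≤-reflexive (cong suc (sym (+-suc m n))))) ⟩
      2 * (suc m + suc n)      ≡⟨ *-distribˡ-+ 2 (suc m) (suc n) ⟩
      2 * suc m + 2 * suc n    ≤⟨ +-mono-≤ p q ⟩
      seeds gs + seeds hs      ≡⟨ seeds-++ gs hs ⟨
      seeds (gs ++ hs)         ∎)
      where open ≤-Reasoning

    -- Only a block straddling the point of insertion can break. This uses up one of the two
    -- reserves and leaves the other.
    bound-insert : ∀ gs {hs I} → Bound (gs ++ hs) → Bound I → Bound (gs ++ I ++ hs)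
    bound-insert gs {hs} {I} (m , b , p) (n , c , q) with bad-cut gs b
    ... | k , l , d , e , r = k + (n + l) , bad-++ d (bad-++ c e) , (begin
      2 * suc (k + (n + l))                ≡⟨ cong (2 *_) (solve 3 (λ k n l → con 1 :+ (k :+ (n :+ l)) := (k :+ l) :+ (con 1 :+ n)) refl k n l) ⟩
      2 * (k + l + suc n)                  ≤⟨ *-monoʳ-≤ 2 (+-monoˡ-≤ (suc n) r) ⟩
      2 * (suc m + suc n)                  ≡⟨ *-distribˡ-+ 2 (suc m) (suc n) ⟩
      2 * suc m + 2 * suc n                ≤⟨ +-mono-≤ p q ⟩
      seeds (gs ++ hs) + seeds I           ≡⟨ cong (_+ seeds I) (seeds-++ gs hs) ⟩
      seeds gs + seeds hs + seeds I        ≡⟨ solve 3 (λ a b c → a :+ b :+ c := a :+ (c :+ b)) refl (seeds gs) (seeds hs) (seeds I) ⟩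
      seeds gs + (seeds I + seeds hs)      ≡⟨ cong (seeds gs +_) (seeds-++ I hs) ⟨
      seeds gs + seeds (I ++ hs)           ≡⟨ seeds-++ gs (I ++ hs) ⟨
      seeds (gs ++ I ++ hs)                ∎)
      where
      open ≤-Reasoning
      open +-*-Solver

    -- The path g ∷ gs read so far is extended by the generator whose source cancels its target,
    -- after removal of the trivial list in between, until it closes up.
    path-bound : ∀ fuel {a b} g gs rest → length rest ≤ fuel → Path a (g ∷ gs) b →
      Triv (neg (node a) ∷ mids (g ∷ gs) ++ pos (node b) ∷ words rest) → Bound ((g ∷ gs) ++ rest)
    triv-bound : ∀ fuel g gs → length gs ≤ fuel → Triv (words (g ∷ gs)) → Bound (g ∷ gs)
    triv-bound fuel g gs f t = path-bound fuel g [] gs f (refl ∷ [])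
      (subst (λ z → Triv (neg (node (source g)) ∷ z ++ pos (node (target g)) ∷ words gs)) (sym (++-identityʳ (mid g))) t)
    path-bound fuel {a} {b} g gs rest f p t with triv-match (neg (node a) ∷ mids (g ∷ gs)) t
    ... | inj₂ (_ ∷ M′ , I , e , i , m) = ⊥-elim (no-node M′ (subst (All NonNode) (∷-injectiveʳ e) (mids-nonNode (g ∷ gs))))
    ... | inj₂ ([] , I , e , i , m) with ∷-injectiveˡ e | ∷-injectiveʳ e
    ...   | refl | refl with rest | fuel | f
    ...     | [] | _ | _ = subst Bound (sym (++-identityʳ (g ∷ gs))) (loop-bound (λ ()) p i)
    ...     | h ∷ hs | suc fuel′ | s≤s f′ = bound-++ (loop-bound (λ ()) p i) (triv-bound fuel′ h hs f′ m)
    path-bound fuel {a} {b} g gs rest f p t | inj₁ (I , V , e , i , m) with locate-node rest I e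
    ... | xs , h , ys , refl , refl , s , refl = extend fuel f
      where
      p′ : Path a ((g ∷ gs) ++ h ∷ []) (target h)
      p′ = path-++ p (s ∷ [])
      assoc : neg (node a) ∷ mids (g ∷ gs) ++ mid h ++ pos (node (target h)) ∷ words ys ≡
              neg (node a) ∷ mids ((g ∷ gs) ++ h ∷ []) ++ pos (node (target h)) ∷ words ys
      assoc = cong (neg (node a) ∷_) (sym (trans
        (cong (_++ pos (node (target h)) ∷ words ys)
          (trans (concatMap-++ mid (g ∷ gs) (h ∷ [])) (cong (mids (g ∷ gs) ++_) (++-identityʳ (mid h)))))
        (++-assoc (mids (g ∷ gs)) (mid h) _)))
      len : length (xs ++ h ∷ ys) ≡ length xs + suc (length ys)
      len = length-++ xs
      extend : ∀ fuel → length (xs ++ h ∷ ys) ≤ fuel → Bound ((g ∷ gs) ++ xs ++ h ∷ ys)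
      extend zero f = ⊥-elim (m+1+n≰m′ (subst (_≤ 0) len f))
        where
        m+1+n≰m′ : ¬ length xs + suc (length ys) ≤ 0
        m+1+n≰m′ q with subst (_≤ 0) (+-suc (length xs) (length ys)) q
        ... | ()
      extend (suc fuel) f = inserted xs i f₁
        where
        f₀ : length xs + length ys ≤ fuel
        f₀ = ℕ.s≤s⁻¹ (subst (_≤ suc fuel) (trans len (+-suc (length xs) (length ys))) f)
        f₁ : length xs ≤ fuel
        f₁ = ≤-trans (m≤m+n _ _) f₀
        removed : Bound ((g ∷ gs) ++ h ∷ ys)
        removed = subst Bound (++-assoc (g ∷ gs) (h ∷ []) ys)
          (path-bound fuel g (gs ++ h ∷ []) ys (≤-trans (m≤n+m _ (length xs)) f₀) p′ (subst Triv assoc m))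
        inserted : ∀ xs → Triv (words xs) → length xs ≤ fuel → Bound ((g ∷ gs) ++ xs ++ h ∷ ys)
        inserted [] i l = removed
        inserted (x ∷ xs) i l = bound-insert (g ∷ gs) removed (triv-bound fuel x xs (≤-trans (n≤1+n _) l) i)

  -- Pigeonhole: some seed is good for both components, and `writing-unique` shows that both mean
  -- the same block there.
  common-seed : ∀ {E} (C D : Component E) gs {m n} →
    Words.Bad C gs m → Words.Bad D gs n → m + n < seeds gs →
    ∃[ b ] Triv (Words.body C b) × Triv (Words.body D b)
  common-seed C D (seed j ∷ gs) (Words.good (αs , βs , w , t)  b) (Words.good (αs′ , βs′ , w′ , t′) c) l
    with writing-unique w w′
  ... | refl , refl = (αs , βs) , t , t′
  common-seed C D (seed j ∷ gs) (Words.good _ b) (Words.bad {n = n} c) l =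
    common-seed C D gs b c (ℕ.s≤s⁻¹ (subst (_< suc (seeds gs)) (+-suc _ _) l))
  common-seed C D (seed j ∷ gs) (Words.bad b) c l =
    common-seed C D gs b (Words.bad-drop D (seed j ∷ []) c) (ℕ.s≤s⁻¹ l)
  common-seed C D (g ∷ gs) (Words.skip (write _ _) b) c l = common-seed C D gs b (Words.bad-drop D (g ∷ []) c) l
  common-seed C D (g ∷ gs) (Words.skip (turn _) b) c l = common-seed C D gs b (Words.bad-drop D (g ∷ []) c) l
  common-seed C D (g ∷ gs) (Words.skip (erase _ _) b) c l = common-seed C D gs b (Words.bad-drop D (g ∷ []) c) l

  common-block : ∀ {E} (C D : Component E) g gs → Triv (Words.words C (g ∷ gs)) → Triv (Words.words D (g ∷ gs)) →
    ∃[ b ] Triv (Words.body C b) × Triv (Words.body D b)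
  common-block C D g gs t u with Words.triv-bound C _ g gs ≤-refl t | Words.triv-bound D _ g gs ≤-refl u
  ... | m , b , p | n , c , q = common-seed C D (g ∷ gs) b c (*-cancelˡ-< 2 _ _ (begin-strict
    2 * (m + n)                        <⟨ *-monoʳ-< 2 (≤-trans (n<1+n (m + n)) (≤-trans (n≤1+n _) (≤-reflexive (cong suc (sym (+-suc m n)))))) ⟩
    2 * (suc m + suc n)                ≡⟨ *-distribˡ-+ 2 (suc m) (suc n) ⟩
    2 * suc m + 2 * suc n              ≤⟨ +-mono-≤ p q ⟩
    seeds (g ∷ gs) + seeds (g ∷ gs)    ≡⟨ cong (seeds (g ∷ gs) +_) (+-identityʳ _) ⟨
    2 * seeds (g ∷ gs)                 ∎))
    where open ≤-Reasoning

-- Trivial blocks as equations between positive words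

open import Data.List using (lookup)
open import Data.List.NonEmpty using (List⁺; _∷_; toList)
open import Data.List.Relation.Unary.Any.Properties using (lookup-index)
open Circuits

module _ {X : Set} where

  private
    P N : List X → SWord (Symbol X)
    P = posWord
    N = map λ x → neg (symbol x)

  split-neg : ∀ x z I {a : X} {V} → P x ++ N z ≡ I ++ neg (symbol a) ∷ V →
    ∃[ z₁ ] ∃[ z₂ ] z ≡ z₁ ++ a ∷ z₂ × I ≡ P x ++ N z₁ × V ≡ N z₂
  split-neg (b ∷ x) z [] ()
  split-neg (b ∷ x) z (c ∷ I) e with ∷-injectiveˡ e | split-neg x z I (∷-injectiveʳ e)
  ... | refl | z₁ , z₂ , p , refl , r = z₁ , z₂ , p , refl , r
  split-neg [] [] [] ()
  split-neg [] [] (_ ∷ _) ()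
  split-neg [] (b ∷ z) [] refl = [] , z , refl , refl , refl
  split-neg [] (b ∷ z) (c ∷ I) e with ∷-injectiveˡ e | split-neg [] z I (∷-injectiveʳ e)
  ... | refl | z₁ , z₂ , refl , refl , r = b ∷ z₁ , z₂ , refl , refl , r

  N-[] : ∀ z → Triv (N z) → z ≡ []
  N-[] [] t = refl
  N-[] (a ∷ z) t with triv-negative (negs (a ∷ z)) t
    where
    negs : ∀ z → All IsNeg (N z)
    negs [] = []
    negs (x ∷ z) = neg (symbol x) ∷ negs z
  ... | ()

  -- The free monoid embeds in the free group: whatever follows the partner of the first letter is a
  -- trivial negative word, hence empty, so all arches are nested.
  triv-≡ : ∀ x y → Triv (posWord x ++ negWord y) → x ≡ y
  triv-≡ x y t = trans (go x (reverse y) t) (reverse-involutive y)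
    where
    go : ∀ x z → Triv (P x ++ N z) → x ≡ reverse z
    go [] z t with N-[] z t
    ... | refl = refl
    go (a ∷ x) z t with triv-match [] t
    ... | inj₂ ([] , _ , () , _)
    ... | inj₂ (_ ∷ _ , _ , () , _)
    ... | inj₁ (I , V , e , i , m) with split-neg x z I e
    ...   | z₁ , z₂ , refl , refl , refl with N-[] z₂ m
    ...     | refl = trans (cong (a ∷_) (go x z₁ i)) (sym (reverse-++ z₁ (a ∷ [])))

  ≡-triv : ∀ x → Triv (posWord x ++ negWord x)
  ≡-triv [] = nil
  ≡-triv (a ∷ x) = subst (λ z → Triv (pos (symbol a) ∷ z)) eq (node (pos (symbol a)) (≡-triv x) nil)
    where
    eq : (P x ++ N (reverse x)) ++ neg (symbol a) ∷ [] ≡ P x ++ N (reverse (a ∷ x))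
    eq = trans (++-assoc (P x) _ _) (cong (P x ++_) (trans (sym (map-++ _ (reverse x) (a ∷ []))) (cong N (sym (unfold-reverse a x)))))

  negWord-++ : ∀ (x y : List X) → negWord (x ++ y) ≡ negWord y ++ negWord x
  negWord-++ x y = trans (cong N (reverse-++ x y)) (map-++ _ (reverse y) (reverse x))

module _ {E : Set} (C : Component E) where
  open Component C
  open Words C

  private
    push* pop* : List E → List X
    push* = concatMap push
    pop* = concatMap pop

  -- Erasing multiplies inverses one after another, so the erased part is the inverse of the
  -- contributions in reverse order.
  body-≡ : ∀ αs βs → body (αs , βs) ≡ posWord (start ++ push* αs) ++ negWord (pop* (reverse βs) ++ stop)
  body-≡ αs βs = begin
    posWord start ++ concatMap (posWord ∘ push) αs ++ negWord stop ++ concatMap (negWord ∘ pop) βs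
      ≡⟨ cong₂ (λ y z → posWord start ++ y ++ negWord stop ++ z) (pushes αs) (pops βs) ⟩
    posWord start ++ posWord (push* αs) ++ negWord stop ++ negWord (pop* (reverse βs))
      ≡⟨ ++-assoc (posWord start) _ _ ⟨
    (posWord start ++ posWord (push* αs)) ++ negWord stop ++ negWord (pop* (reverse βs))
      ≡⟨ cong₂ _++_ (map-++ _ start (push* αs)) (negWord-++ (pop* (reverse βs)) stop) ⟨
    posWord (start ++ push* αs) ++ negWord (pop* (reverse βs) ++ stop) ∎
    where
    open ≡-Reasoning
    pushes : ∀ es → concatMap (posWord ∘ push) es ≡ posWord (push* es)
    pushes [] = refl
    pushes (e ∷ es) = trans (cong (posWord (push e) ++_) (pushes es)) (sym (map-++ _ (push e) (push* es)))
    pops : ∀ es → concatMap (negWord ∘ pop) es ≡ negWord (pop* (reverse es))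
    pops [] = refl
    pops (e ∷ es) = begin
      negWord (pop e) ++ concatMap (negWord ∘ pop) es    ≡⟨ cong₂ _++_ (cong negWord (sym (++-identityʳ (pop e)))) (pops es) ⟩
      negWord (pop* (e ∷ [])) ++ negWord (pop* (reverse es))  ≡⟨ negWord-++ (pop* (reverse es)) (pop* (e ∷ [])) ⟨
      negWord (pop* (reverse es) ++ pop* (e ∷ []))       ≡⟨ cong negWord (concatMap-++ pop (reverse es) (e ∷ [])) ⟨
      negWord (pop* (reverse es ++ e ∷ []))              ≡⟨ cong (negWord ∘ pop*) (unfold-reverse e es) ⟨
      negWord (pop* (reverse (e ∷ es)))                  ∎

  body-triv⇒≡ : ∀ αs βs → Triv (body (αs , βs)) → start ++ push* αs ≡ pop* (reverse βs) ++ stop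
  body-triv⇒≡ αs βs t = triv-≡ _ _ (subst Triv (body-≡ αs βs) t)

  ≡⇒body-triv : ∀ αs βs → start ++ push* αs ≡ pop* (reverse βs) ++ stop → Triv (body (αs , βs))
  ≡⇒body-triv αs βs e = subst Triv (sym (body-≡ αs βs))
    (subst (λ z → Triv (posWord (start ++ push* αs) ++ negWord z)) e (≡-triv (start ++ push* αs)))

-- Post correspondence for a string rewriting system: a solution α spells out a derivation
-- w # w₁ # w₂ # … # H #, each round of α rewriting wᵢ to wᵢ₊₁.
module Correspondence {Sym Rule : Set} (lhs⁺ rhs⁺ : Rule → List⁺ Sym)
  (copy : Sym → Rule) (lhs-copy : ∀ a → lhs⁺ (copy a) ≡ a ∷ []) (rhs-copy : ∀ a → rhs⁺ (copy a) ≡ a ∷ [])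
  (H : Sym) (rules : List Rule) where

  lhs rhs : Rule → List Sym
  lhs = toList ∘ lhs⁺
  rhs = toList ∘ rhs⁺

  -- `zero` is the separator, written `nothing` as a symbol, and `suc i` is the rule at position
  -- `i`. Finiteness of the type lets the generators be listed.
  E : Set
  E = Fin (suc (length rules))

  push pop : E → List (Maybe Sym)
  push zero = nothing ∷ []
  push (suc i) = map just (rhs (lookup rules i))
  pop zero = nothing ∷ []
  pop (suc i) = map just (lhs (lookup rules i))

  push* pop* : List E → List (Maybe Sym)
  push* = concatMap push
  pop* = concatMap pop

  final : List (Maybe Sym)
  final = just H ∷ nothing ∷ []

  Solves : List Sym → List E → Set
  Solves w α = map just w ++ nothing ∷ push* α ≡ pop* α ++ final

  -- Every letter contributes itself, so a trivial block has `αs` equal to `reverse βs`. This ties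
  -- what is popped in `content` to what was pushed.
  history : Component E
  history = record { X = E ; start = [] ; stop = [] ; push = _∷ [] ; pop = _∷ [] ; push≢[] = λ _ () ; pop≢[] = λ _ () }

  content : List Sym → Component E
  content w = record
    { X = Maybe Sym ; start = map just w ++ nothing ∷ [] ; stop = final ; push = push ; pop = pop
    ; push≢[] = λ { zero () ; (suc i) () }
    ; pop≢[] = λ { zero () ; (suc i) () } }

  concatMap-singleton : ∀ {A : Set} (xs : List A) → concatMap (_∷ []) xs ≡ xs
  concatMap-singleton [] = refl
  concatMap-singleton (x ∷ xs) = cong (x ∷_) (concatMap-singleton xs)

  bodies⇒solves : ∀ w b → Triv (Words.body history b) → Triv (Words.body (content w) b) → Solves w (proj₁ b)
  bodies⇒solves w (αs , βs) p q = begin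
    map just w ++ nothing ∷ push* αs         ≡⟨ ++-assoc (map just w) _ _ ⟨
    (map just w ++ nothing ∷ []) ++ push* αs ≡⟨ body-triv⇒≡ (content w) αs βs q ⟩
    pop* (reverse βs) ++ final               ≡⟨ cong (λ z → pop* z ++ final) eq ⟨
    pop* αs ++ final                         ∎
    where
    open ≡-Reasoning
    eq : αs ≡ reverse βs
    eq = begin
      αs                                     ≡⟨ concatMap-singleton αs ⟨
      concatMap (_∷ []) αs                   ≡⟨ body-triv⇒≡ history αs βs p ⟩
      concatMap (_∷ []) (reverse βs) ++ []   ≡⟨ ++-identityʳ _ ⟩
      concatMap (_∷ []) (reverse βs)         ≡⟨ concatMap-singleton (reverse βs) ⟩
      reverse βs                             ∎

  solves⇒bodies : ∀ w α → Solves w α → Triv (Words.body history (α , reverse α)) × Triv (Words.body (content w) (α , reverse α))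
  solves⇒bodies w α s =
    ≡⇒body-triv history α (reverse α) (trans (cong (concatMap (_∷ [])) (sym (reverse-involutive α))) (sym (++-identityʳ _))) ,
    ≡⇒body-triv (content w) α (reverse α)
      (trans (++-assoc (map just w) _ _) (trans s (cong (λ z → pop* z ++ final) (sym (reverse-involutive α)))))

  strip : ∀ l w {y z : List (Maybe Sym)} → map just w ++ nothing ∷ y ≡ map just l ++ z →
    ∃[ w′ ] w ≡ l ++ w′ × map just w′ ++ nothing ∷ y ≡ z
  strip [] w e = w , refl , e
  strip (a ∷ l) [] ()
  strip (a ∷ l) (b ∷ w) e with ∷-injectiveˡ e | strip l w (∷-injectiveʳ e)
  ... | refl | w′ , refl , q = w′ , refl , q

  module _ (Q : List Sym → Set) (hit : Q (H ∷ [])) (back : ∀ x r y → Q (x ++ rhs r ++ y) → Q (x ++ lhs r ++ y)) where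

    -- x is the part of the next word already produced, w the part of the current one still to be read.
    solves-sound′ : ∀ α w x → map just w ++ nothing ∷ map just x ++ push* α ≡ pop* α ++ final → Q (x ++ w)
    solves-sound′ [] (a ∷ []) [] refl = hit
    solves-sound′ [] [] x ()
    solves-sound′ [] (a ∷ []) (_ ∷ _) ()
    solves-sound′ [] (a ∷ b ∷ w) x ()
    solves-sound′ (zero ∷ α) [] x e = subst Q (sym (++-identityʳ x)) (solves-sound′ α x [] (∷-injectiveʳ e))
    solves-sound′ (zero ∷ α) (a ∷ w) x ()
    solves-sound′ (suc i ∷ α) w x e with strip (lhs (lookup rules i)) w (trans e (++-assoc (pop (suc i)) _ _))
    ... | w′ , refl , q = back x (lookup rules i) w′ (subst Q (++-assoc x r w′) (solves-sound′ α w′ (x ++ r) (begin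
      map just w′ ++ nothing ∷ map just (x ++ r) ++ push* α           ≡⟨ cong (λ z → map just w′ ++ nothing ∷ z ++ push* α) (map-++ just x r) ⟩
      map just w′ ++ nothing ∷ (map just x ++ map just r) ++ push* α  ≡⟨ cong (λ z → map just w′ ++ nothing ∷ z) (++-assoc (map just x) _ _) ⟩
      map just w′ ++ nothing ∷ map just x ++ push* (suc i ∷ α)        ≡⟨ q ⟩
      pop* α ++ final                                                 ∎)))
      where
      open ≡-Reasoning
      r = rhs (lookup rules i)

    -- A round may apply several rules at once. No derivation has to be extracted: it is enough that
    -- `Q` holds at `H` and passes backwards through each rule in any context.
    solves-sound : ∀ w α → Solves w α → Q w
    solves-sound w α s = solves-sound′ α w [] s

  number : ∀ {r} → r ∈ rules → E
  number p = suc (index p)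

  Copied : List Sym → Set
  Copied = All (λ a → copy a ∈ rules)

  copies : ∀ {x} → Copied x → List E
  copies [] = []
  copies (p ∷ ps) = number p ∷ copies ps

  push-number : ∀ {r} (p : r ∈ rules) → push (number p) ≡ map just (rhs r)
  push-number p = cong (map just ∘ rhs) (sym (lookup-index p))

  pop-number : ∀ {r} (p : r ∈ rules) → pop (number p) ≡ map just (lhs r)
  pop-number p = cong (map just ∘ lhs) (sym (lookup-index p))

  push-copies : ∀ {x} (c : Copied x) → push* (copies c) ≡ map just x
  push-copies [] = refl
  push-copies (p ∷ c) = cong₂ _++_ (trans (push-number p) (cong (map just ∘ toList) (rhs-copy _))) (push-copies c)

  pop-copies : ∀ {x} (c : Copied x) → pop* (copies c) ≡ map just x
  pop-copies [] = refl
  pop-copies (p ∷ c) = cong₂ _++_ (trans (pop-number p) (cong (map just ∘ toList) (lhs-copy _))) (pop-copies c)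

  data _⇝_ : List Sym → List Sym → Set where
    rewriteBy : ∀ {x r y} → Copied x → r ∈ rules → Copied y → (x ++ lhs r ++ y) ⇝ (x ++ rhs r ++ y)

  data _⇝*_ : List Sym → List Sym → Set where
    stop : ∀ {w} → w ⇝* w
    _▷_  : ∀ {u v w} → u ⇝ v → v ⇝* w → u ⇝* w

  infixr 5 _▷_

  ⇝*-trans : ∀ {u v w} → u ⇝* v → v ⇝* w → u ⇝* w
  ⇝*-trans stop q = q
  ⇝*-trans (s ▷ p) q = s ▷ ⇝*-trans p q

  solves-H : Solves (H ∷ []) []
  solves-H = refl

  round : ∀ {x r y} → Copied x → r ∈ rules → Copied y → List E
  round cx p cy = copies cx ++ number p ∷ copies cy

  -- One rewriting step takes one round, in which the context is copied; the letter `zero` then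
  -- closes the round.
  solves-round : ∀ {x r y α} (cx : Copied x) (p : r ∈ rules) (cy : Copied y) →
    Solves (x ++ rhs r ++ y) α → Solves (x ++ lhs r ++ y) (round cx p cy ++ zero ∷ α)
  solves-round {x} {r} {y} {α} cx p cy s = begin
    map just (x ++ lhs r ++ y) ++ nothing ∷ push* (round cx p cy ++ zero ∷ α)
      ≡⟨ cong (λ z → map just (x ++ lhs r ++ y) ++ nothing ∷ z) (trans (concatMap-++ push (round cx p cy) (zero ∷ α)) (cong (_++ nothing ∷ push* α) pushes)) ⟩
    map just (x ++ lhs r ++ y) ++ nothing ∷ map just (x ++ rhs r ++ y) ++ nothing ∷ push* α
      ≡⟨ cong (λ z → map just (x ++ lhs r ++ y) ++ nothing ∷ z) s ⟩
    map just (x ++ lhs r ++ y) ++ nothing ∷ pop* α ++ final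
      ≡⟨ cong (_++ nothing ∷ pop* α ++ final) pops ⟨
    pop* (round cx p cy) ++ nothing ∷ pop* α ++ final
      ≡⟨ ++-assoc (pop* (round cx p cy)) (nothing ∷ pop* α) final ⟨
    (pop* (round cx p cy) ++ nothing ∷ pop* α) ++ final
      ≡⟨ cong (_++ final) (concatMap-++ pop (round cx p cy) (zero ∷ α)) ⟨
    pop* (round cx p cy ++ zero ∷ α) ++ final ∎
    where
    open ≡-Reasoning
    joined : ∀ l → map just (x ++ l ++ y) ≡ map just x ++ map just l ++ map just y
    joined l = trans (map-++ just x (l ++ y)) (cong (map just x ++_) (map-++ just l y))
    pushes : push* (round cx p cy) ≡ map just (x ++ rhs r ++ y)
    pushes = trans (concatMap-++ push (copies cx) _)
      (trans (cong₂ _++_ (push-copies cx) (cong₂ _++_ (push-number p) (push-copies cy))) (sym (joined (rhs r))))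
    pops : pop* (round cx p cy) ≡ map just (x ++ lhs r ++ y)
    pops = trans (concatMap-++ pop (copies cx) _)
      (trans (cong₂ _++_ (pop-copies cx) (cong₂ _++_ (pop-number p) (pop-copies cy))) (sym (joined (lhs r))))

  solves-⇝* : ∀ {v w α} → v ⇝* w → Solves w α → ∃[ β ] Solves v (β ++ α)
  solves-⇝* stop s = [] , s
  solves-⇝* {α = α} (rewriteBy cx p cy ▷ d) s with solves-⇝* d s
  ... | β , t = round cx p cy ++ zero ∷ β , subst (Solves _) (sym (++-assoc (round cx p cy) (zero ∷ β) α)) (solves-round cx p cy t)

-- Counter machines and their simulation by string rewriting

module CounterMachine where

  open import Data.Nat.Properties using (_≟_; +-assoc; +-comm; +-cancelˡ-≡)

  data Cmd : Set where
    inc  : ℕ → Cmd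
    loop : ℕ → List Cmd → Cmd

  Store : Set
  Store = ℕ → ℕ

  δ : ℕ → ℕ → ℕ
  δ r x with r ≟ x
  ... | yes _ = 1
  ... | no _  = 0

  δ-same : ∀ r → δ r r ≡ 1
  δ-same r with r ≟ r
  ... | yes _ = refl
  ... | no n = ⊥-elim (n refl)

  δ-other : ∀ {r x} → r ≢ x → δ r x ≡ 0
  δ-other {r} {x} n with r ≟ x
  ... | yes e = ⊥-elim (n e)
  ... | no _ = refl

  bump : ℕ → Store → Store
  bump r s x = δ r x + s x

  -- loop r P is: while r ≠ 0 do r := r − 1; P.
  data Halts : List Cmd → Store → Set where
    halt  : ∀ {s} → Halts [] s
    incr  : ∀ {r K s} → Halts K (bump r s) → Halts (inc r ∷ K) s
    leave : ∀ {r P K s} → s r ≡ 0 → Halts K s → Halts (loop r P ∷ K) s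
    enter : ∀ {r P K s s′} → (∀ x → s x ≡ bump r s′ x) → Halts (P ++ loop r P ∷ K) s′ → Halts (loop r P ∷ K) s

  -- Stores are functions, and moving register letters around on the tape changes `count` only up to
  -- pointwise equality.
  halts-ext : ∀ {K s s′} → (∀ x → s x ≡ s′ x) → Halts K s → Halts K s′
  halts-ext e halt = halt
  halts-ext e (incr {r} h) = incr (halts-ext (λ x → cong (δ r x +_) (e x)) h)
  halts-ext e (leave {r} z h) = leave (trans (sym (e r)) z) (halts-ext e h)
  halts-ext e (enter d h) = enter (λ x → trans (sym (e x)) (d x)) h

  count : List ℕ → Store
  count [] x = 0
  count (a ∷ σ) = bump a (count σ)

  count-mid : ∀ σ a τ x → count (σ ++ a ∷ τ) x ≡ bump a (count (σ ++ τ)) x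
  count-mid [] a τ x = refl
  count-mid (b ∷ σ) a τ x = begin
    δ b x + count (σ ++ a ∷ τ) x          ≡⟨ cong (δ b x +_) (count-mid σ a τ x) ⟩
    δ b x + (δ a x + count (σ ++ τ) x)    ≡⟨ +-assoc (δ b x) (δ a x) _ ⟨
    δ b x + δ a x + count (σ ++ τ) x      ≡⟨ cong (_+ count (σ ++ τ) x) (+-comm (δ b x) (δ a x)) ⟩
    δ a x + δ b x + count (σ ++ τ) x      ≡⟨ +-assoc (δ a x) (δ b x) _ ⟩
    δ a x + (δ b x + count (σ ++ τ) x)    ∎
    where open ≡-Reasoning

  ∉-count : ∀ {r} σ → r ∉ σ → count σ r ≡ 0
  ∉-count [] n = refl
  ∉-count (a ∷ σ) n = cong₂ _+_ (δ-other (λ e → n (here (sym e)))) (∉-count σ (n ∘ there))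

  count-∉ : ∀ {r} σ → count σ r ≡ 0 → r ∉ σ
  count-∉ (a ∷ σ) e (here refl) with trans (sym (cong (_+ count σ a) (δ-same a))) e
  ... | ()
  count-∉ {r} (a ∷ σ) e (there p) with r ≟ a
  ... | yes refl with trans (sym (cong (_+ count σ a) (δ-same a))) e
  ...   | ()
  count-∉ {r} (a ∷ σ) e (there p) | no n = count-∉ σ (trans (sym (cong (_+ count σ r) (δ-other (λ q → n (sym q))))) e) p

  count-∈ : ∀ {r n} σ → count σ r ≡ suc n → r ∈ σ
  count-∈ {r} (a ∷ σ) e with a ≟ r
  ... | yes p = here (sym p)
  ... | no _ = there (count-∈ σ e)

  ∉-∷ʳ : ∀ {r a : ℕ} σ → r ∉ σ → a ≢ r → r ∉ σ ++ a ∷ []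
  ∉-∷ʳ σ r∉σ n p with ∈-++⁻ σ p
  ... | inj₁ q = r∉σ q
  ... | inj₂ (here refl) = n refl

  -- The continuation lists occurring in an execution of the program.
  states : List Cmd → List (List Cmd)
  states [] = [] ∷ []
  states (inc r ∷ K) = (inc r ∷ K) ∷ states K
  states (loop r P ∷ K) = (loop r P ∷ K) ∷ map (_++ loop r P ∷ K) (states P) ++ states K

  data _↦_ : List Cmd → List Cmd → Set where
    incr  : ∀ {r K} → (inc r ∷ K) ↦ K
    leave : ∀ {r P K} → (loop r P ∷ K) ↦ K
    enter : ∀ {r P K} → (loop r P ∷ K) ↦ (P ++ loop r P ∷ K)

  self-state : ∀ Q → Q ∈ states Q
  self-state [] = here refl
  self-state (inc r ∷ K) = here refl
  self-state (loop r P ∷ K) = here refl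

  -- Closure under steps keeps the control letters, and with them the rules, finite in number. A
  -- body `P` runs with its loop behind it, which is why `states P` occurs with that suffix
  -- appended.
  state-step : ∀ Q {K K′} → K ∈ states Q → K ↦ K′ → K′ ∈ states Q
  state-step [] (here refl) ()
  state-step (inc r ∷ Q) (here refl) incr = there (self-state Q)
  state-step (inc r ∷ Q) (there p) s = there (state-step Q p s)
  state-step (loop r P ∷ Q) {K} {K′} p s = there (go p)
    where
    M = loop r P ∷ Q
    here-case : M ↦ K′ → K′ ∈ map (_++ M) (states P) ++ states Q
    here-case leave = ∈-++⁺ʳ _ (self-state Q)
    here-case enter = ∈-++⁺ˡ (∈-map⁺ (_++ M) (self-state P))
    inner : ∀ K₀ → K₀ ∈ states P → (K₀ ++ M) ↦ K′ → K′ ∈ map (_++ M) (states P) ++ states Q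
    inner [] p s = here-case s
    inner (inc _ ∷ K₀) p incr = ∈-++⁺ˡ (∈-map⁺ (_++ M) (state-step P p incr))
    inner (loop _ _ ∷ K₀) p leave = ∈-++⁺ˡ (∈-map⁺ (_++ M) (state-step P p leave))
    inner (loop r′ P′ ∷ K₀) p enter = ∈-++⁺ˡ (subst (_∈ map (_++ M) (states P)) (++-assoc P′ _ M)
      (∈-map⁺ (_++ M) (state-step P p enter)))
    go : K ∈ M ∷ map (_++ M) (states P) ++ states Q → K′ ∈ map (_++ M) (states P) ++ states Q
    go (here refl) = here-case s
    go (there p) with ∈-++⁻ (map (_++ M) (states P)) p
    ... | inj₂ q = ∈-++⁺ʳ _ (state-step Q q s)
    ... | inj₁ q with ∈-map⁻ (_++ M) q
    ...   | K₀ , q′ , refl = inner K₀ q′ s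

  data Sym : Set where
    L R H init : Sym
    reg        : ℕ → Sym
    run        : List Cmd → Sym
    test       : ℕ → List Cmd → Sym

  module Machine (Q : List Cmd) where

    -- The store is a word of register letters between L and R, in any order; a state walks freely
    -- inside it, and a register is tested for zero by a sweep from L to R.
    data Rule : Set where
      copy eatL eatR spawn : Sym → Rule
      start accept : Rule
      incr         : ℕ → List Cmd → Rule
      dec probe    : ℕ → List Cmd → List Cmd → Rule
      goL goR      : List Cmd → ℕ → Rule
      pass         : (r : ℕ) (K : List Cmd) (a : ℕ) → a ≢ r → Rule
      back         : ℕ → List Cmd → Rule

    lhs⁺ rhs⁺ : Rule → List⁺ Sym
    lhs⁺ (copy a)       = a ∷ []
    lhs⁺ (eatL a)       = a ∷ H ∷ []
    lhs⁺ (eatR a)       = H ∷ a ∷ []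
    lhs⁺ (spawn a)      = H ∷ []
    lhs⁺ start          = init ∷ []
    lhs⁺ accept         = run [] ∷ []
    lhs⁺ (incr r K)     = run (inc r ∷ K) ∷ []
    lhs⁺ (dec r P K)    = run (loop r P ∷ K) ∷ reg r ∷ []
    lhs⁺ (probe r P K)  = L ∷ run (loop r P ∷ K) ∷ []
    lhs⁺ (goL K a)      = reg a ∷ run K ∷ []
    lhs⁺ (goR K a)      = run K ∷ reg a ∷ []
    lhs⁺ (pass r K a _) = test r K ∷ reg a ∷ []
    lhs⁺ (back r K)     = test r K ∷ R ∷ []
    rhs⁺ (copy a)       = a ∷ []
    rhs⁺ (eatL a)       = H ∷ []
    rhs⁺ (eatR a)       = H ∷ []
    rhs⁺ (spawn a)      = H ∷ a ∷ []
    rhs⁺ start          = run Q ∷ []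
    rhs⁺ accept         = H ∷ []
    rhs⁺ (incr r K)     = reg r ∷ run K ∷ []
    rhs⁺ (dec r P K)    = run (P ++ loop r P ∷ K) ∷ []
    rhs⁺ (probe r P K)  = L ∷ test r K ∷ []
    rhs⁺ (goL K a)      = run K ∷ reg a ∷ []
    rhs⁺ (goR K a)      = reg a ∷ run K ∷ []
    rhs⁺ (pass r K a _) = reg a ∷ test r K ∷ []
    rhs⁺ (back r K)     = run K ∷ R ∷ []

    lhs rhs : Rule → List Sym
    lhs = toList ∘ lhs⁺
    rhs = toList ∘ rhs⁺

    tape : List ℕ → List Sym
    tape τ = map reg τ ++ R ∷ []

    conf : List ℕ → Sym → List ℕ → List Sym
    conf σ c τ = (L ∷ map reg σ) ++ c ∷ tape τ

    conf-∷ʳ : ∀ σ a c τ → conf (σ ++ a ∷ []) c τ ≡ (L ∷ map reg σ) ++ reg a ∷ c ∷ tape τ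
    conf-∷ʳ σ a c τ = cong (L ∷_) (trans (cong (_++ c ∷ tape τ) (map-++ reg σ (a ∷ []))) (++-assoc (map reg σ) _ _))

    -- The control letters that can occur in a derivation from an initial word, given the registers
    -- to their left.
    data Admissible : Sym → List ℕ → Set where
      init : Admissible init []
      run  : ∀ {K σ} → Admissible (run K) σ
      test : ∀ {r K σ} → r ∉ σ → Admissible (test r K) σ

    Meaning : Sym → List ℕ → Set
    Meaning init ρ       = Halts Q (count ρ)
    Meaning (run K) ρ    = Halts K (count ρ)
    Meaning (test r K) ρ = count ρ r ≡ 0 × Halts K (count ρ)
    Meaning _ ρ          = ⊥

    -- A word that is no configuration, or whose control letter is `H`, is vacuously sound. Hence
    -- `H` is a base case, and the rules that eat or create letters beside it preserve soundness.
    Sound : List Sym → Set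
    Sound w = ∀ c σ τ → w ≡ conf σ c τ → Admissible c σ → Meaning c (σ ++ τ)

    data Control : Sym → Set where
      H    : Control H
      init : Control init
      run  : ∀ K → Control (run K)
      test : ∀ r K → Control (test r K)

    control-tape : ∀ {c} → Control c → ∀ x τ {y} → x ++ c ∷ y ≢ tape τ
    control-tape () [] [] refl
    control-tape c (_ ∷ []) [] ()
    control-tape c (_ ∷ _ ∷ _) [] ()
    control-tape () [] (a ∷ τ) refl
    control-tape c (_ ∷ x) (a ∷ τ) e = control-tape c x τ (∷-injectiveʳ e)

    control-reg : ∀ {a} → ¬ Control (reg a)
    control-reg ()

    locate : ∀ {c c′ y τ} → Control c → ∀ x σ → x ++ c ∷ y ≡ conf σ c′ τ → x ≡ L ∷ map reg σ × c ≡ c′ × y ≡ tape τ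
    locate {c} {c′} {y} {τ} k (a ∷ x) σ e with ∷-injectiveˡ e | go x σ (∷-injectiveʳ e)
      where
      go : ∀ x σ → x ++ c ∷ y ≡ map reg σ ++ c′ ∷ tape τ → x ≡ map reg σ × c ≡ c′ × y ≡ tape τ
      go [] [] refl = refl , refl , refl
      go (_ ∷ x) [] e = ⊥-elim (control-tape k x τ (∷-injectiveʳ e))
      go [] (s ∷ σ) e = ⊥-elim (control-reg (subst Control (∷-injectiveˡ e) k))
      go (a ∷ x) (s ∷ σ) e with ∷-injectiveˡ e | go x σ (∷-injectiveʳ e)
      ... | refl | p , q , r = cong (_ ∷_) p , q , r
    ... | refl | p , q , r = cong (L ∷_) p , q , r
    locate () [] σ refl

    locate₂ : ∀ {c c′ d y τ} → Control c → ∀ x σ → x ++ d ∷ c ∷ y ≡ conf σ c′ τ →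
      x ++ d ∷ [] ≡ L ∷ map reg σ × c ≡ c′ × y ≡ tape τ
    locate₂ {c} {d = d} {y} k x σ e = locate k (x ++ d ∷ []) σ (trans (++-assoc x (d ∷ []) (c ∷ y)) e)

    reg-tape : ∀ {a y} τ → reg a ∷ y ≡ tape τ → ∃[ τ′ ] τ ≡ a ∷ τ′ × y ≡ tape τ′
    reg-tape (a ∷ τ) refl = τ , refl , refl

    R-tape : ∀ {y} τ → R ∷ y ≡ tape τ → τ ≡ [] × y ≡ []
    R-tape [] refl = refl , refl

    reg-end : ∀ {a} x σ → x ++ reg a ∷ [] ≡ L ∷ map reg σ → ∃[ σ′ ] σ ≡ σ′ ++ a ∷ [] × x ≡ L ∷ map reg σ′
    reg-end (b ∷ x) σ e with ∷-injectiveˡ e | go x σ (∷-injectiveʳ e)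
      where
      go : ∀ {a} x σ → x ++ reg a ∷ [] ≡ map reg σ → ∃[ σ′ ] σ ≡ σ′ ++ a ∷ [] × x ≡ map reg σ′
      go [] (a ∷ []) refl = [] , refl , refl
      go (b ∷ x) (s ∷ σ) e with ∷-injectiveˡ e | go x σ (∷-injectiveʳ e)
      ... | refl | σ′ , refl , refl = s ∷ σ′ , refl , refl
      go [] [] ()
      go [] (_ ∷ _ ∷ _) ()
      go (_ ∷ _) [] ()
    ... | refl | σ′ , refl , refl = σ′ , refl , refl

    L-end : ∀ x σ → x ++ L ∷ [] ≡ L ∷ map reg σ → x ≡ [] × σ ≡ []
    L-end [] [] refl = refl , refl
    L-end (b ∷ x) σ e = ⊥-elim (go x σ (∷-injectiveʳ e))
      where
      go : ∀ x σ → x ++ L ∷ [] ≢ map reg σ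
      go [] [] ()
      go [] (_ ∷ _) ()
      go (_ ∷ x) [] ()
      go (_ ∷ x) (s ∷ σ) e = go x σ (∷-injectiveʳ e)

    sound-H : Sound (H ∷ [])
    sound-H c σ τ ()

    -- Apart from `copy`, every left hand side contains a control letter, and a configuration has
    -- only one, which fixes the parse. `H` is never admissible, `accept` halts at once, and in the
    -- other cases the right hand side is again a configuration.
    sound-back : ∀ x r y → Sound (x ++ rhs r ++ y) → Sound (x ++ lhs r ++ y)
    sound-back x (copy a) y q = q
    sound-back x (eatL a) y q c σ τ e A with locate₂ H x σ e | A
    ... | _ , refl , _ | ()
    sound-back x (eatR a) y q c σ τ e A with locate H x σ e | A
    ... | _ , refl , _ | ()
    sound-back x (spawn a) y q c σ τ e A with locate H x σ e | A
    ... | _ , refl , _ | ()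
    sound-back x start y q c σ τ e A with locate init x σ e | A
    ... | refl , refl , refl | init = q (run Q) [] τ refl run
    sound-back x accept y q c σ τ e A with locate (run []) x σ e
    ... | _ , refl , _ = halt
    sound-back x (incr r K) y q c σ τ e A with locate (run _) x σ e
    ... | refl , refl , refl = incr (halts-ext ext (q (run K) (σ ++ r ∷ []) τ (sym (conf-∷ʳ σ r (run K) τ)) run))
      where
      ext : ∀ x → count ((σ ++ r ∷ []) ++ τ) x ≡ bump r (count (σ ++ τ)) x
      ext x = trans (cong (λ ρ → count ρ x) (++-assoc σ _ τ)) (count-mid σ r τ x)
    sound-back x (dec r P K) y q c σ τ e A with locate (run _) x σ e
    ... | refl , refl , e′ with reg-tape τ e′
    ...   | τ′ , refl , refl = enter (count-mid σ r τ′) (q (run (P ++ loop r P ∷ K)) σ τ′ refl run)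
    sound-back x (probe r P K) y q c σ τ e A with locate₂ (run _) x σ e
    ... | e′ , refl , refl with L-end x σ e′
    -- Nothing has been swept yet, so the new test letter is admissible.
    ...   | refl , refl = let z , h = q (test r K) [] τ refl (test λ ()) in leave z h
    sound-back x (goL K a) y q c σ τ e A with locate₂ (run _) x σ e
    ... | e′ , refl , refl with reg-end x σ e′
    ...   | σ′ , refl , refl = subst (λ ρ → Halts K (count ρ)) (sym (++-assoc σ′ _ τ)) (q (run K) σ′ (a ∷ τ) refl run)
    sound-back x (goR K a) y q c σ τ e A with locate (run _) x σ e
    ... | refl , refl , e′ with reg-tape τ e′
    ...   | τ′ , refl , refl = subst (λ ρ → Halts K (count ρ)) (++-assoc σ _ τ′)
              (q (run K) (σ ++ a ∷ []) τ′ (sym (conf-∷ʳ σ a (run K) τ′)) run)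
    sound-back x (pass r K a n) y q c σ τ e A with locate (test _ _) x σ e | A
    ... | refl , refl , e′ | test r∉σ with reg-tape τ e′
    ...   | τ′ , refl , refl = subst (λ ρ → count ρ r ≡ 0 × Halts K (count ρ)) (++-assoc σ _ τ′)
              (q (test r K) (σ ++ a ∷ []) τ′ (sym (conf-∷ʳ σ a (test r K) τ′)) (test (∉-∷ʳ {r} {a} σ r∉σ n)))
    sound-back x (back r K) y q c σ τ e A with locate (test _ _) x σ e | A
    ... | refl , refl , e′ | test r∉σ with R-tape τ e′
    -- The whole store now lies to the left of the test letter, so `r∉σ` says that the register is
    -- zero.
    ...   | refl , refl = ∉-count (σ ++ []) (λ p → r∉σ (subst (r ∈_) (++-identityʳ σ) p)) , q (run K) σ [] refl run

    used-register : List Cmd → List ℕ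
    used-register [] = []
    used-register (inc r ∷ _) = r ∷ []
    used-register (loop r _ ∷ _) = r ∷ []

    -- `0` holds the input and is listed even if the program never mentions it.
    registers : List ℕ
    registers = 0 ∷ concatMap used-register (states Q)

    passes : ℕ → List Cmd → List ℕ → List Rule
    passes r K [] = []
    passes r K (a ∷ as) with a ≟ r
    ... | yes _ = passes r K as
    ... | no n = pass r K a n ∷ passes r K as

    rulesOf : List Cmd → List Rule
    rulesOf [] = []
    rulesOf (inc r ∷ K) = incr r K ∷ []
    rulesOf (loop r P ∷ K) = dec r P K ∷ probe r P K ∷ back r K ∷ passes r K registers ++
      map (goL (loop r P ∷ K)) registers ++ map (goR (loop r P ∷ K)) registers

    basicRules : List Rule
    basicRules = start ∷ accept ∷ concatMap rulesOf (states Q)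

    -- The rules added for these letters involve only the letter itself and `H`, so the alphabet is
    -- already closed.
    letters : List Sym
    letters = L ∷ R ∷ H ∷ map reg registers ++ concatMap (λ r → lhs r ++ rhs r) basicRules

    letterRules : Sym → List Rule
    letterRules a = copy a ∷ eatL a ∷ eatR a ∷ spawn a ∷ []

    rules : List Rule
    rules = basicRules ++ concatMap letterRules letters

    lhs-copy : ∀ a → lhs⁺ (copy a) ≡ a ∷ []
    lhs-copy a = refl

    rhs-copy : ∀ a → rhs⁺ (copy a) ≡ a ∷ []
    rhs-copy a = refl

    open Correspondence lhs⁺ rhs⁺ copy lhs-copy rhs-copy H rules public hiding (lhs; rhs)

    basic-rule : ∀ {K r} → K ∈ states Q → r ∈ rulesOf K → r ∈ basicRules
    basic-rule p q = there (there (∈-concatMap⁺ rulesOf (Any.map (λ { refl → q }) p)))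

    rule : ∀ {K r} → K ∈ states Q → r ∈ rulesOf K → r ∈ rules
    rule p q = ∈-++⁺ˡ (basic-rule p q)

    letterRule : ∀ {a r} → a ∈ letters → r ∈ letterRules a → r ∈ rules
    letterRule p q = ∈-++⁺ʳ basicRules (∈-concatMap⁺ letterRules (Any.map (λ { refl → q }) p))

    Letters : List Sym → Set
    Letters = All (_∈ letters)

    copied : ∀ {x} → Letters x → Copied x
    copied = All.map (λ p → letterRule p (here refl))

    register : ∀ {a} → a ∈ registers → reg a ∈ letters
    register p = there (there (there (∈-++⁺ˡ (∈-map⁺ reg p))))

    Registers : List ℕ → Set
    Registers = All (_∈ registers)

    reg-letters : ∀ {σ} → Registers σ → Letters (map reg σ)
    reg-letters = Allₚ.map⁺ ∘ All.map register

    tape-letters : ∀ {τ} → Registers τ → Letters (tape τ)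
    tape-letters ps = Allₚ.++⁺ (reg-letters ps) (there (here refl) ∷ [])

    in-context : ∀ {σ r τ} → Registers σ → r ∈ rules → Registers τ →
      ((L ∷ map reg σ) ++ lhs r ++ tape τ) ⇝ ((L ∷ map reg σ) ++ rhs r ++ tape τ)
    in-context pσ p pτ = rewriteBy (copied (here refl ∷ reg-letters pσ)) p (copied (tape-letters pτ))

    ⇝*-∷ : ∀ {a v w} → a ∈ letters → v ⇝* w → (a ∷ v) ⇝* (a ∷ w)
    ⇝*-∷ p stop = stop
    ⇝*-∷ {a} p (rewriteBy {x} cx q cy ▷ d) = rewriteBy {a ∷ x} (letterRule p (here refl) ∷ cx) q cy ▷ ⇝*-∷ p d

    eat-left : ∀ x {y} → Letters x → Letters y → (x ++ H ∷ y) ⇝* (H ∷ y)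
    eat-left [] [] py = stop
    eat-left (a ∷ x) (p ∷ px) py = ⇝*-trans (⇝*-∷ p (eat-left x px py))
      (rewriteBy [] (letterRule p (there (here refl))) (copied py) ▷ stop)

    eat-right : ∀ {y} → Letters y → (H ∷ y) ⇝* (H ∷ [])
    eat-right [] = stop
    eat-right (p ∷ py) = rewriteBy [] (letterRule p (there (there (here refl)))) (copied py) ▷ eat-right py

    H∈letters : H ∈ letters
    H∈letters = there (there (here refl))

    spawn-right : ∀ {y} → Letters y → (H ∷ []) ⇝* (H ∷ y)
    spawn-right [] = stop
    spawn-right (p ∷ py) = ⇝*-trans (spawn-right py)
      (rewriteBy [] (letterRule p (there (there (there (here refl))))) (copied py) ▷ stop)

    module _ {r P K} (K∈ : (loop r P ∷ K) ∈ states Q) where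

      private
        M : List Cmd
        M = loop r P ∷ K

      goR-rule : ∀ {a} → a ∈ registers → goR M a ∈ rules
      goR-rule p = rule K∈ (there (there (there (∈-++⁺ʳ (passes r K registers) (∈-++⁺ʳ (map (goL M) registers) (∈-map⁺ (goR M) p))))))

      goL-rule : ∀ {a} → a ∈ registers → goL M a ∈ rules
      goL-rule p = rule K∈ (there (there (there (∈-++⁺ʳ (passes r K registers) (∈-++⁺ˡ (∈-map⁺ (goL M) p))))))

      pass-rule : ∀ {a} → a ∈ registers → a ≢ r → ∃[ n ] pass r K a n ∈ rules
      pass-rule {a} p ne with go registers p
        where
        go : ∀ as → a ∈ as → ∃[ n ] pass r K a n ∈ passes r K as
        go (b ∷ as) (here refl) with b ≟ r
        ... | yes e = ⊥-elim (ne e)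
        ... | no n = n , here refl
        go (b ∷ as) (there p) with b ≟ r | go as p
        ... | yes _ | q = q
        ... | no _ | n , q = n , there q
      ... | n , q = n , rule K∈ (there (there (there (∈-++⁺ˡ q))))

      walk-right : ∀ {σ} ρ {τ} → Registers σ → Registers ρ → Registers τ → conf σ (run M) (ρ ++ τ) ⇝* conf (σ ++ ρ) (run M) τ
      walk-right {σ} [] {τ} pσ [] pτ = subst (λ z → conf σ (run M) τ ⇝* conf z (run M) τ) (sym (++-identityʳ σ)) stop
      walk-right {σ} (a ∷ ρ) {τ} pσ (p ∷ pρ) pτ =
        subst (conf σ (run M) (a ∷ ρ ++ τ) ⇝_) (sym (conf-∷ʳ σ a (run M) (ρ ++ τ)))
          (in-context pσ (goR-rule p) (Allₚ.++⁺ pρ pτ)) ▷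
        subst (λ z → conf (σ ++ a ∷ []) (run M) (ρ ++ τ) ⇝* conf z (run M) τ) (++-assoc σ (a ∷ []) ρ)
          (walk-right ρ (Allₚ.++⁺ pσ (p ∷ [])) pρ pτ)

      walk-left : ∀ σ ρ {τ} → Registers σ → Registers ρ → Registers τ → conf (σ ++ ρ) (run M) τ ⇝* conf σ (run M) (ρ ++ τ)
      walk-left σ [] {τ} pσ [] pτ = subst (λ z → conf z (run M) τ ⇝* conf σ (run M) τ) (sym (++-identityʳ σ)) stop
      walk-left σ (a ∷ ρ) {τ} pσ (p ∷ pρ) pτ = ⇝*-trans
        (subst (λ z → conf z (run M) τ ⇝* conf (σ ++ a ∷ []) (run M) (ρ ++ τ)) (++-assoc σ (a ∷ []) ρ)
          (walk-left (σ ++ a ∷ []) ρ (Allₚ.++⁺ pσ (p ∷ [])) pρ pτ))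
        (subst (_⇝ conf σ (run M) (a ∷ ρ ++ τ)) (sym (conf-∷ʳ σ a (run M) (ρ ++ τ)))
          (in-context pσ (goL-rule p) (Allₚ.++⁺ pρ pτ)) ▷ stop)

      sweep : ∀ {σ} ρ → Registers σ → Registers ρ → r ∉ ρ → conf σ (test r K) ρ ⇝* conf (σ ++ ρ) (test r K) []
      sweep {σ} [] pσ [] n = subst (λ z → conf σ (test r K) [] ⇝* conf z (test r K) []) (sym (++-identityʳ σ)) stop
      sweep {σ} (a ∷ ρ) pσ (p ∷ pρ) n with pass-rule p (λ e → n (here (sym e)))
      ... | ne , q =
        subst (conf σ (test r K) (a ∷ ρ) ⇝_) (sym (conf-∷ʳ σ a (test r K) ρ)) (in-context pσ q pρ) ▷
        subst (λ z → conf (σ ++ a ∷ []) (test r K) ρ ⇝* conf z (test r K) []) (++-assoc σ (a ∷ []) ρ)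
          (sweep ρ (Allₚ.++⁺ pσ (p ∷ [])) pρ (n ∘ there))

      leave-⇝* : ∀ {σ τ} → Registers σ → Registers τ → r ∉ σ ++ τ → conf σ (run M) τ ⇝* conf (σ ++ τ) (run K) []
      leave-⇝* {σ} {τ} pσ pτ n = ⇝*-trans (walk-left [] σ [] pσ pτ)
        (rewriteBy [] (rule K∈ (there (here refl))) (copied (tape-letters (Allₚ.++⁺ pσ pτ))) ▷
         ⇝*-trans (sweep (σ ++ τ) [] (Allₚ.++⁺ pσ pτ) n)
           (rewriteBy (copied (here refl ∷ reg-letters (Allₚ.++⁺ pσ pτ))) (rule K∈ (there (there (here refl)))) [] ▷ stop))

      enter-⇝* : ∀ {σ τ} ρ₁ ρ₂ → Registers σ → Registers τ → σ ++ τ ≡ ρ₁ ++ r ∷ ρ₂ →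
        conf σ (run M) τ ⇝* conf ρ₁ (run (P ++ M)) ρ₂
      enter-⇝* {σ} {τ} ρ₁ ρ₂ pσ pτ e with subst Registers e (Allₚ.++⁺ pσ pτ)
      ... | pρ with Allₚ.++⁻ˡ ρ₁ pρ | Allₚ.++⁻ʳ ρ₁ pρ
      ...   | p₁ | q ∷ p₂ = ⇝*-trans (walk-left [] σ [] pσ pτ)
        (subst (λ z → conf [] (run M) z ⇝* conf ρ₁ (run (P ++ M)) ρ₂) (sym e)
          (⇝*-trans (walk-right ρ₁ [] p₁ (q ∷ p₂)) (in-context p₁ (rule K∈ (here refl)) p₂ ▷ stop)))

    used-registers : ∀ {K r} → K ∈ states Q → r ∈ used-register K → r ∈ registers
    used-registers p q = there (∈-concatMap⁺ used-register (Any.map (λ { refl → q }) p))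

    -- A store determines its tape only up to order, so the order of the letters and the place of
    -- the state are left arbitrary; they change during the run.
    halts-⇝* : ∀ {K s} → Halts K s → K ∈ states Q → ∀ σ τ → (∀ x → s x ≡ count (σ ++ τ) x) →
      Registers σ → Registers τ → conf σ (run K) τ ⇝* (H ∷ [])
    halts-⇝* halt p σ τ e pσ pτ = in-context pσ (there (here refl)) pτ ▷
      ⇝*-trans (eat-left (L ∷ map reg σ) (here refl ∷ reg-letters pσ) (tape-letters pτ)) (eat-right (tape-letters pτ))
    halts-⇝* (incr {r} {K} {s} h) p σ τ e pσ pτ =
      subst (conf σ (run (inc r ∷ K)) τ ⇝_) (sym (conf-∷ʳ σ r (run K) τ)) (in-context pσ (rule p (here refl)) pτ) ▷
      halts-⇝* h (state-step Q p incr) (σ ++ r ∷ []) τ ext (Allₚ.++⁺ pσ (used-registers p (here refl) ∷ [])) pτ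
      where
      ext : ∀ x → bump r s x ≡ count ((σ ++ r ∷ []) ++ τ) x
      ext x = trans (cong (δ r x +_) (e x)) (sym (trans (cong (λ ρ → count ρ x) (++-assoc σ _ τ)) (count-mid σ r τ x)))
    halts-⇝* (leave {r} z h) p σ τ e pσ pτ = ⇝*-trans
      (leave-⇝* p pσ pτ (count-∉ (σ ++ τ) (trans (sym (e r)) z)))
      (halts-⇝* h (state-step Q p leave) (σ ++ τ) [] (λ x → trans (e x) (cong (λ ρ → count ρ x) (sym (++-identityʳ (σ ++ τ)))))
        (Allₚ.++⁺ pσ pτ) [])
    halts-⇝* (enter {r} {P} {K} {s} {s′} d h) p σ τ e pσ pτ
      with ∈-∃++ (count-∈ (σ ++ τ) (trans (sym (e r)) (trans (d r) (cong (_+ s′ r) (δ-same r)))))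
    ... | ρ₁ , ρ₂ , q = ⇝*-trans (enter-⇝* p ρ₁ ρ₂ pσ pτ q)
          (halts-⇝* h (state-step Q p enter) ρ₁ ρ₂ ext (Allₚ.++⁻ˡ ρ₁ pρ) (All.tail (Allₚ.++⁻ʳ ρ₁ pρ)))
      where
      pρ : Registers (ρ₁ ++ r ∷ ρ₂)
      pρ = subst Registers q (Allₚ.++⁺ pσ pτ)
      ext : ∀ x → s′ x ≡ count (ρ₁ ++ ρ₂) x
      ext x = +-cancelˡ-≡ (δ r x) _ _ (trans (sym (d x)) (trans (e x) (trans (cong (λ ρ → count ρ x) q) (count-mid ρ₁ r ρ₂ x))))

    initial : ℕ → List Sym
    initial n = conf [] init (replicate n 0)

    initial-⇝* : ∀ n → Halts Q (count (replicate n 0)) → initial n ⇝* (H ∷ [])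
    initial-⇝* n h = in-context [] (here refl) zeros ▷
      halts-⇝* h (self-state Q) [] (replicate n 0) (λ x → refl) [] zeros
      where
      zeros : Registers (replicate n 0)
      zeros = Allₚ.replicate⁺ n (here refl)

    initial-sound : ∀ n α → Solves (initial n) α → Halts Q (count (replicate n 0))
    initial-sound n α s = solves-sound Sound sound-H sound-back (initial n) α s init [] (replicate n 0) refl init

    rule-letters : ∀ {r} → r ∈ rules → Letters (lhs r) × Letters (rhs r)
    rule-letters {r} p with ∈-++⁻ basicRules p
    ... | inj₁ q = Allₚ.++⁻ (lhs r) (All.tabulate λ a∈ →
            there (there (there (∈-++⁺ʳ (map reg registers) (∈-concatMap⁺ (λ r → lhs r ++ rhs r) (Any.map (λ { refl → a∈ }) q))))))
    ... | inj₂ q = go letters (λ a∈ → a∈) (∈-concatMap⁻ letterRules q)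
      where
      go : ∀ as → (∀ {a} → a ∈ as → a ∈ letters) → Any.Any (λ a → r ∈ letterRules a) as → Letters (lhs r) × Letters (rhs r)
      go (a ∷ as) f (there q) = go as (f ∘ there) q
      go (a ∷ as) f (here (here refl)) = f (here refl) ∷ [] , f (here refl) ∷ []
      go (a ∷ as) f (here (there (here refl))) = f (here refl) ∷ H∈letters ∷ [] , H∈letters ∷ []
      go (a ∷ as) f (here (there (there (here refl)))) = H∈letters ∷ f (here refl) ∷ [] , H∈letters ∷ []
      go (a ∷ as) f (here (there (there (there (here refl))))) = H∈letters ∷ [] , H∈letters ∷ f (here refl) ∷ []

    -- Once H is reached, any rule can be applied to a freely created left hand side.
    solves-using : ∀ n → Halts Q (count (replicate n 0)) → ∀ {r} (p : r ∈ rules) →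
      ∃[ α ] Solves (initial n) α × number p ∈ α × zero ∈ α
    solves-using n h {r} p with rule-letters p
    ... | pl , pr with solves-⇝* (eat-right pr) solves-H
    ...   | β , s = result
      where
      H∈ : Letters (H ∷ [])
      H∈ = H∈letters ∷ []
      γ : List E
      γ = round (copied H∈) p [] ++ zero ∷ β ++ []
      s′ : Solves (H ∷ lhs r) γ
      s′ = subst (λ z → Solves (H ∷ z) γ) (++-identityʳ (lhs r))
        (solves-round {α = β ++ []} (copied H∈) p [] (subst (λ z → Solves (H ∷ z) (β ++ [])) (sym (++-identityʳ (rhs r))) s))
      result : ∃[ α ] Solves (initial n) α × number p ∈ α × zero ∈ α
      result with solves-⇝* (⇝*-trans (initial-⇝* n h) (spawn-right pl)) s′
      ... | α , t = α ++ γ , t , ∈-++⁺ʳ α (there (here refl)) , ∈-++⁺ʳ α (there (there (here refl)))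

    numbered : ∀ (rs : List Rule) i → ∃[ r ] Σ (r ∈ rs) λ p → index p ≡ i
    numbered (r ∷ rs) zero = r , here refl , refl
    numbered (r ∷ rs) (suc i) = let r′ , p , e = numbered rs i in r′ , there p , cong suc e

    solves-using-every : ∀ n → Halts Q (count (replicate n 0)) → ∀ e → ∃[ α ] Solves (initial n) α × e ∈ α
    solves-using-every n h zero = let α , s , _ , z = solves-using n h {accept} (there (here refl)) in α , s , z
    solves-using-every n h (suc i) =
      let r , p , e = numbered rules i
          α , s , q , _ = solves-using n h p
      in α , s , subst (λ j → suc j ∈ α) e q

-- Compilation of μ-recursive functions into counter machines

module Compilation where

  open import Data.Nat.Properties
  open CounterMachine

  mutual
    -- Only the existence of a value matters below, and induction on derivations follows the
    -- compiled program more closely than induction on fuel.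
    data Ev : ∀ {n} → Code n → Vec ℕ n → ℕ → Set where
      Z     : ∀ {n} {xs : Vec ℕ n} → Ev Z xs 0
      S     : ∀ {x} → Ev S (x ∷ []) (suc x)
      proj  : ∀ {n} {xs : Vec ℕ n} i → Ev (proj i) xs (lookupV xs i)
      comp  : ∀ {m n g y ys} {hs : Vec (Code n) m} {xs} → EvVec hs xs ys → Ev g ys y → Ev (comp g hs) xs y
      prec₀ : ∀ {n g h y} {xs : Vec ℕ n} → Ev g xs y → Ev (prec g h) (0 ∷ xs) y
      precₛ : ∀ {n g h k r y} {xs : Vec ℕ n} → Ev (prec g h) (k ∷ xs) r → Ev h (k ∷ r ∷ xs) y → Ev (prec g h) (suc k ∷ xs) y
      mu    : ∀ {n g y} {xs : Vec ℕ n} → EvMu g xs 0 y → Ev (mu g) xs y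

    data EvVec : ∀ {m n} → Vec (Code n) m → Vec ℕ n → Vec ℕ m → Set where
      []  : ∀ {n} {xs : Vec ℕ n} → EvVec [] xs []
      _∷_ : ∀ {m n h y ys} {hs : Vec (Code n) m} {xs} → Ev h xs y → EvVec hs xs ys → EvVec (h ∷ hs) xs (y ∷ ys)

    data EvMu : ∀ {n} → Code (suc n) → Vec ℕ n → ℕ → ℕ → Set where
      found : ∀ {n g i} {xs : Vec ℕ n} → Ev g (i ∷ xs) 0 → EvMu g xs i i
      next  : ∀ {n g i v y} {xs : Vec ℕ n} → Ev g (i ∷ xs) (suc v) → EvMu g xs (suc i) y → EvMu g xs i y

  mutual
    eval-Ev : ∀ f {n} (c : Code n) xs {y} → eval f c xs ≡ just y → Ev c xs y
    eval-Ev (suc f) Z xs refl = Z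
    eval-Ev (suc f) S (x ∷ []) refl = S
    eval-Ev (suc f) (proj i) xs refl = proj i
    eval-Ev (suc f) (comp g hs) xs e with evalVec f hs xs in eq
    ... | just ys = comp (evalVec-Ev f hs xs eq) (eval-Ev f g ys e)
    eval-Ev (suc f) (prec g h) (zero ∷ xs) e = prec₀ (eval-Ev f g xs e)
    eval-Ev (suc f) (prec g h) (suc k ∷ xs) e with eval f (prec g h) (k ∷ xs) in eq
    ... | just r = precₛ (eval-Ev f (prec g h) (k ∷ xs) eq) (eval-Ev f h (k ∷ r ∷ xs) e)
    eval-Ev (suc f) (mu g) xs e = mu (search-Ev f g xs 0 e)

    evalVec-Ev : ∀ f {m n} (hs : Vec (Code n) m) xs {ys} → evalVec f hs xs ≡ just ys → EvVec hs xs ys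
    evalVec-Ev f [] xs refl = []
    evalVec-Ev f (h ∷ hs) xs e with eval f h xs in eq
    ... | just y with evalVec f hs xs in eq′
    evalVec-Ev f (h ∷ hs) xs refl | just y | just ys = eval-Ev f h xs eq ∷ evalVec-Ev f hs xs eq′

    search-Ev : ∀ f {n} (g : Code (suc n)) xs i {y} → search f g xs i ≡ just y → EvMu g xs i y
    search-Ev (suc f) g xs i e with eval f g (i ∷ xs) in eq
    search-Ev (suc f) g xs i refl | just zero = found (eval-Ev f g (i ∷ xs) eq)
    search-Ev (suc f) g xs i e | just (suc v) = next (eval-Ev f g (i ∷ xs) eq) (search-Ev f g xs (suc i) e)

  -- Both directions are used: `from` shows that the final program halts after one answer of the
  -- decider, `to` that it diverges after the other.
  record _≅_ (c d : List Cmd × Store) : Set where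
    constructor equiv
    field
      to   : Halts (proj₁ c) (proj₂ c) → Halts (proj₁ d) (proj₂ d)
      from : Halts (proj₁ d) (proj₂ d) → Halts (proj₁ c) (proj₂ c)

  open _≅_ public

  ≅-refl : ∀ {c} → c ≅ c
  ≅-refl = equiv id id

  ≅-trans : ∀ {c d e} → c ≅ d → d ≅ e → c ≅ e
  ≅-trans p q = equiv (to q ∘ to p) (from p ∘ from q)

  inc-≅ : ∀ r K s → (inc r ∷ K , s) ≅ (K , bump r s)
  inc-≅ r K s = equiv (λ { (incr h) → h }) incr

  leave-≅ : ∀ r P K s → s r ≡ 0 → (loop r P ∷ K , s) ≅ (K , s)
  leave-≅ r P K s z = equiv fwd (leave z)
    where
    fwd : Halts (loop r P ∷ K) s → Halts K s
    fwd (leave _ h) = h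
    fwd (enter {s′ = s′} d h) with trans (sym z) (trans (d r) (cong (_+ s′ r) (δ-same r)))
    ... | ()

  dec : ℕ → Store → Store
  dec r s x = s x ∸ δ r x

  bump-same : ∀ r s → bump r s r ≡ suc (s r)
  bump-same r s = cong (_+ s r) (δ-same r)

  bump-other : ∀ {r x} s → x ≢ r → bump r s x ≡ s x
  bump-other {x = x} s n = cong (_+ s x) (δ-other (n ∘ sym))

  dec-same : ∀ r s {v} → s r ≡ suc v → dec r s r ≡ v
  dec-same r s e rewrite δ-same r | e = refl

  dec-other : ∀ {r x} s → x ≢ r → dec r s x ≡ s x
  dec-other s n rewrite δ-other (n ∘ sym) = refl

  bump-dec : ∀ r {s v} → s r ≡ suc v → ∀ x → s x ≡ bump r (dec r s) x
  bump-dec r {s} e x with r ≟ x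
  ... | yes refl rewrite e = refl
  ... | no _ = refl

  enter-≅ : ∀ r P K s {v} → s r ≡ suc v → (loop r P ∷ K , s) ≅ (P ++ loop r P ∷ K , dec r s)
  enter-≅ r P K s e = equiv fwd (enter (bump-dec r e))
    where
    fwd : Halts (loop r P ∷ K) s → Halts (P ++ loop r P ∷ K) (dec r s)
    fwd (leave z h) with trans (sym z) e
    ... | ()
    fwd (enter {s′ = s′} d h) = halts-ext (λ x → +-cancelˡ-≡ (δ r x) _ _ (trans (sym (d x)) (bump-dec r e x))) h

  record Update (o y : ℕ) (s s′ : Store) : Set where
    constructor update
    field
      value : s′ o ≡ y
      frame : ∀ x → x ≢ o → s′ x ≡ s x

  open Update public

  -- `Halts` speaks of whole programs only; quantifying over the continuation `K` is what makes
  -- fragments composable.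
  Sets : ℕ → ℕ → List Cmd → Store → Set
  Sets o y P s = ∃[ s′ ] Update o y s s′ × ∀ K → (P ++ K , s) ≅ (K , s′)

  clear : ℕ → Cmd
  clear r = loop r []

  clear-sets : ∀ r s → Sets r 0 (clear r ∷ []) s
  clear-sets r s = go (s r) s refl
    where
    go : ∀ v s → s r ≡ v → Sets r 0 (clear r ∷ []) s
    go zero s e = s , update e (λ _ _ → refl) , λ K → leave-≅ r [] K s e
    go (suc v) s e with go v (dec r s) (dec-same r s e)
    ... | s′ , u , q = s′ , update (value u) (λ x n → trans (frame u x n) (dec-other s n)) ,
                       λ K → ≅-trans (enter-≅ r [] K s e) (q K)

  move : ℕ → List ℕ → Cmd
  move r os = loop r (incs os)
    where
    incs : List ℕ → List Cmd
    incs [] = []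
    incs (o ∷ os) = inc o ∷ incs os

  shift-sets : ∀ r o s → r ≢ o → ∃[ s′ ] s′ r ≡ 0 × s′ o ≡ s r + s o × (∀ x → x ≢ r → x ≢ o → s′ x ≡ s x) ×
    ∀ K → (move r (o ∷ []) ∷ K , s) ≅ (K , s′)
  shift-sets r o s r≢o = go (s r) s refl
    where
    go : ∀ v s → s r ≡ v → ∃[ s′ ] s′ r ≡ 0 × s′ o ≡ v + s o × (∀ x → x ≢ r → x ≢ o → s′ x ≡ s x) ×
         ∀ K → (move r (o ∷ []) ∷ K , s) ≅ (K , s′)
    go zero s e = s , e , refl , (λ _ _ _ → refl) , λ K → leave-≅ r _ K s e
    go (suc v) s e with go v (bump o (dec r s)) (trans (bump-other (dec r s) r≢o) (dec-same r s e))
    ... | s′ , z , t , f , q = s′ , z ,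
      trans t (trans (cong (v +_) (trans (bump-same o (dec r s)) (cong suc (dec-other s (r≢o ∘ sym))))) (+-suc v _)) ,
      (λ x n m → trans (f x n m) (trans (bump-other (dec r s) m) (dec-other s n))) ,
      λ K → ≅-trans (enter-≅ r _ K s e) (≅-trans (inc-≅ o _ (dec r s)) (q K))

  shift₂-sets : ∀ r o t s → r ≢ o → r ≢ t → o ≢ t → ∃[ s′ ] s′ r ≡ 0 × s′ o ≡ s r + s o × s′ t ≡ s r + s t ×
    (∀ x → x ≢ r → x ≢ o → x ≢ t → s′ x ≡ s x) × ∀ K → (move r (o ∷ t ∷ []) ∷ K , s) ≅ (K , s′)
  shift₂-sets r o t s r≢o r≢t o≢t = go (s r) s refl
    where
    go : ∀ v s → s r ≡ v → ∃[ s′ ] s′ r ≡ 0 × s′ o ≡ v + s o × s′ t ≡ v + s t ×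
      (∀ x → x ≢ r → x ≢ o → x ≢ t → s′ x ≡ s x) × ∀ K → (move r (o ∷ t ∷ []) ∷ K , s) ≅ (K , s′)
    go zero s e = s , e , refl , refl , (λ _ _ _ _ → refl) , λ K → leave-≅ r _ K s e
    go (suc v) s e with go v (bump t (bump o (dec r s))) (trans (bump-other (bump o (dec r s)) r≢t) (trans (bump-other (dec r s) r≢o) (dec-same r s e)))
    ... | s′ , z , p , p′ , f , q = s′ , z ,
      trans p (trans (cong (v +_) (trans (bump-other (bump o (dec r s)) o≢t) (trans (bump-same o (dec r s)) (cong suc (dec-other s (r≢o ∘ sym)))))) (+-suc v _)) ,
      trans p′ (trans (cong (v +_) (trans (bump-same t (bump o (dec r s))) (cong suc (trans (bump-other (dec r s) (o≢t ∘ sym)) (dec-other s (r≢t ∘ sym)))))) (+-suc v _)) ,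
      (λ x n m k → trans (f x n m k) (trans (bump-other (bump o (dec r s)) k) (trans (bump-other (dec r s) m) (dec-other s n)))) ,
      λ K → ≅-trans (enter-≅ r _ K s e) (≅-trans (inc-≅ o _ (dec r s)) (≅-trans (inc-≅ t _ (bump o (dec r s))) (q K)))

  copyTo : ℕ → ℕ → ℕ → List Cmd
  copyTo r o t = move r (o ∷ t ∷ []) ∷ move t (r ∷ []) ∷ []

  copy-sets : ∀ r o t s → r ≢ o → r ≢ t → o ≢ t → s o ≡ 0 → s t ≡ 0 → Sets o (s r) (copyTo r o t) s
  copy-sets r o t s r≢o r≢t o≢t zo zt with shift₂-sets r o t s r≢o r≢t o≢t
  ... | s₁ , r₁ , o₁ , t₁ , f₁ , q₁ with shift-sets t r s₁ (r≢t ∘ sym)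
  ...   | s₂ , t₂ , r₂ , f₂ , q₂ = s₂ , update
      (trans (f₂ o o≢t (r≢o ∘ sym)) (trans o₁ (trans (cong (s r +_) zo) (+-identityʳ _)))) fr ,
      λ K → ≅-trans (q₁ _) (q₂ K)
    where
    fr : ∀ x → x ≢ o → s₂ x ≡ s x
    fr x n with x ≟ r | x ≟ t
    ... | yes refl | _ = trans r₂ (trans (cong₂ _+_ t₁ r₁) (trans (+-identityʳ _) (trans (cong (s x +_) zt) (+-identityʳ _))))
    ... | no _ | yes refl = trans t₂ (sym zt)
    ... | no x≢r | no x≢t = trans (f₂ x x≢t x≢r) (f₁ x x≢r n x≢t)

  tabulateFrom : ℕ → ∀ m → Vec ℕ m
  tabulateFrom b zero = []
  tabulateFrom b (suc m) = b ∷ tabulateFrom (suc b) m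

  clears : ℕ → ℕ → List Cmd
  clears b zero = []
  clears b (suc m) = clear b ∷ clears (suc b) m

  -- Arguments are read from the registers ρ, the result is stored in o, and the registers from b on
  -- serve as scratch space, which is zero before and after.
  mutual
    compile : ∀ {n} → Code n → Vec ℕ n → (o b : ℕ) → List Cmd
    compile Z ρ o b = []
    compile S (x ∷ []) o b = copyTo x o b ++ inc o ∷ []
    compile (proj i) ρ o b = copyTo (lookupV ρ i) o b
    compile (comp {m} g hs) ρ o b =
      compileVec hs ρ b (b + m) ++ compile g (tabulateFrom b m) o (b + m) ++ clears b m
    compile (prec g h) (k ∷ ρ) o b =
      -- `b` counts the rounds left and `1 + b` the rounds done; `2 + b` receives the next value
      -- before it replaces the one in `o`. The copying borrows `suc b` before the counting starts
      -- and returns it empty.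
      copyTo k b (suc b) ++ compile g ρ o (3 + b) ++
      loop b (compile h (1 + b ∷ o ∷ ρ) (2 + b) (3 + b) ++ clear o ∷ move (2 + b) (o ∷ []) ∷ inc (1 + b) ∷ []) ∷
      clear (1 + b) ∷ []
    -- `o` is the candidate and finally the result. Entering the loop takes one from the value in
    -- `b`, and `clear` removes the rest before the next candidate is tried.
    compile (mu g) ρ o b = compile g (o ∷ ρ) b (1 + b) ++ loop b (clear b ∷ inc o ∷ compile g (o ∷ ρ) b (1 + b)) ∷ []

    compileVec : ∀ {m n} → Vec (Code n) m → Vec ℕ n → (t b : ℕ) → List Cmd
    compileVec [] ρ t b = []
    compileVec (h ∷ hs) ρ t b = compile h ρ t b ++ compileVec hs ρ (suc t) b

  Runs : List Cmd → Store → Store → Set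
  Runs P s s′ = ∀ K → (P ++ K , s) ≅ (K , s′)

  runs-++ : ∀ P Q {s s₁ s₂} → Runs P s s₁ → Runs Q s₁ s₂ → Runs (P ++ Q) s s₂
  runs-++ P Q p q K = subst (λ z → (z , _) ≅ _) (sym (++-assoc P Q K)) (≅-trans (p (Q ++ K)) (q K))

  -- Through `distinct`, a primitive recursion can read its parameters in every round while `o`
  -- already holds a partial result.
  record Ready {n} (ρ xs : Vec ℕ n) (o b : ℕ) (s : Store) : Set where
    field
      values   : ∀ i → s (lookupV ρ i) ≡ lookupV xs i
      below    : ∀ i → lookupV ρ i < b
      distinct : ∀ i → lookupV ρ i ≢ o
      o<b      : o < b
      o-zero   : s o ≡ 0
      zeros    : ∀ x → b ≤ x → s x ≡ 0

  open Ready

  tabulateFrom-≥ : ∀ b m i → b ≤ lookupV (tabulateFrom b m) i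
  tabulateFrom-≥ b (suc m) zero = ≤-refl
  tabulateFrom-≥ b (suc m) (suc i) = ≤-trans (n≤1+n b) (tabulateFrom-≥ (suc b) m i)

  tabulateFrom-< : ∀ b m i → lookupV (tabulateFrom b m) i < b + m
  tabulateFrom-< b (suc m) zero = m<m+n b (s≤s z≤n)
  tabulateFrom-< b (suc m) (suc i) = subst (lookupV (tabulateFrom (suc b) m) i <_) (sym (+-suc b m)) (tabulateFrom-< (suc b) m i)

  clears-sets : ∀ b m s → (∀ x → b + m ≤ x → s x ≡ 0) →
    ∃[ s′ ] (∀ x → x < b → s′ x ≡ s x) × (∀ x → b ≤ x → s′ x ≡ 0) × Runs (clears b m) s s′
  clears-sets b zero s z = s , (λ _ _ → refl) , (λ x p → z x (subst (_≤ x) (sym (+-identityʳ b)) p)) , λ K → ≅-refl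
  clears-sets b (suc m) s z with clear-sets b s
  ... | s₁ , u , q with clears-sets (suc b) m s₁
          (λ x p → trans (frame u x (λ { refl → <-irrefl refl (≤-trans (s≤s (m≤m+n b m)) p) })) (z x (subst (_≤ x) (sym (+-suc b m)) p)))
  ...   | s₂ , f , g , q₂ = s₂ ,
          (λ x p → trans (f x (≤-trans p (n≤1+n b))) (frame u x (<⇒≢ p))) , h ,
          runs-++ (clear b ∷ []) (clears (suc b) m) q q₂
    where
    h : ∀ x → b ≤ x → s₂ x ≡ 0
    h x p with b ≟ x
    ... | yes refl = trans (f b ≤-refl) (value u)
    ... | no n = g x (≤∧≢⇒< p n)

  mutual
    compile-correct : ∀ {n c y b o s} {ρ xs : Vec ℕ n} → Ev c xs y → Ready ρ xs o b s → Sets o y (compile c ρ o b) s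
    compile-correct {s = s} Z r = s , update (o-zero r) (λ _ _ → refl) , λ K → ≅-refl
    compile-correct {b = b} {o} {s} {ρ = x ∷ []} S r
      with copy-sets x o b s (distinct r zero) (<⇒≢ (below r zero)) (<⇒≢ (o<b r)) (o-zero r) (zeros r b ≤-refl)
    ... | s₁ , u , q = bump o s₁ ,
          update (trans (bump-same o s₁) (cong suc (trans (value u) (values r zero))))
                 (λ z n → trans (bump-other s₁ n) (frame u z n)) ,
          runs-++ (copyTo x o b) (inc o ∷ []) q (λ K → inc-≅ o K s₁)
    compile-correct {b = b} {o} {s} {ρ} (proj i) r
      with copy-sets (lookupV ρ i) o b s (distinct r i) (<⇒≢ (below r i)) (<⇒≢ (o<b r)) (o-zero r) (zeros r b ≤-refl)
    ... | s₁ , u , q = s₁ , update (trans (value u) (values r i)) (frame u) , q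
    compile-correct {b = b} {o} {s} {ρ} (comp {m} {g = g} {hs = hs} es e) r
      with compileVec-correct {t = b} {b = b + m} {s} es (values r) (below r) ≤-refl (zeros r)
    ... | s₁ , v₁ , f₁ , z₁ , q₁ with compile-correct {o = o} {s = s₁} e record
          { values = v₁ ; below = tabulateFrom-< b m
          ; distinct = λ i p → <⇒≢ (≤-trans (o<b r) (tabulateFrom-≥ b m i)) (sym p)
          ; o<b = ≤-trans (o<b r) (m≤m+n b m) ; o-zero = trans (f₁ o (o<b r)) (o-zero r) ; zeros = z₁ }
    ...   | s₂ , u₂ , q₂ with clears-sets b m s₂
              (λ x p → trans (frame u₂ x (λ x≡o → <⇒≢ (≤-trans (≤-trans (o<b r) (m≤m+n b m)) p) (sym x≡o))) (z₁ x p))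
    ...     | s₃ , f₃ , z₃ , q₃ = s₃ , update (trans (f₃ o (o<b r)) (value u₂)) fr ,
              runs-++ (compileVec hs ρ b (b + m)) _ q₁ (runs-++ (compile g (tabulateFrom b m) o (b + m)) (clears b m) q₂ q₃)
      where
      fr : ∀ x → x ≢ o → s₃ x ≡ s x
      fr x n with x <? b
      ... | yes p = trans (f₃ x p) (trans (frame u₂ x n) (f₁ x p))
      ... | no p = trans (z₃ x (≮⇒≥ p)) (sym (zeros r x (≮⇒≥ p)))
    compile-correct {b = b} {o} {s} {k ∷ ρ} {x ∷ xs} (prec₀ {g = g} {h} e) r = prec-correct (prec₀ {h = h} e) r
    compile-correct {b = b} {o} {s} {k ∷ ρ} {x ∷ xs} (precₛ e e′) r = prec-correct (precₛ e e′) r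
    compile-correct {b = b} {o} {s} {ρ} (mu {g = g} e) r with mu-correct e (values r) (below r) (distinct r) (o<b r) (o-zero r) (zeros r)
    ... | s′ , u , q = s′ , u , λ K → subst (λ z → (z , s) ≅ (K , s′)) (sym (++-assoc (compile g (o ∷ ρ) b (1 + b)) _ K)) (q K)

    compileVec-correct : ∀ {m n} {hs : Vec (Code n) m} {ys t b s} {ρ xs : Vec ℕ n} → EvVec hs xs ys →
      (∀ i → s (lookupV ρ i) ≡ lookupV xs i) → (∀ i → lookupV ρ i < t) → t + m ≤ b → (∀ x → t ≤ x → s x ≡ 0) →
      ∃[ s′ ] (∀ i → s′ (lookupV (tabulateFrom t m) i) ≡ lookupV ys i) × (∀ x → x < t → s′ x ≡ s x) ×
        (∀ x → t + m ≤ x → s′ x ≡ 0) × Runs (compileVec hs ρ t b) s s′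
    compileVec-correct {t = t} {s = s} [] v l p z =
      s , (λ ()) , (λ _ _ → refl) , (λ x q → z x (subst (_≤ x) (+-identityʳ t) q)) , λ K → ≅-refl
    compileVec-correct {suc m} {hs = h ∷ hs} {t = t} {b} {s} {ρ} (e ∷ es) v l p z with compile-correct {b = b} {o = t} {s = s} e record
          { values = v ; below = λ i → ≤-trans (l i) t≤b ; distinct = λ i → <⇒≢ (l i) ; o<b = t<b
          ; o-zero = z t ≤-refl ; zeros = λ x q → z x (≤-trans t≤b q) }
      where
      t<b : t < b
      t<b = ≤-trans (m<m+n t (s≤s z≤n)) p
      t≤b : t ≤ b
      t≤b = <⇒≤ t<b
    ... | s₁ , u , q with compileVec-correct {t = suc t} {b} {s₁} es
          (λ i → trans (frame u _ (<⇒≢ (l i))) (v i)) (λ i → ≤-trans (l i) (n≤1+n t)) (subst (_≤ b) (+-suc t m) p)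
          (λ x t<x → trans (frame u x (λ x≡t → <⇒≢ t<x (sym x≡t))) (z x (<⇒≤ t<x)))
    ...   | s₂ , v₂ , f₂ , z₂ , q₂ = s₂ ,
            (λ { zero → trans (f₂ t ≤-refl) (value u) ; (suc i) → v₂ i }) ,
            (λ x x<t → trans (f₂ x (≤-trans x<t (n≤1+n t))) (frame u x (<⇒≢ x<t))) ,
            (λ x w → z₂ x (subst (_≤ x) (+-suc t m) w)) ,
            runs-++ (compile h ρ t b) (compileVec hs ρ (suc t) b) q q₂

    -- The evaluation of `g` stands in front of the loop because the unrolled body, after `clear`
    -- and `inc`, is exactly this program again, now with the candidate `suc i`.
    mu-correct : ∀ {n g i y b o s} {ρ xs : Vec ℕ n} → EvMu g xs i y →
      (∀ j → s (lookupV ρ j) ≡ lookupV xs j) → (∀ j → lookupV ρ j < b) → (∀ j → lookupV ρ j ≢ o) → o < b → s o ≡ i →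
      (∀ x → b ≤ x → s x ≡ 0) →
      ∃[ s′ ] Update o y s s′ × ∀ K →
        (compile g (o ∷ ρ) b (1 + b) ++ loop b (clear b ∷ inc o ∷ compile g (o ∷ ρ) b (1 + b)) ∷ K , s) ≅ (K , s′)
    mu-correct {g = g} {b = b} {o} {s} {ρ} (found e) v l d o<b so z with compile-correct {o = b} {s = s} e (mu-ready v l o<b so z)
    ... | s₁ , u , q = s₁ , update (trans (frame u o (<⇒≢ o<b)) so) fr , λ K → ≅-trans (q _) (leave-≅ b _ K s₁ (value u))
      where
      fr : ∀ x → x ≢ o → s₁ x ≡ s x
      fr x n with x ≟ b
      ... | yes refl = trans (value u) (sym (z b ≤-refl))
      ... | no m = frame u x m
    mu-correct {g = g} {b = b} {o} {s} {ρ} (next e es) v l d o<b so z with compile-correct {o = b} {s = s} e (mu-ready v l o<b so z)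
    ... | s₁ , u , q with clear-sets b (dec b s₁)
    ...   | s₃ , u₃ , q₃ with mu-correct {g = g} {b = b} {o} {bump o s₃} {ρ} es
              (λ j → trans (rest _ (<⇒≢ (l j)) (d j)) (v j)) l d o<b
              (trans (bump-same o s₃) (cong suc (trans (frame u₃ o (<⇒≢ o<b)) (trans (dec-other s₁ (<⇒≢ o<b)) (trans (frame u o (<⇒≢ o<b)) so)))))
              (λ x b≤x → trans (bump-other s₃ (λ x≡o → <⇒≢ (≤-trans o<b b≤x) (sym x≡o))) (zero₃ x b≤x))
      where
      same₃ : ∀ x → x ≢ b → s₃ x ≡ s x
      same₃ x n = trans (frame u₃ x n) (trans (dec-other s₁ n) (frame u x n))
      rest : ∀ x → x ≢ b → x ≢ o → bump o s₃ x ≡ s x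
      rest x n m = trans (bump-other s₃ m) (same₃ x n)
      zero₃ : ∀ x → b ≤ x → s₃ x ≡ 0
      zero₃ x p with x ≟ b
      ... | yes refl = value u₃
      ... | no n = trans (same₃ x n) (z x p)
    ...     | s′ , u′ , q′ = s′ , update (value u′) fr ,
              λ K → ≅-trans (q _) (≅-trans (enter-≅ b _ K s₁ (value u)) (≅-trans (q₃ _) (≅-trans (inc-≅ o _ s₃) (q′ K))))
      where
      fr : ∀ x → x ≢ o → s′ x ≡ s x
      fr x n with x ≟ b
      ... | yes refl = trans (frame u′ x n) (trans (bump-other s₃ n) (trans (value u₃) (sym (z b ≤-refl))))
      ... | no m = trans (frame u′ x n) (trans (bump-other s₃ n) (trans (frame u₃ x m) (trans (dec-other s₁ m) (frame u x m))))

    mu-ready : ∀ {n b o i s} {ρ xs : Vec ℕ n} → (∀ j → s (lookupV ρ j) ≡ lookupV xs j) → (∀ j → lookupV ρ j < b) →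
      o < b → s o ≡ i → (∀ x → b ≤ x → s x ≡ 0) → Ready (o ∷ ρ) (i ∷ xs) b (1 + b) s
    mu-ready {b = b} v l o<b so z = record
      { values = λ { zero → so ; (suc j) → v j }
      ; below = λ { zero → ≤-trans o<b (n≤1+n b) ; (suc j) → ≤-trans (l j) (n≤1+n b) }
      ; distinct = λ { zero → <⇒≢ o<b ; (suc j) → <⇒≢ (l j) }
      ; o<b = ≤-refl ; o-zero = z b ≤-refl ; zeros = λ x p → z x (<⇒≤ p) }

    prec-loop : ∀ {n} → Code (suc (suc n)) → Vec ℕ n → ℕ → ℕ → Cmd
    prec-loop h ρ o b =
      loop b (compile h (1 + b ∷ o ∷ ρ) (2 + b) (3 + b) ++ clear o ∷ move (2 + b) (o ∷ []) ∷ inc (1 + b) ∷ [])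

    prec-correct : ∀ {n g h y b o s k ρ x} {xs : Vec ℕ n} → Ev (prec g h) (x ∷ xs) y → Ready (k ∷ ρ) (x ∷ xs) o b s →
      Sets o y (compile (prec g h) (k ∷ ρ) o b) s
    prec-correct {g = g} {h} {y} {b} {o} {s} {k} {ρ} {x} e r
      with copy-sets k b (suc b) s (<⇒≢ (below r zero)) (<⇒≢ (≤-trans (below r zero) (n≤1+n b))) (<⇒≢ ≤-refl)
             (zeros r b ≤-refl) (zeros r (suc b) (n≤1+n b))
    ... | s₁ , u₁ , q₁ with iterate {v = 0} {s = s₁} e
            (λ i → trans (frame u₁ _ (<⇒≢ (below r (suc i)))) (values r (suc i)))
            (λ i → below r (suc i)) (λ i → distinct r (suc i)) (o<b r)
            (trans (frame u₁ o (<⇒≢ (o<b r))) (o-zero r))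
            (λ z p → trans (frame u₁ z (λ z≡b → <⇒≢ p (sym z≡b))) (zeros r z (<⇒≤ p)))
            (trans (value u₁) (trans (values r zero) (sym (+-identityʳ x))))
    ...   | s₂ , b₂ , j₂ , o₂ , f₂ , q₂ with clear-sets (1 + b) s₂
    ...     | s₃ , u₃ , q₃ = s₃ , update (trans (frame u₃ o (<⇒≢ (≤-trans (o<b r) (n≤1+n b)))) o₂) fr ,
              runs-++ (copyTo k b (suc b)) _ q₁ λ K →
                subst (λ z → (z , s₁) ≅ (K , s₃)) (sym (++-assoc (compile g ρ o (3 + b)) _ K))
                  (≅-trans (q₂ (clear (1 + b) ∷ K)) (≅-trans (leave-≅ b _ _ s₂ b₂) (q₃ K)))
      where
      fr : ∀ z → z ≢ o → s₃ z ≡ s z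
      fr z n with z ≟ 1 + b | z ≟ b
      ... | yes refl | _ = trans (value u₃) (sym (zeros r z (n≤1+n b)))
      ... | no m | yes refl = trans (frame u₃ z m) (trans b₂ (sym (zeros r b ≤-refl)))
      ... | no m | no m′ = trans (frame u₃ z m) (trans (f₂ z m′ m n) (frame u₁ z m′))

    -- k rounds of the loop, the counter b starting at k + v; 1 + b counts the rounds.
    iterate : ∀ {n g h k y v b o s ρ} {xs : Vec ℕ n} → Ev (prec g h) (k ∷ xs) y →
      (∀ i → s (lookupV ρ i) ≡ lookupV xs i) → (∀ i → lookupV ρ i < b) → (∀ i → lookupV ρ i ≢ o) → o < b → s o ≡ 0 →
      (∀ x → 1 + b ≤ x → s x ≡ 0) → s b ≡ k + v →
      ∃[ s′ ] s′ b ≡ v × s′ (1 + b) ≡ k × s′ o ≡ y × (∀ x → x ≢ b → x ≢ 1 + b → x ≢ o → s′ x ≡ s x) ×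
        ∀ K → (compile g ρ o (3 + b) ++ prec-loop h ρ o b ∷ K , s) ≅ (prec-loop h ρ o b ∷ K , s′)
    iterate {b = b} {o} {s} (prec₀ e) v l d o<b so z sb with compile-correct {b = 3 + b} {o = o} {s = s} e record
        { values = v ; below = λ i → ≤-trans (l i) (m≤n+m b 3) ; distinct = d ; o<b = ≤-trans o<b (m≤n+m b 3) ; o-zero = so
        ; zeros = λ x p → z x (≤-trans (m≤n+m (1 + b) 2) p) }
    ... | s′ , u , q = s′ , trans (frame u b (λ b≡o → <⇒≢ o<b (sym b≡o))) sb ,
          trans (frame u (1 + b) (λ e → <⇒≢ (≤-trans o<b (n≤1+n b)) (sym e))) (z (1 + b) ≤-refl) ,
          value u , (λ x _ _ n → frame u x n) , λ K → q _
    iterate {k = suc k} {v = w} {b} {o} {s} {ρ} (precₛ {h = h} {r = r} e e′) v l d o<b so z sb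
      -- The earlier rounds leave `suc w` on the counter; one unit pays for the round added here.
      with iterate {v = suc w} {s = s} e v l d o<b so z (trans sb (sym (+-suc k w)))
    ... | s₁ , b₁ , j₁ , o₁ , f₁ , q₁ with compile-correct {b = 3 + b} {o = 2 + b} {s = dec b s₁} e′ record
          { values = λ { zero → trans (dec-other s₁ (1+n≢n)) j₁ ; (suc zero) → trans (dec-other s₁ o≢b) o₁
                       ; (suc (suc i)) → trans (dec-other s₁ (<⇒≢ (l i))) (trans (f₁ _ (<⇒≢ (l i)) (<⇒≢ (≤-trans (l i) (n≤1+n b))) (d i)) (v i)) }
          ; below = λ { zero → n≤1+n (2 + b) ; (suc zero) → ≤-trans o<b (m≤n+m b 3) ; (suc (suc i)) → ≤-trans (l i) (m≤n+m b 3) }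
          ; distinct = λ { zero → <⇒≢ ≤-refl ; (suc zero) → <⇒≢ (≤-trans o<b (m≤n+m b 2)) ; (suc (suc i)) → <⇒≢ (≤-trans (l i) (m≤n+m b 2)) }
          ; o<b = ≤-refl ; o-zero = zero₁ (2 + b) ≤-refl ; zeros = λ x p → zero₁ x (<⇒≤ p) }
      where
      o≢b : o ≢ b
      o≢b = <⇒≢ o<b
      zero₁ : ∀ x → 2 + b ≤ x → dec b s₁ x ≡ 0
      zero₁ x p = trans (dec-other s₁ (λ e → <⇒≢ (≤-trans (n≤1+n (1 + b)) p) (sym e)))
        (trans (f₁ x (λ e → <⇒≢ (≤-trans (n≤1+n (1 + b)) p) (sym e)) (λ e → <⇒≢ p (sym e))
                     (λ e → <⇒≢ (≤-trans (≤-trans o<b (m≤n+m b 2)) p) (sym e)))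
               (z x (≤-trans (n≤1+n (1 + b)) p)))
    ...   | s₃ , u₃ , q₃ with clear-sets o s₃
    ...     | s₄ , u₄ , q₄ with shift-sets (2 + b) o s₄ (λ e → <⇒≢ (≤-trans o<b (m≤n+m b 2)) (sym e))
    ...       | s₅ , n₅ , o₅ , f₅ , q₅ = bump (1 + b) s₅ ,
                trans (keep b b≢n b≢o (λ e → 1+n≢n (sym e))) (dec-same b s₁ b₁) ,
                trans (bump-same (1 + b) s₅) (cong suc (trans (f₅ (1 + b) j≢n j≢o) (trans (frame u₄ (1 + b) j≢o)
                  (trans (frame u₃ (1 + b) j≢n) (trans (dec-other s₁ 1+n≢n) j₁))))) ,
                trans (bump-other s₅ (λ e → j≢o (sym e))) (trans o₅ (trans (cong₂ _+_ (trans (frame u₄ (2 + b) n≢o) (value u₃)) (value u₄)) (+-identityʳ _))) ,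
                fr ,
                λ K → ≅-trans (q₁ K) (≅-trans (enter-≅ b _ K s₁ b₁)
                  (subst (λ c → (c , dec b s₁) ≅ (prec-loop h ρ o b ∷ K , bump (1 + b) s₅)) (sym (++-assoc (compile h (1 + b ∷ o ∷ ρ) (2 + b) (3 + b)) _ _))
                    (≅-trans (q₃ _) (≅-trans (q₄ _) (≅-trans (q₅ _) (inc-≅ (1 + b) _ s₅))))))
      where
      n≢o : 2 + b ≢ o
      n≢o e = <⇒≢ (≤-trans o<b (m≤n+m b 2)) (sym e)
      j≢o : 1 + b ≢ o
      j≢o e = <⇒≢ (≤-trans o<b (n≤1+n b)) (sym e)
      b≢o : b ≢ o
      b≢o e = <⇒≢ o<b (sym e)
      b≢n : b ≢ 2 + b
      b≢n e = <⇒≢ (n≤1+n (1 + b)) e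
      j≢n : 1 + b ≢ 2 + b
      j≢n e = 1+n≢n (sym e)
      keep : ∀ x → x ≢ 2 + b → x ≢ o → x ≢ 1 + b → bump (1 + b) s₅ x ≡ dec b s₁ x
      keep x p q t = trans (bump-other s₅ t) (trans (f₅ x p q) (trans (frame u₄ x q) (frame u₃ x p)))
      fr : ∀ x → x ≢ b → x ≢ 1 + b → x ≢ o → bump (1 + b) s₅ x ≡ s x
      fr x p t q with x ≟ 2 + b
      ... | no m = trans (keep x m q t) (trans (dec-other s₁ p) (f₁ x p t q))
      ... | yes refl = trans (bump-other s₅ t) (trans n₅ (sym (z (2 + b) (n≤1+n (1 + b)))))

-- Recursive functions computing the codes of instances

module Arithmetisation where

  open import Data.Nat using (_/_)
  open import Data.Nat.Properties
  open import Data.Nat.DivMod using (m*n/n≡m)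
  open import Data.Nat.Solver using (module +-*-Solver)
  open Compilation using (Ev; Z; S; proj; comp; prec₀; precₛ; []; _∷_)

  triangle : ℕ → ℕ
  triangle zero = 0
  triangle (suc n) = suc (n + triangle n)

  triangle-double : ∀ n → n * suc n ≡ triangle n * 2
  triangle-double zero = refl
  triangle-double (suc n) = begin
    suc n * suc (suc n)              ≡⟨ solve 1 (λ n → (con 1 :+ n) :* (con 2 :+ n) := con 2 :+ con 2 :* n :+ n :* (con 1 :+ n)) refl n ⟩
    2 + 2 * n + n * suc n            ≡⟨ cong (2 + 2 * n +_) (triangle-double n) ⟩
    2 + 2 * n + triangle n * 2       ≡⟨ solve 2 (λ n t → con 2 :+ con 2 :* n :+ t :* con 2 := (con 1 :+ (n :+ t)) :* con 2) refl n (triangle n) ⟩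
    suc (n + triangle n) * 2         ∎
    where
    open ≡-Reasoning
    open +-*-Solver

  -- Triangular numbers satisfy a primitive recursion, so `pair` can be computed without a code for
  -- division.
  pair-triangle : ∀ x y → pair x y ≡ triangle (x + y) + y
  pair-triangle x y = cong (_+ y) (trans (cong (_/ 2) (triangle-double (x + y))) (m*n/n≡m (triangle (x + y)) 2))

  constant : ∀ {n} → ℕ → Code n
  constant zero = Z
  constant (suc k) = comp S (constant k ∷ [])

  constant-ev : ∀ {n} k {xs : Vec ℕ n} → Ev (constant k) xs k
  constant-ev zero = Z
  constant-ev (suc k) = comp (constant-ev k ∷ []) S

  addCode : Code 2
  addCode = prec (proj zero) (comp S (proj (suc zero) ∷ []))

  add-ev : ∀ k y → Ev addCode (k ∷ y ∷ []) (k + y)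
  add-ev zero y = prec₀ (proj zero)
  add-ev (suc k) y = precₛ (add-ev k y) (comp (proj (suc zero) ∷ []) S)

  triangleCode : Code 1
  triangleCode = prec Z (comp S (addCode ∷ []))

  triangle-ev : ∀ n → Ev triangleCode (n ∷ []) (triangle n)
  triangle-ev zero = prec₀ Z
  triangle-ev (suc n) = precₛ (triangle-ev n) (comp (add-ev n (triangle n) ∷ []) S)

  pairCode : Code 2
  pairCode = comp addCode (comp triangleCode (addCode ∷ []) ∷ proj (suc zero) ∷ [])

  pair-ev : ∀ x y → Ev pairCode (x ∷ y ∷ []) (pair x y)
  pair-ev x y = subst (Ev pairCode (x ∷ y ∷ [])) (sym (pair-triangle x y))
    (comp (comp (add-ev x y ∷ []) (triangle-ev (x + y)) ∷ proj (suc zero) ∷ []) (add-ev (triangle (x + y)) y))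

  consCode : ∀ {n} → Code n → Code n → Code n
  consCode c d = comp S (comp pairCode (c ∷ d ∷ []) ∷ [])

  cons-ev : ∀ {n c d x y} {xs : Vec ℕ n} → Ev c xs x → Ev d xs y → Ev (consCode c d) xs (suc (pair x y))
  cons-ev {x = x} {y} p q = comp (comp (p ∷ q ∷ []) (pair-ev x y) ∷ []) S

  prependCode : ∀ {n} → Word → Code n → Code n
  prependCode [] c = c
  prependCode (l ∷ w) c = consCode (constant (encLetter l)) (prependCode w c)

  prepend-ev : ∀ {n c v} {xs : Vec ℕ n} w → Ev c xs (encWord v) → Ev (prependCode w c) xs (encWord (w ++ v))
  prepend-ev [] p = p
  prepend-ev (l ∷ w) p = cons-ev (constant-ev (encLetter l)) (prepend-ev w p)

  power : ℕ → Word → Word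
  power n w = concat (replicate n w)

  -- Codes of lists grow at the front, so the recursion starts from the suffix `v` and the prefix
  -- `u` comes last.
  powerCode : Word → Word → Word → Code 1
  powerCode u w v = prependCode u (prec (prependCode v Z) (prependCode w (proj (suc zero))))

  power-ev : ∀ u w v n → Ev (powerCode u w v) (n ∷ []) (encWord (u ++ power n w ++ v))
  power-ev u w v n = prepend-ev u (go n)
    where
    go : ∀ n → Ev (prec (prependCode v Z) (prependCode w (proj (suc zero)))) (n ∷ []) (encWord (power n w ++ v))
    go zero = prec₀ (subst (λ z → Ev (prependCode v Z) [] (encWord z)) (++-identityʳ v) (prepend-ev {v = []} v Z))
    go (suc n) = precₛ (go n) (subst (λ z → Ev _ (n ∷ encWord (power n w ++ v) ∷ []) (encWord z)) (sym (++-assoc w (power n w) v))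
      (prepend-ev {v = power n w ++ v} w (proj (suc zero))))

  -- The argument serves twice, as the number passed to every `f a` and as the tail of the list.
  -- This is the self-application of the diagonal argument.
  familyCode : ∀ {A : Set} → (A → Code 1) → List A → Code 1
  familyCode f [] = proj zero
  familyCode f (a ∷ as) = consCode (f a) (familyCode f as)

  family-ev : ∀ {A : Set} {f : A → Code 1} {g : A → Word} T → (∀ a → Ev (f a) (encSet T ∷ []) (encWord (g a))) →
    ∀ as → Ev (familyCode f as) (encSet T ∷ []) (encSet (map g as ++ T))
  family-ev T h [] = proj zero
  family-ev T h (a ∷ as) = cons-ev (h a) (family-ev T h as)

-- Injective numbering of the letters, and words of closed circuits

module Numbering where

  open import Data.Nat.Properties hiding (_≟_)
  open import Data.Fin.Properties using (toℕ-injective)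
  open Circuits
  open CounterMachine
  open Compilation hiding (dec)
  open Arithmetisation

  double : ℕ → ℕ
  double zero = zero
  double (suc n) = suc (suc (double n))

  double-injective : ∀ {m n} → double m ≡ double n → m ≡ n
  double-injective {zero} {zero} e = refl
  double-injective {suc m} {suc n} e = cong suc (double-injective (suc-injective (suc-injective e)))

  double≢suc-double : ∀ m n → double m ≢ suc (double n)
  double≢suc-double (suc m) (suc n) e = double≢suc-double m n (suc-injective (suc-injective e))
  double≢suc-double (suc m) zero ()

  -- 2ᵃ (2b + 1)
  code₂ : ℕ → ℕ → ℕ
  code₂ zero b = suc (double b)
  code₂ (suc a) b = double (code₂ a b)

  code₂-injective : ∀ {a b c d} → code₂ a b ≡ code₂ c d → a ≡ c × b ≡ d
  code₂-injective {zero} {b} {zero} {d} e = refl , double-injective (suc-injective e)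
  code₂-injective {zero} {b} {suc c} {d} e = ⊥-elim (double≢suc-double (code₂ c d) b (sym e))
  code₂-injective {suc a} {b} {zero} {d} e = ⊥-elim (double≢suc-double (code₂ a b) d e)
  code₂-injective {suc a} {b} {suc c} {d} e with code₂-injective {a} {b} {c} {d} (double-injective e)
  ... | refl , q = refl , q

  -- Only injectivity matters: the numbers select free generators, and no machine has to decode
  -- them.
  programCode : List Cmd → ℕ
  programCode [] = 0
  programCode (inc r ∷ K) = suc (code₂ 0 (code₂ r (programCode K)))
  programCode (loop r P ∷ K) = suc (code₂ 1 (code₂ r (code₂ (programCode P) (programCode K))))

  programCode-injective : ∀ K K′ → programCode K ≡ programCode K′ → K ≡ K′
  programCode-injective [] [] e = refl
  programCode-injective [] (inc _ ∷ _) ()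
  programCode-injective [] (loop _ _ ∷ _) ()
  programCode-injective (inc _ ∷ _) [] ()
  programCode-injective (loop _ _ ∷ _) [] ()
  programCode-injective (inc r ∷ K) (inc r′ ∷ K′) e
    with code₂-injective {r} {_} {r′} (proj₂ (code₂-injective {0} {_} {0} (suc-injective e)))
  ... | refl , p = cong (inc r ∷_) (programCode-injective K K′ p)
  programCode-injective (inc r ∷ K) (loop r′ P′ ∷ K′) e with proj₁ (code₂-injective {0} {_} {1} (suc-injective e))
  ... | ()
  programCode-injective (loop r P ∷ K) (inc r′ ∷ K′) e with proj₁ (code₂-injective {1} {_} {0} (suc-injective e))
  ... | ()
  programCode-injective (loop r P ∷ K) (loop r′ P′ ∷ K′) e
    with code₂-injective {r} {_} {r′} (proj₂ (code₂-injective {1} {_} {1} (suc-injective e)))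
  ... | refl , p with code₂-injective {programCode P} {_} {programCode P′} p
  ...   | p₁ , p₂ = cong₂ (λ P K → loop r P ∷ K) (programCode-injective P P′ p₁) (programCode-injective K K′ p₂)

  symTag symValue : Sym → ℕ
  symTag L = 0
  symTag R = 1
  symTag H = 2
  symTag init = 3
  symTag (reg _) = 4
  symTag (run _) = 5
  symTag (test _ _) = 6
  symValue (reg r) = r
  symValue (run K) = programCode K
  symValue (test r K) = code₂ r (programCode K)
  symValue _ = 0

  sym-injective : ∀ a b → symTag a ≡ symTag b → symValue a ≡ symValue b → a ≡ b
  sym-injective L L _ _ = refl
  sym-injective R R _ _ = refl
  sym-injective H H _ _ = refl
  sym-injective init init _ _ = refl
  sym-injective (reg r) (reg .r) _ refl = refl
  sym-injective (run K) (run K′) _ e = cong run (programCode-injective K K′ e)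
  sym-injective (test r K) (test r′ K′) _ e with code₂-injective {r} {_} {r′} e
  ... | refl , p = cong (test r) (programCode-injective K K′ p)

  contentCode : Maybe Sym → ℕ
  contentCode nothing = 0
  contentCode (just a) = suc (code₂ (symTag a) (symValue a))

  contentCode-injective : ∀ a b → contentCode a ≡ contentCode b → a ≡ b
  contentCode-injective nothing nothing e = refl
  contentCode-injective (just a) (just b) e with code₂-injective {symTag a} {_} {symTag b} (suc-injective e)
  ... | p , q = cong just (sym-injective a b p q)

  module _ {X : Set} (f : X → ℕ) where

    symbolTag symbolValue symbolCode : Symbol X → ℕ
    symbolTag (node (true , _)) = 0
    symbolTag (node (false , _)) = 1
    symbolTag (bracket _) = 2
    symbolTag (symbol _) = 3
    symbolValue (node (_ , j)) = toℕ j
    symbolValue (bracket j) = toℕ j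
    symbolValue (symbol x) = f x
    symbolCode a = code₂ (symbolTag a) (symbolValue a)

    signedCode : Signed (Symbol X) → Signed ℕ
    signedCode (pos a) = pos (symbolCode a)
    signedCode (neg a) = neg (symbolCode a)

    signedCode-inv : ∀ a → signedCode (inv a) ≡ inv (signedCode a)
    signedCode-inv (pos a) = refl
    signedCode-inv (neg a) = refl

    unsigned : Signed ℕ → ℕ
    unsigned (pos a) = a
    unsigned (neg a) = a

    triv-code : ∀ {w} → Triv w → Triv (map signedCode w)
    triv-code nil = nil
    triv-code (node a {u} {v} p q) = subst Triv (cong (signedCode a ∷_) (trans
      (cong (λ b → map signedCode u ++ b ∷ map signedCode v) (sym (signedCode-inv a))) (sym (map-++ signedCode u (inv a ∷ v)))))
      (node (signedCode a) (triv-code p) (triv-code q))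

    module _ (f-injective : ∀ x y → f x ≡ f y → x ≡ y) where

      symbol-injective : ∀ a b → symbolTag a ≡ symbolTag b → symbolValue a ≡ symbolValue b → a ≡ b
      symbol-injective (node (true , j)) (node (true , k)) _ e = cong (λ j → node (true , j)) (toℕ-injective e)
      symbol-injective (node (false , j)) (node (false , k)) _ e = cong (λ j → node (false , j)) (toℕ-injective e)
      symbol-injective (bracket j) (bracket k) _ e = cong bracket (toℕ-injective e)
      symbol-injective (symbol x) (symbol y) _ e = cong symbol (f-injective x y e)
      symbol-injective (node (true , _)) (node (false , _)) ()
      symbol-injective (node (false , _)) (node (true , _)) ()
      symbol-injective (node (true , _)) (bracket _) ()
      symbol-injective (node (false , _)) (bracket _) ()
      symbol-injective (node (true , _)) (symbol _) ()
      symbol-injective (node (false , _)) (symbol _) ()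
      symbol-injective (bracket _) (node (true , _)) ()
      symbol-injective (bracket _) (node (false , _)) ()
      symbol-injective (symbol _) (node (true , _)) ()
      symbol-injective (symbol _) (node (false , _)) ()

      symbolCode-injective : ∀ a b → symbolCode a ≡ symbolCode b → a ≡ b
      symbolCode-injective a b e with code₂-injective {symbolTag a} {_} {symbolTag b} e
      ... | p , q = symbol-injective a b p q

      signedCode-injective : ∀ a b → signedCode a ≡ signedCode b → a ≡ b
      signedCode-injective (pos a) (pos b) e = cong pos (symbolCode-injective a b (cong unsigned e))
      signedCode-injective (neg a) (neg b) e = cong neg (symbolCode-injective a b (cong unsigned e))

      map-split : ∀ w u {b v} → map signedCode w ≡ u ++ b ∷ v →
        ∃[ w₁ ] ∃[ a ] ∃[ w₂ ] w ≡ w₁ ++ a ∷ w₂ × map signedCode w₁ ≡ u × signedCode a ≡ b × map signedCode w₂ ≡ v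
      map-split (a ∷ w) [] refl = [] , a , w , refl , refl , refl , refl
      map-split (a ∷ w) (b ∷ u) e with ∷-injectiveˡ e | map-split w u (∷-injectiveʳ e)
      ... | refl | w₁ , a′ , w₂ , refl , refl , q , r = a ∷ w₁ , a′ , w₂ , refl , refl , q , r
      map-split [] [] ()
      map-split [] (_ ∷ _) ()

      -- A matching of the image is one of `w` as well: by injectivity and `signedCode-inv`, letters
      -- with inverse images are inverse.
      triv-decode : ∀ w → Triv (map signedCode w) → Triv w
      triv-decode w t = go t w refl
        where
        go : ∀ {z} → Triv z → ∀ w → map signedCode w ≡ z → Triv w
        go nil [] e = nil
        go nil (_ ∷ _) ()
        go (node b {u} p q) (a ∷ w) e with map-split w u (∷-injectiveʳ e)
        ... | w₁ , a′ , w₂ , refl , e₁ , e′ , e₂ with signedCode-injective a′ (inv a)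
                (trans e′ (trans (cong inv (sym (∷-injectiveˡ e))) (sym (signedCode-inv a))))
        ...   | refl = node a (go p w₁ e₁) (go q w₂ e₂)

  module _ {E : Set} (C : Component E) where
    open Component C
    open Words C

    word-words : ∀ g gs → words (g ∷ gs) ≡ word g ++ words gs
    word-words g gs = cong (neg (node (source g)) ∷_) (sym (++-assoc (mid g) _ (words gs)))

    -- Between consecutive generators of a path the node letters form a cancelling pair, which is
    -- inserted here; `u` is the part already completed.
    path-words : ∀ {a b} u g gs → Path a (g ∷ gs) b → Triv (u ++ mid g ++ mids gs ++ pos (node b) ∷ []) →
      Triv (u ++ mid g ++ pos (node (target g)) ∷ words gs)
    path-words u g [] (_ ∷ []) t = t
    path-words {b = b} u g (h ∷ gs) (_ ∷ (e ∷ p)) t = subst Triv reassoc (path-words u′ h gs (e ∷ p) (subst Triv reassoc′ inserted))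
      where
      c : Symbol X
      c = node (target g)
      u′ : SWord (Symbol X)
      u′ = u ++ mid g ++ pos c ∷ neg c ∷ []
      rest : SWord (Symbol X)
      rest = mid h ++ mids gs ++ pos (node b) ∷ []
      inserted : Triv ((u ++ mid g) ++ (pos c ∷ neg c ∷ []) ++ rest)
      inserted = triv-insert (u ++ mid g)
        (subst Triv (trans (cong (λ z → u ++ mid g ++ z) (++-assoc (mid h) _ _)) (sym (++-assoc u (mid g) rest))) t)
        (node (pos c) nil nil)
      reassoc′ : (u ++ mid g) ++ (pos c ∷ neg c ∷ []) ++ rest ≡ u′ ++ rest
      reassoc′ = trans (sym (++-assoc (u ++ mid g) _ rest)) (cong (_++ rest) (++-assoc u (mid g) _))
      reassoc : u′ ++ mid h ++ pos (node (target h)) ∷ words gs ≡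
                u ++ mid g ++ pos c ∷ words (h ∷ gs)
      reassoc = trans (++-assoc u _ _) (cong (u ++_) (trans (++-assoc (mid g) _ _)
        (cong (λ a → mid g ++ pos c ∷ neg (node a) ∷ mid h ++ pos (node (target h)) ∷ words gs) (sym e))))

    loop-words : ∀ {a g gs} → Path a (g ∷ gs) a → Triv (mids (g ∷ gs)) → Triv (words (g ∷ gs))
    loop-words {a} {g} {gs} (refl ∷ p) t = path-words (neg (node (source g)) ∷ []) g gs (refl ∷ p)
      (subst (λ z → Triv (neg (node (source g)) ∷ z)) (++-assoc (mid g) (mids gs) _) (node (neg (node a)) t nil))

    bracketed-triv : ∀ j bs → All (Triv ∘ body) bs → Triv (bracketed j (map body bs))
    bracketed-triv j [] [] = nil
    bracketed-triv j (b ∷ bs) (t ∷ ts) = node (neg (bracket (succ j))) t (bracketed-triv (succ j) bs ts)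

    -- Each trivial body lets the brackets around it cancel; the rotation brings the bracket
    -- displaced in `mids-blocks` back to the front.
    blocks-mids : ∀ j b bs → advance (length (b ∷ bs)) j ≡ j → All (Triv ∘ body) (b ∷ bs) → Triv (mids (blocks j (b ∷ bs)))
    blocks-mids j b bs a ts = triv-rotate (X′ bs) (subst Triv (sym e) (bracketed-triv j (b ∷ bs) ts))
      where
      X′ : List (List E × List E) → SWord (Symbol X)
      X′ bs = neg (bracket (succ j)) ∷ posWord start ++ mids (segment (succ j) (proj₁ b) (proj₂ b) (blocks (succ j) bs))
      e : X′ bs ++ pos (bracket j) ∷ [] ≡ bracketed j (map body (b ∷ bs))
      e = ∷-injectiveʳ (trans (cong (λ k → mids (blocks j (b ∷ bs)) ++ pos (bracket k) ∷ []) (sym a)) (mids-blocks j (b ∷ bs)))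

-- Semigroups of braids generated by the edges of the graph

open import Data.List.Relation.Unary.Any.Properties using (reverse⁺)
open StrandForgetting using (≈-refl; ≈-sym; ≈-trans; ≈-reflexive; ≈-++; ≈-++ˡ; ≈-context)
open FreeSquare using (toBraid; toBraid-faithful; toBraid-++; toBraid-triv; module ≈-Reasoning; _⁻¹; inverseˡ; inverseʳ)
open Circuits
open Numbering

≈-rotate : ∀ u v → (u ++ v) ≈B [] → (v ++ u) ≈B []
≈-rotate u v e = begin
  v ++ u                     ≈⟨ ≈-++ (inverseˡ u) (≈-refl {v ++ u}) ⟨
  (u ⁻¹ ++ u) ++ v ++ u      ≡⟨ ++-assoc (u ⁻¹) u _ ⟩
  u ⁻¹ ++ u ++ v ++ u        ≡⟨ cong (u ⁻¹ ++_) (++-assoc u v u) ⟨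
  u ⁻¹ ++ (u ++ v) ++ u      ≈⟨ ≈-context (u ⁻¹) u e ⟩
  u ⁻¹ ++ u                  ≈⟨ inverseˡ u ⟩
  []                         ∎
  where open ≈-Reasoning

idempotent-trivial : ∀ u → (u ++ u) ≈B u → u ≈B []
idempotent-trivial u e = begin
  u                        ≡⟨ ++-identityʳ u ⟨
  u ++ []                  ≈⟨ ≈-++ˡ u (inverseʳ u) ⟨
  u ++ u ++ u ⁻¹           ≡⟨ ++-assoc u u _ ⟨
  (u ++ u) ++ u ⁻¹         ≈⟨ ≈-++ e ≈-refl ⟩
  u ++ u ⁻¹                ≈⟨ inverseʳ u ⟩
  []                       ∎
  where open ≈-Reasoning

-- The identity element of the semigroup is idempotent, hence trivial in B₅.
group⇒identity : ∀ B → IsGroupGen B → IdentityIn B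
group⇒identity B (e , e∈@(w , ws , w∈ , ws∈ , p) , h) =
  w , ws , w∈ , ws∈ , ≈-trans p (idempotent-trivial e (proj₁ (h e e∈)))

module Generated {A : Set} (f : A → Word) (as : List A) (as-complete : ∀ a → a ∈ as) where

  product : List A → Word
  product = concat ∘ map f

  product-++ : ∀ xs ys → product (xs ++ ys) ≡ product xs ++ product ys
  product-++ xs ys = trans (cong concat (map-++ f xs ys)) (sym (concat-++ (map f xs) (map f ys)))

  generated : ∀ {x} a xs → product (a ∷ xs) ≈B x → x ∈⟨ map f as ⟩
  generated a xs e = f a , map f xs , ∈-map⁺ f (as-complete a) , Allₚ.map⁺ (All.universal (λ a → ∈-map⁺ f (as-complete a)) xs) , e

  generators : ∀ {x} → x ∈⟨ map f as ⟩ → ∃[ a ] ∃[ xs ] product (a ∷ xs) ≈B x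
  generators {x} (w , ws , w∈ , ws∈ , e) with ∈-map⁻ f w∈ | preimages ws ws∈
    where
    preimages : ∀ ws → All (_∈ map f as) ws → ∃[ xs ] ws ≡ map f xs
    preimages [] [] = [] , refl
    preimages (w ∷ ws) (p ∷ ps) with ∈-map⁻ f p | preimages ws ps
    ... | a , _ , refl | xs , refl = a ∷ xs , refl
  ... | a , _ , refl | xs , refl = a , xs , e

  module _ (invertible : ∀ a → ∃[ xs ] ∃[ ys ] product (xs ++ a ∷ ys) ≈B []) where

    -- Rotating an identity `us a vs` exhibits `vs us` as an inverse of `a`.
    inverses : ∀ xs → ∃[ ys ] (product xs ++ product ys) ≈B []
    inverses [] = [] , ≈-refl
    inverses (a ∷ xs) with inverses xs | invertible a
    ... | ys , e | us , vs , e′ = ys ++ vs ++ us , (begin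
      (f a ++ product xs) ++ product (ys ++ vs ++ us)            ≡⟨ ++-assoc (f a) _ _ ⟩
      f a ++ product xs ++ product (ys ++ vs ++ us)              ≡⟨ cong (λ z → f a ++ product xs ++ z) (product-++ ys _) ⟩
      f a ++ product xs ++ product ys ++ product (vs ++ us)      ≡⟨ cong (f a ++_) (++-assoc (product xs) _ _) ⟨
      f a ++ (product xs ++ product ys) ++ product (vs ++ us)    ≈⟨ ≈-context (f a) _ e ⟩
      f a ++ product (vs ++ us)                                  ≡⟨ cong (f a ++_) (product-++ vs us) ⟩
      f a ++ product vs ++ product us                            ≡⟨ ++-assoc (f a) _ _ ⟨
      product (a ∷ vs) ++ product us                             ≈⟨ ≈-rotate (product us) _ (≈-trans (≈-reflexive (sym (product-++ us (a ∷ vs)))) e′) ⟩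
      []                                                         ∎)
      where open ≈-Reasoning

    isGroup : A → IsGroupGen (map f as)
    isGroup a₀ = [] , unit , λ x x∈ → ≈-refl , ≈-reflexive (++-identityʳ x) , inverse x x∈
      where
      trivial : ∃[ a ] ∃[ xs ] product (a ∷ xs) ≈B []
      trivial with invertible a₀
      ... | [] , ys , e = a₀ , ys , e
      ... | x ∷ xs , ys , e = x , xs ++ a₀ ∷ ys , e
      unit : [] ∈⟨ map f as ⟩
      unit = let a , xs , e = trivial in generated a xs e
      inverse : ∀ x → x ∈⟨ map f as ⟩ → Σ Word λ y → y ∈⟨ map f as ⟩ × ((x ++ y) ≈B []) × ((y ++ x) ≈B [])
      inverse x x∈ =
        let b , bs , e = generators x∈
            ys , i = inverses (b ∷ bs)
            a , xs , t = trivial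
            y = product ys
            xy : (x ++ y) ≈B []
            xy = ≈-trans (≈-++ (≈-sym e) ≈-refl) i
        -- Elements of the semigroup are non-empty products, and `ys` might be empty; the trivial
        -- product `a ∷ xs` is put in front of it.
        in y , generated a (xs ++ ys) (≈-trans (≈-reflexive (product-++ (a ∷ xs) ys)) (≈-++ t ≈-refl)) , xy , ≈-rotate x y xy

module FromComponents {N : ℕ} (C₁ C₂ : Component (Fin (suc N)))
  (f₁ : Component.X C₁ → ℕ) (f₁-injective : ∀ x y → f₁ x ≡ f₁ y → x ≡ y)
  (f₂ : Component.X C₂ → ℕ) (f₂-injective : ∀ x y → f₂ x ≡ f₂ y → x ≡ y) where

  private
    E : Set
    E = Fin (suc N)
    module W₁ = Words C₁
    module W₂ = Words C₂

  braidOf : Gen E → Word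
  braidOf g = toBraid (map (signedCode f₁) (W₁.word g)) (map (signedCode f₂) (W₂.word g))

  ofKind : Kind → List (Gen E)
  ofKind j = turn j ∷ map (write j) (allFin (suc N)) ++ map (erase j) (allFin (suc N))

  others : List (Gen E)
  others = concatMap ofKind (allFin 6)

  gens : List (Gen E)
  gens = map seed (allFin 6) ++ others

  others-complete : ∀ {j g} → g ∈ ofKind j → g ∈ gens
  others-complete {j} p = ∈-++⁺ʳ (map seed (allFin 6)) (∈-concatMap⁺ ofKind (Any.map (λ { refl → p }) (∈-allFin j)))

  gens-complete : ∀ g → g ∈ gens
  gens-complete (seed j) = ∈-++⁺ˡ (∈-map⁺ seed (∈-allFin j))
  gens-complete (turn j) = others-complete (here refl)
  gens-complete (write j e) = others-complete (there (∈-++⁺ˡ (∈-map⁺ (write j) (∈-allFin e))))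
  gens-complete (erase j e) = others-complete (there (∈-++⁺ʳ (map (write j) (allFin (suc N))) (∈-map⁺ (erase j) (∈-allFin e))))

  open Generated braidOf gens gens-complete

  product-toBraid : ∀ gs → product gs ≈B toBraid (map (signedCode f₁) (W₁.words gs)) (map (signedCode f₂) (W₂.words gs))
  product-toBraid [] = ≈-refl
  product-toBraid (g ∷ gs) = begin
    braidOf g ++ product gs
      ≈⟨ ≈-++ˡ (braidOf g) (product-toBraid gs) ⟩
    toBraid (c₁ (W₁.word g)) (c₂ (W₂.word g)) ++ toBraid (c₁ (W₁.words gs)) (c₂ (W₂.words gs))
      ≈⟨ toBraid-++ (c₁ (W₁.word g)) (c₂ (W₂.word g)) (c₁ (W₁.words gs)) (c₂ (W₂.words gs)) ⟩
    toBraid (c₁ (W₁.word g) ++ c₁ (W₁.words gs)) (c₂ (W₂.word g) ++ c₂ (W₂.words gs))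
      ≡⟨ cong₂ toBraid (joined₁ g gs) (joined₂ g gs) ⟩
    toBraid (c₁ (W₁.words (g ∷ gs))) (c₂ (W₂.words (g ∷ gs))) ∎
    where
    open ≈-Reasoning
    c₁ = map (signedCode f₁)
    c₂ = map (signedCode f₂)
    joined₁ : ∀ g gs → c₁ (W₁.word g) ++ c₁ (W₁.words gs) ≡ c₁ (W₁.words (g ∷ gs))
    joined₁ g gs = sym (trans (cong c₁ (word-words C₁ g gs)) (map-++ _ (W₁.word g) (W₁.words gs)))
    joined₂ : ∀ g gs → c₂ (W₂.word g) ++ c₂ (W₂.words gs) ≡ c₂ (W₂.words (g ∷ gs))
    joined₂ g gs = sym (trans (cong c₂ (word-words C₂ g gs)) (map-++ _ (W₂.word g) (W₂.words gs)))

  identity⇒block : IdentityIn (map braidOf gens) → ∃[ b ] Triv (W₁.body b) × Triv (W₂.body b)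
  identity⇒block i =
    let g , gs , e = generators i
        p , q = toBraid-faithful (map (signedCode f₁) (W₁.words (g ∷ gs))) (map (signedCode f₂) (W₂.words (g ∷ gs)))
                  (≈-trans (≈-sym (product-toBraid (g ∷ gs))) e)
    in common-block C₁ C₂ g gs (triv-decode f₁ f₁-injective (W₁.words (g ∷ gs)) p)
                               (triv-decode f₂ f₂-injective (W₂.words (g ∷ gs)) q)

  Solution : List E → Set
  Solution αs = Triv (W₁.body (αs , reverse αs)) × Triv (W₂.body (αs , reverse αs))

  -- Six equal blocks run once through all kinds, so the path closes up and meets every seed and
  -- every turn.
  circuit : List E → List (Gen E)
  circuit αs = blocks (# 0) (replicate 6 (αs , reverse αs))

  segment-path : ∀ {j b} αs βs {gs : List (Gen E)} → Path (false , j) gs b → Path (true , j) (segment j αs βs gs) b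
  segment-path [] βs p = refl ∷ go βs p
    where
    go : ∀ {j b} βs {gs : List (Gen E)} → Path (false , j) gs b → Path (false , j) (map (erase j) βs ++ gs) b
    go [] p = p
    go (e ∷ βs) p = refl ∷ go βs p
  segment-path (e ∷ αs) βs p = refl ∷ segment-path αs βs p

  blocks-path : ∀ j (bs : List (List E × List E)) → Path (false , j) (blocks j bs) (false , advance (length bs) j)
  blocks-path j [] = []
  blocks-path j ((αs , βs) ∷ bs) = refl ∷ segment-path αs βs (blocks-path (succ j) bs)

  circuit-trivial : ∀ αs → Solution αs → product (circuit αs) ≈B []
  circuit-trivial αs (p , q) = ≈-trans (product-toBraid (circuit αs)) (toBraid-triv
    (triv-code f₁ (loop-words C₁ path (blocks-mids C₁ (# 0) b (replicate 5 b) refl (p ∷ p ∷ p ∷ p ∷ p ∷ p ∷ []))))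
    (triv-code f₂ (loop-words C₂ path (blocks-mids C₂ (# 0) b (replicate 5 b) refl (q ∷ q ∷ q ∷ q ∷ q ∷ q ∷ [])))))
    where
    b = αs , reverse αs
    path : Path (false , # 0) (circuit αs) (false , # 0)
    path = blocks-path (# 0) (replicate 6 b)

  segment-∈ˡ : ∀ j αs βs {gs g} → g ∈ segment j αs βs [] → g ∈ segment {E} j αs βs gs
  segment-∈ˡ j (e ∷ αs) βs (here refl) = here refl
  segment-∈ˡ j (e ∷ αs) βs (there p) = there (segment-∈ˡ j αs βs p)
  segment-∈ˡ j [] βs (here refl) = here refl
  segment-∈ˡ j [] βs (there p) = there (∈-++⁺ˡ (subst (_ ∈_) (++-identityʳ (map (erase j) βs)) p))

  segment-∈ʳ : ∀ j αs βs {gs g} → g ∈ gs → g ∈ segment {E} j αs βs gs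
  segment-∈ʳ j (e ∷ αs) βs p = there (segment-∈ʳ j αs βs p)
  segment-∈ʳ j [] βs p = there (∈-++⁺ʳ (map (erase j) βs) p)

  block-∈ : ∀ m n j αs βs {g} → g ∈ seed (advance m j) ∷ segment (succ (advance m j)) αs βs [] →
    g ∈ blocks {E} j (replicate (m + suc n) (αs , βs))
  block-∈ zero n j αs βs (here refl) = here refl
  block-∈ zero n j αs βs (there p) = there (segment-∈ˡ (succ j) αs βs p)
  block-∈ (suc m) n j αs βs p = there (segment-∈ʳ (succ j) αs βs (block-∈ m n (succ j) αs βs p))

  circuit-∈ : ∀ j αs {g} → g ∈ seed j ∷ segment (succ j) αs (reverse αs) [] → g ∈ circuit αs
  circuit-∈ zero αs p = block-∈ 0 5 (# 0) αs (reverse αs) p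
  circuit-∈ (suc zero) αs p = block-∈ 1 4 (# 0) αs (reverse αs) p
  circuit-∈ (suc (suc zero)) αs p = block-∈ 2 3 (# 0) αs (reverse αs) p
  circuit-∈ (suc (suc (suc zero))) αs p = block-∈ 3 2 (# 0) αs (reverse αs) p
  circuit-∈ (suc (suc (suc (suc zero)))) αs p = block-∈ 4 1 (# 0) αs (reverse αs) p
  circuit-∈ (suc (suc (suc (suc (suc zero))))) αs p = block-∈ 5 0 (# 0) αs (reverse αs) p

  -- The segment of kind `j` is opened by the seed of the preceding kind, hence the shift by one.
  segment-circuit : ∀ j αs {g} → g ∈ segment j αs (reverse αs) [] → g ∈ circuit αs
  segment-circuit zero αs p = circuit-∈ (# 5) αs (there p)
  segment-circuit (suc zero) αs p = circuit-∈ (# 0) αs (there p)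
  segment-circuit (suc (suc zero)) αs p = circuit-∈ (# 1) αs (there p)
  segment-circuit (suc (suc (suc zero))) αs p = circuit-∈ (# 2) αs (there p)
  segment-circuit (suc (suc (suc (suc zero)))) αs p = circuit-∈ (# 3) αs (there p)
  segment-circuit (suc (suc (suc (suc (suc zero))))) αs p = circuit-∈ (# 4) αs (there p)

  solutions⇒group : (∀ e → ∃[ αs ] Solution αs × e ∈ αs) → IsGroupGen (map braidOf gens)
  solutions⇒group solve = isGroup invertible (turn (# 0))
    where
    split : ∀ αs {g} → Solution αs → g ∈ circuit αs → ∃[ xs ] ∃[ ys ] product (xs ++ g ∷ ys) ≈B []
    split αs s p with ∈-∃++ p
    ... | xs , ys , e = xs , ys , subst (λ gs → product gs ≈B []) e (circuit-trivial αs s)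
    invertible : ∀ g → ∃[ xs ] ∃[ ys ] product (xs ++ g ∷ ys) ≈B []
    invertible (seed j) = let αs , s , _ = solve zero in split αs s (circuit-∈ j αs (here refl))
    invertible (turn j) = let αs , s , _ = solve zero in split αs s (segment-circuit j αs (∈-++⁺ʳ (map (write j) αs) (here refl)))
    invertible (write j e) = let αs , s , p = solve e in split αs s (segment-circuit j αs (∈-++⁺ˡ (∈-map⁺ (write j) p)))
    invertible (erase j e) = let αs , s , p = solve e in split αs s (segment-circuit j αs
      (∈-++⁺ʳ (map (write j) αs) (there (∈-++⁺ˡ (∈-map⁺ (erase j) (reverse⁺ p))))))

-- Instances and the diagonal argument

open import Data.Nat.Properties using (1+n≢0)
open import Data.Fin.Properties using (toℕ-injective)
open FreeSquare using (left; right; toBraid)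
open Circuits
open CounterMachine
open Compilation hiding (dec)
open Arithmetisation
open Numbering

contentSigned : Signed (Symbol (Maybe Sym)) → Signed ℕ
contentSigned = signedCode contentCode

-- The generator seed j is the only one that depends on the input n, through the word
-- L init 0ⁿ R # in its second component.
seedLeft seedPrefix seedSuffix : Kind → SWord ℕ
seedLeft j = map contentSigned
  (neg (node (false , j)) ∷ pos (bracket j) ∷ neg (bracket (succ j)) ∷ pos (node (true , succ j)) ∷ [])
seedPrefix j = map contentSigned
  (neg (node (false , j)) ∷ pos (bracket j) ∷ neg (bracket (succ j)) ∷ pos (symbol (just L)) ∷ pos (symbol (just init)) ∷ [])
seedSuffix j = map contentSigned
  (pos (symbol (just R)) ∷ pos (symbol nothing) ∷ pos (node (true , succ j)) ∷ [])

digit : Signed ℕ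
digit = contentSigned (pos (symbol (just (reg 0))))

seedRight : Kind → ℕ → SWord ℕ
seedRight j n = seedPrefix j ++ replicate n digit ++ seedSuffix j

seedCode : Kind → Code 1
seedCode j = powerCode (concatMap left (seedLeft j) ++ concatMap right (seedPrefix j)) (right digit) (concatMap right (seedSuffix j))

seed-ev : ∀ j n → Ev (seedCode j) (n ∷ []) (encWord (toBraid (seedLeft j) (seedRight j n)))
seed-ev j n = subst (λ w → Ev (seedCode j) (n ∷ []) (encWord w)) split
  (power-ev (concatMap left (seedLeft j) ++ concatMap right (seedPrefix j)) (right digit) (concatMap right (seedSuffix j)) n)
  where
  open ≡-Reasoning
  A B C : Word
  A = concatMap left (seedLeft j)
  B = concatMap right (seedPrefix j)
  C = concatMap right (seedSuffix j)
  powers : ∀ n → power n (right digit) ++ C ≡ concatMap right (replicate n digit ++ seedSuffix j)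
  powers zero = refl
  powers (suc n) = trans (++-assoc (right digit) _ _) (cong (right digit ++_) (powers n))
  split : (A ++ B) ++ power n (right digit) ++ C ≡ toBraid (seedLeft j) (seedRight j n)
  split = begin
    (A ++ B) ++ power n (right digit) ++ C                             ≡⟨ ++-assoc A B _ ⟩
    A ++ B ++ power n (right digit) ++ C                               ≡⟨ cong (λ z → A ++ B ++ z) (powers n) ⟩
    A ++ B ++ concatMap right (replicate n digit ++ seedSuffix j)      ≡⟨ cong (A ++_) (concatMap-++ right (seedPrefix j) (replicate n digit ++ seedSuffix j)) ⟨
    toBraid (seedLeft j) (seedRight j n)                               ∎

opaque
  -- No program enters here: the seeds contain only nodes, brackets, the separator and the letters
  -- of an initial word. So `instanceCode` is available before the program whose rules make up `T`
  -- is chosen.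
  instanceOf : ℕ → List Word → List Word
  instanceOf n T = map (λ j → toBraid (seedLeft j) (seedRight j n)) (allFin 6) ++ T

  instanceCode : Code 1
  instanceCode = familyCode seedCode (allFin 6)

  instance-ev : ∀ T → Ev instanceCode (encSet T ∷ []) (encSet (instanceOf (encSet T) T))
  instance-ev T = family-ev {f = seedCode} T (λ j → seed-ev j (encSet T)) (allFin 6)

module Instance (Q : List Cmd) where

  open Machine Q

  numbers-injective : ∀ (i j : E) → toℕ i ≡ toℕ j → i ≡ j
  numbers-injective _ _ = toℕ-injective

  module At (n : ℕ) = FromComponents history (content (initial n)) toℕ numbers-injective contentCode contentCode-injective

  -- The input `0` is an arbitrary choice, since `start` enters only the words of seeds.
  fixed : List Word
  fixed = map (At.braidOf 0) (At.others 0)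

  seed-braid : ∀ n j → toBraid (seedLeft j) (seedRight j n) ≡ At.braidOf n (seed j)
  seed-braid n j = cong (λ w → toBraid (seedLeft j) (seedPrefix j ++ w)) (go n)
    where
    go : ∀ n → replicate n digit ++ seedSuffix j ≡
      map contentSigned (map (λ x → pos (symbol x)) (map just (map reg (replicate n 0) ++ R ∷ []) ++ nothing ∷ []) ++ pos (node (true , succ j)) ∷ [])
    go zero = refl
    go (suc n) = cong (digit ∷_) (go n)

  opaque
    unfolding instanceOf

    inst-gens : ∀ n → instanceOf n fixed ≡ map (At.braidOf n) (At.gens n)
    inst-gens n = begin
      map (λ j → toBraid (seedLeft j) (seedRight j n)) (allFin 6) ++ fixed  ≡⟨ cong₂ _++_ (map-cong (seed-braid n) (allFin 6)) (same (At.others 0) nonSeeds) ⟩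
      map (At.braidOf n ∘ seed) (allFin 6) ++ map (At.braidOf n) (At.others n)  ≡⟨ cong (_++ map (At.braidOf n) (At.others n)) (map-∘ {g = At.braidOf n} {f = seed} (allFin 6)) ⟩
      map (At.braidOf n) (map seed (allFin 6)) ++ map (At.braidOf n) (At.others n)  ≡⟨ map-++ (At.braidOf n) (map seed (allFin 6)) (At.others n) ⟨
      map (At.braidOf n) (At.gens n) ∎
      where
      open ≡-Reasoning
      nonSeeds : All NonSeed (At.others 0)
      nonSeeds = Allₚ.concat⁺ (Allₚ.map⁺ (All.universal (λ j → turn j ∷ Allₚ.++⁺
        (Allₚ.map⁺ (All.universal (λ e → write j e) (allFin _))) (Allₚ.map⁺ (All.universal (λ e → erase j e) (allFin _)))) (allFin 6)))
      same : ∀ gs → All NonSeed gs → map (At.braidOf 0) gs ≡ map (At.braidOf n) gs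
      same [] [] = refl
      same (_ ∷ gs) (write j e ∷ ns) = cong (_ ∷_) (same gs ns)
      same (_ ∷ gs) (turn j ∷ ns) = cong (_ ∷_) (same gs ns)
      same (_ ∷ gs) (erase j e ∷ ns) = cong (_ ∷_) (same gs ns)

  block⇒halts : ∀ n → ∃[ b ] Triv (Words.body history b) × Triv (Words.body (content (initial n)) b) →
    Halts Q (count (replicate n 0))
  block⇒halts n (b , p , q) = initial-sound n (proj₁ b) (bodies⇒solves (initial n) b p q)

  identity⇒halts : ∀ n → IdentityIn (instanceOf n fixed) → Halts Q (count (replicate n 0))
  identity⇒halts n i = block⇒halts n (At.identity⇒block n (subst IdentityIn (inst-gens n) i))

  solution : ∀ n {e} → ∃[ α ] Solves (initial n) α × e ∈ α → ∃[ α ] At.Solution n α × e ∈ α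
  solution n (α , s , e∈) = α , solves⇒bodies (initial n) α s , e∈

  halts⇒group : ∀ n → Halts Q (count (replicate n 0)) → IsGroupGen (instanceOf n fixed)
  halts⇒group n h = subst IsGroupGen (sym (inst-gens n))
    (At.solutions⇒group n λ e → solution n (solves-using-every n h e))

-- The final loop restores the register it decrements, so it ends only if the computed value is
-- zero; halting thus expresses the answer 0.
zeroTest : Code 1 → List Cmd
zeroTest c = compile c (0 ∷ []) 1 2 ++ loop 1 (inc 1 ∷ []) ∷ []

module _ (c : Code 1) (n : ℕ) where

  private
    store : Store
    store = count (replicate n 0)

  zeroTest-ready : Ready (0 ∷ []) (n ∷ []) 1 2 store
  zeroTest-ready = record
    { values = λ { zero → zeros n } ; below = λ { zero → s≤s z≤n } ; distinct = λ { zero () }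
    ; o<b = s≤s (s≤s z≤n) ; o-zero = others n 0 ; zeros = λ { (suc x) _ → others n x } }
    where
    zeros : ∀ n → count (replicate n 0) 0 ≡ n
    zeros zero = refl
    zeros (suc n) = cong suc (zeros n)
    others : ∀ n x → count (replicate n 0) (suc x) ≡ 0
    others zero x = refl
    others (suc n) x = others n x

  zeroTest-runs : ∀ {y} → Ev c (n ∷ []) y → ∃[ s ] s 1 ≡ y × (zeroTest c , store) ≅ (loop 1 (inc 1 ∷ []) ∷ [] , s)
  zeroTest-runs e = let s , u , q = compile-correct e zeroTest-ready in s , value u , q (loop 1 (inc 1 ∷ []) ∷ [])

  diverges : ∀ {s} → s 1 ≢ 0 → ¬ Halts (loop 1 (inc 1 ∷ []) ∷ []) s
  diverges n (leave z _) = n z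
  diverges n (enter _ (incr h)) = diverges (λ ()) h

  zeroTest-halts : Ev c (n ∷ []) 0 → Halts (zeroTest c) store
  zeroTest-halts e = let s , v , q = zeroTest-runs e in from q (leave v halt)

  zeroTest-diverges : ∀ {y} → Ev c (n ∷ []) (suc y) → ¬ Halts (zeroTest c) store
  zeroTest-diverges e h = let s , v , q = zeroTest-runs e in diverges (λ z → 1+n≢0 (trans (sym v) z)) (to q h)

-- The machine for `answer c` determines the list `T` of fixed generators, and is then given the
-- code of `T` as its input.
answer : Code 1 → Code 1
answer c = comp c (instanceCode ∷ [])

-- The program is run on the code of T, so it halts iff c answers 0 on the instance built from T.
diagonal : ∀ c T (P : Set) →
  (P → Halts (zeroTest (answer c)) (count (replicate (encSet T) 0))) →
  (Halts (zeroTest (answer c)) (count (replicate (encSet T) 0)) → P) →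
  ¬ (∃[ n ] ((eval n c (encSet (instanceOf (encSet T) T) ∷ []) ≡ just 1 × P) ⊎
             (eval n c (encSet (instanceOf (encSet T) T) ∷ []) ≡ just 0 × ¬ P)))
diagonal c T P P⇒halts halts⇒P = λ where
    (n , inj₁ (e , p)) → zeroTest-diverges (answer c) (encSet T) (ev n e) (P⇒halts p)
    (n , inj₂ (e , ¬p)) → ¬p (halts⇒P (zeroTest-halts (answer c) (encSet T) (ev n e)))
  where
  ev : ∀ n {y} → eval n c (encSet (instanceOf (encSet T) T) ∷ []) ≡ just y → Ev (answer c) (encSet T ∷ []) y
  ev n e = comp (instance-ev T ∷ []) (eval-Ev n c _ e)

-- For the instance used, halting implies the group property and follows from the presence of the
-- identity. Any property between the two is therefore equivalent to halting, and both problems are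
-- covered at once.
undecidable : ∀ (P : List Word → Set) → (∀ B → IsGroupGen B → P B) → (∀ B → P B → IdentityIn B) → ∀ c → ¬ Decides c P
undecidable P group⇒P P⇒identity c d = diagonal c fixed (P (instanceOf (encSet fixed) fixed))
  (λ p → identity⇒halts (encSet fixed) (P⇒identity _ p)) (λ h → group⇒P _ (halts⇒group (encSet fixed) h))
  (d (instanceOf (encSet fixed) fixed))
  where open Instance (zeroTest (answer c))

theorem3 : (¬ (∃[ c ] Decides c IdentityIn)) × (¬ (∃[ c ] Decides c IsGroupGen))
theorem3 =
  (λ (c , d) → undecidable IdentityIn group⇒identity (λ _ → id) c d) ,
  (λ (c , d) → undecidable IsGroupGen (λ _ → id) group⇒identity c d)
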